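{- Let $G=(V,E)$ be a finite undirected graph. The system $$\tfrac12\, x(C)\ge 0\quad\text{for all circuits } C \text{ of } G$$ in the variables $x\in\mathbb{R}^E$ is box-TDI if and only if $G$ is series-parallel.
   Context: For $C\subseteq E$, $x(C)=\sum_{e\in C}x_e$. A circuit of $G$ is a set of edges inducing a connected subgraph in which every vertex has degree two. A graph is series-parallel if and only if it has no $K_4$ minor, where the minors of a graph are the graphs obtained by repeatedly contracting edges and deleting edges and isolated vertices. A rational linear system $Ax\le b$ is totally dual integral (TDI) if for every integer vector $w$ for which the optimum in $\max\{w^\top x:Ax\le b\}=\min\{b^\top y: A^\top y=w,\ y\ge \mathbf{0}\}$ is finite, the minimum is attained by an integer vector $y$. The system $Ax\le b$ is box-TDI if the system $Ax\le b,\ \ell\le x\le u$ is TDI for all rational vectors $\ell,u$. A system of "$\ge$" inequalities is read as a system of "$\le$" inequalities by multiplying each inequality by $-1$.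
   Formalization: The variables x and the dual multipliers y in the definition of (box-)TDI range over the rationals instead of the reals; the data w, ℓ, u and the system are integral or rational as in the original. -}

module Defs where

open import Data.Bool.Base using (if_then_else_)
open import Data.Fin.Base using (Fin; punchIn)
open import Data.Fin.Patterns using (0F; 1F; 2F; 3F)
open import Data.Fin.Properties using (_≟_; any?; all?)
open import Data.Fin.Subset using (Subset; inside; outside; _∈_; _∉_; _⊃_; _∪_; ⁅_⁆; Nonempty)
open import Data.Fin.Subset.Induction using (Acc; acc; ⊃-wellFounded)
open import Data.Fin.Subset.Properties
  using (_∈?_; nonempty?; x∈⁅x⁆; x∈⁅y⁆⇒x≡y; x∈p∪q⁻; p⊆p∪q; q⊆p∪q)
open import Data.Integer.Base as ℤ using (ℤ)
open import Data.List.Base as List using (List; []; _∷_; _++_; length; filter; allFin)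
open import Data.Nat.Base as ℕ using (ℕ)
import Data.Nat.Properties as ℕ using (_≟_)
open import Data.Product.Base using (Σ; ∃-syntax; _×_; _,_; proj₁; proj₂)
open import Data.Product.Properties using (≡-dec)
open import Data.Rational.Base as ℚ using (ℚ; 0ℚ; 1ℚ; ½)
open import Data.Sum.Base using (_⊎_; inj₁; inj₂)
open import Data.Vec.Base as Vec using ([]; _∷_)
open import Data.Vec.Functional using (Vector)
open import Function.Base using (_∘_)
open import Function.Bundles using (_⇔_; _↔_; Inverse)
open import Function.Definitions using (Surjective)
open import Relation.Binary.Construct.Closure.ReflexiveTransitive using (Star; ε; _◅_; _◅◅_)
open import Relation.Binary.PropositionalEquality using (_≡_; sym; subst)
open import Relation.Nullary
  using (¬_; Dec; yes; no; does; ¬?; _×-dec_; _⊎-dec_; _→-dec_; decidable-stable)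
open import Relation.Nullary.Decidable using (map′)
open import Relation.Unary using (Pred)
open import Level using (0ℓ)

import Algebra.Definitions.RawMonoid ℕ.+-0-rawMonoid as Sumℕ
import Algebra.Definitions.RawMonoid ℚ.+-0-rawMonoid as Sumℚ

------------------------------------------------------------------------
-- Graphs

-- Loops and parallel edges are allowed (contraction creates them).  Edges
-- are undirected: no notion below depends on the order of the two ends.

record Graph : Set where
  constructor graph
  field
    {#V #E} : ℕ
    ends    : Fin #E → Fin #V × Fin #V

Joins : ∀ {V : Set} → V × V → V → V → Set
Joins p u v = p ≡ (u , v) ⊎ p ≡ (v , u)

module _ (G : Graph) where
  open Graph G

  Incident : Fin #E → Fin #V → Set
  Incident e v = proj₁ (ends e) ≡ v ⊎ proj₂ (ends e) ≡ v

  -- v is a vertex of the subgraph induced by the edge set C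
  Covers : Subset #E → Fin #V → Set
  Covers C v = ∃[ e ] (e ∈ C × Incident e v)

  Adjacent : Subset #E → Fin #V → Fin #V → Set
  Adjacent C u v = ∃[ e ] (e ∈ C × Joins (ends e) u v)

  -- a loop contributes 2
  degree : Subset #E → Fin #V → ℕ
  degree C v = Sumℕ.sum λ e →
    if Vec.lookup C e
    then (if does (proj₁ (ends e) ≟ v) then 1 else 0) ℕ.+
         (if does (proj₂ (ends e) ≟ v) then 1 else 0)
    else 0

  Connected : Subset #E → Set
  Connected C = ∀ u v → Covers C u → Covers C v → Star (Adjacent C) u v

  Circuit : Subset #E → Set
  Circuit C = Nonempty C × Connected C × (∀ v → Covers C v → degree C v ≡ 2)

-- Reachability in a finite decidable relation: enlarge the set S of vertices
-- known to be reachable from u until no step leaves it.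

module _ {n} {R : Fin n → Fin n → Set} (R? : ∀ a b → Dec (R a b)) where

  private
    closed : ∀ {S : Subset n} {a b} →
             ¬ (∃[ a ] ∃[ b ] (a ∈ S × b ∉ S × R a b)) →
             a ∈ S → Star R a b → b ∈ S
    closed stuck a∈S ε = a∈S
    closed {S} stuck a∈S (_◅_ {j = c} r rs) =
      closed stuck (decidable-stable (c ∈? S) λ c∉S → stuck (_ , _ , a∈S , c∉S , r)) rs

    grow : ∀ u (S : Subset n) → Acc _⊃_ S → u ∈ S → (∀ v → v ∈ S → Star R u v) →
           ∀ v → Dec (Star R u v)
    grow u S (acc rec) u∈S reach v
      with any? (λ a → any? (λ b → (a ∈? S) ×-dec ¬? (b ∈? S) ×-dec R? a b))
    ... | no stuck = map′ (reach v) (closed stuck u∈S) (v ∈? S)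
    ... | yes (a , b , a∈S , b∉S , r) =
      grow u (S ∪ ⁅ b ⁆)
           (rec (p⊆p∪q ⁅ b ⁆ , b , q⊆p∪q S ⁅ b ⁆ (x∈⁅x⁆ b) , b∉S))
           (p⊆p∪q ⁅ b ⁆ u∈S) reach′ v
      where
      reach′ : ∀ w → w ∈ S ∪ ⁅ b ⁆ → Star R u w
      reach′ w w∈ with x∈p∪q⁻ S ⁅ b ⁆ w∈
      ... | inj₁ w∈S = reach w w∈S
      ... | inj₂ w∈b = subst (Star R u) (sym (x∈⁅y⁆⇒x≡y b w∈b)) (reach a a∈S ◅◅ (r ◅ ε))

  star? : ∀ u v → Dec (Star R u v)
  star? u = grow u ⁅ u ⁆ (⊃-wellFounded ⁅ u ⁆) (x∈⁅x⁆ u)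
    λ v v∈ → subst (λ w → Star R w v) (x∈⁅y⁆⇒x≡y u v∈) ε

module _ (G : Graph) where
  open Graph G

  covers? : ∀ C v → Dec (Covers G C v)
  covers? C v = any? λ e →
    (e ∈? C) ×-dec ((proj₁ (ends e) ≟ v) ⊎-dec (proj₂ (ends e) ≟ v))

  adjacent? : ∀ C u v → Dec (Adjacent G C u v)
  adjacent? C u v = any? λ e →
    (e ∈? C) ×-dec (≡-dec _≟_ _≟_ (ends e) (u , v) ⊎-dec ≡-dec _≟_ _≟_ (ends e) (v , u))

  connected? : ∀ C → Dec (Connected G C)
  connected? C = all? λ u → all? λ v →
    covers? C u →-dec (covers? C v →-dec star? (adjacent? C) u v)

  circuit? : ∀ C → Dec (Circuit G C)
  circuit? C = nonempty? C ×-dec connected? C ×-dec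
    all? λ v → covers? C v →-dec (degree G C v ℕ.≟ 2)

subsets : ∀ n → List (Subset n)
subsets ℕ.zero    = [] ∷ []
subsets (ℕ.suc n) = List.map (outside ∷_) (subsets n) ++ List.map (inside ∷_) (subsets n)

circuits : (G : Graph) → List (Subset (Graph.#E G))
circuits G = filter (circuit? G) (subsets (Graph.#E G))

------------------------------------------------------------------------
-- Minors

infix 4 _⟶_ _≅_

mapEnds : ∀ {A B : Set} → (A → B) → A × A → B × B
mapEnds f (u , v) = f u , f v

data _⟶_ : Graph → Graph → Set where

  delete-edge : ∀ {n m} {ends : Fin (ℕ.suc m) → Fin n × Fin n} (e : Fin (ℕ.suc m)) →
    graph ends ⟶ graph (ends ∘ punchIn e)

  -- φ is the quotient map identifying the two ends of e and nothing else;
  -- contracting a loop just removes it.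
  contract-edge : ∀ {n n′ m} {ends : Fin (ℕ.suc m) → Fin n × Fin n} (e : Fin (ℕ.suc m))
    (φ : Fin n → Fin n′) →
    Surjective _≡_ _≡_ φ →
    (∀ u v → φ u ≡ φ v ⇔ (u ≡ v ⊎ Joins (ends e) u v)) →
    graph ends ⟶ graph (mapEnds φ ∘ ends ∘ punchIn e)

  -- v is isolated because punchIn v never takes the value v.
  delete-vertex : ∀ {n m} {ends : Fin m → Fin (ℕ.suc n) × Fin (ℕ.suc n)}
    {ends′ : Fin m → Fin n × Fin n} (v : Fin (ℕ.suc n)) →
    (∀ e → ends e ≡ mapEnds (punchIn v) (ends′ e)) →
    graph ends ⟶ graph ends′

record _≅_ (G H : Graph) : Set where
  private
    module G = Graph G
    module H = Graph H
  field
    vertices : Fin G.#V ↔ Fin H.#V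
    edges    : Fin G.#E ↔ Fin H.#E
    ends-≅   : ∀ e → let (u , v) = mapEnds (Inverse.to vertices) (G.ends e)
                     in Joins (H.ends (Inverse.to edges e)) u v

HasMinor : Graph → Graph → Set
HasMinor G H = ∃[ G′ ] (Star _⟶_ G G′ × G′ ≅ H)

K₄ : Graph
K₄ = graph {4} {6} (Vec.lookup
  ((0F , 1F) ∷ (0F , 2F) ∷ (0F , 3F) ∷ (1F , 2F) ∷ (1F , 3F) ∷ (2F , 3F) ∷ []))

SeriesParallel : Graph → Set
SeriesParallel G = ¬ HasMinor G K₄

------------------------------------------------------------------------
-- Linear systems

infix 8 _·_
infix 4 _≤ᵣ_ _≥ᵣ_

_·_ : ∀ {n} → Vector ℚ n → Vector ℚ n → ℚ
a · x = Sumℚ.sum λ i → a i ℚ.* x i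

fromℤ : ℤ → ℚ
fromℤ z = z ℚ./ 1

-- The pair (a , β) stands for the inequality a·x ≤ β.
Row : ℕ → Set
Row n = Vector ℚ n × ℚ

_≤ᵣ_ : ∀ {n} → Vector ℚ n → ℚ → Row n
a ≤ᵣ β = a , β

_≥ᵣ_ : ∀ {n} → Vector ℚ n → ℚ → Row n
a ≥ᵣ β = (λ e → ℚ.- a e) ≤ᵣ ℚ.- β

System : ℕ → Set
System n = List (Row n)

module _ {n} (S : System n) where

  matrix : Fin (length S) → Vector ℚ n
  matrix i = proj₁ (List.lookup S i)

  rhs : Vector ℚ (length S)
  rhs i = proj₂ (List.lookup S i)

  PrimalFeasible : Vector ℚ n → Set
  PrimalFeasible x = ∀ i → matrix i · x ℚ.≤ rhs i

  DualFeasible : Vector ℚ n → Vector ℚ (length S) → Set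
  DualFeasible w y = (∀ e → (λ i → matrix i e) · y ≡ w e) × (∀ i → 0ℚ ℚ.≤ y i)

  PrimalValue : Vector ℚ n → Pred ℚ 0ℓ
  PrimalValue w v = ∃[ x ] (PrimalFeasible x × w · x ≡ v)

  DualValue : Vector ℚ n → Pred ℚ 0ℓ
  DualValue w v = ∃[ y ] (DualFeasible w y × rhs · y ≡ v)

IsMaximum : Pred ℚ 0ℓ → ℚ → Set
IsMaximum P v = P v × (∀ v′ → P v′ → v′ ℚ.≤ v)

IsMinimum : Pred ℚ 0ℓ → ℚ → Set
IsMinimum P v = P v × (∀ v′ → P v′ → v ℚ.≤ v′)

-- The system is rational, so feasibility, finiteness of the optimum and its
-- value are the same for rational and for real x and y.
TDI : ∀ {n} → System n → Set
TDI {n} S = ∀ (w : Vector ℤ n) (v : ℚ) →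
  IsMaximum (PrimalValue S (fromℤ ∘ w)) v →
  IsMinimum (DualValue S (fromℤ ∘ w)) v →
  Σ (Vector ℤ (length S)) λ y →
    DualFeasible S (fromℤ ∘ w) (fromℤ ∘ y) × rhs S · (fromℤ ∘ y) ≡ v

unit : ∀ {n} → Fin n → Vector ℚ n
unit e f = if does (e ≟ f) then 1ℚ else 0ℚ

box : ∀ {n} → Vector ℚ n → Vector ℚ n → System n
box {n} ℓ u = List.map (λ e → unit e ≥ᵣ ℓ e) (allFin n) ++
              List.map (λ e → unit e ≤ᵣ u e) (allFin n)

BoxTDI : ∀ {n} → System n → Set
BoxTDI {n} S = ∀ (ℓ u : Vector ℚ n) → TDI (S ++ box ℓ u)

-- χ C · x is x(C).
χ : ∀ {n} → Subset n → Vector ℚ n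
χ C e = if Vec.lookup C e then 1ℚ else 0ℚ

halfCircuitSystem : (G : Graph) → System (Graph.#E G)
halfCircuitSystem G = List.map (λ C → (λ e → ½ ℚ.* χ C e) ≥ᵣ 0ℚ) (circuits G)

-- Dual solutions for the system with box constraints minimise a separable
-- convex function, with breakpoints at integers, over the cone of circuits;
-- an integral dual solution needs an integral point c of the cone together
-- with a representation of 2c as a sum of circuits.  Circuits may be replaced
-- by even edge sets, since these are disjoint unions of circuits.
--
-- If there is no K₄ minor, the graph dissolves under deleting loops and
-- bridges, contracting one of two edges at a vertex of degree two and deleting
-- one of two parallel edges (Dirac: otherwise all degrees are at least three in
-- a simple graph, which forces a K₄ minor).  Each reduction preserves that a
-- point c of the cone can be rounded, coordinatewise up or down, to an integral
-- point that is not worse for a given linear objective.  The only interesting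
-- case is a parallel pair: c e and c f are the sides of a triangle whose third
-- side is the flow s through the rest of the graph, and on the vertices of that
-- slice c e and c f are of the form k or k ± s with k integral, so that rounding
-- s first rounds them as well.
--
-- If there is a K₄ minor, giving x = -1/2 to the three edges at one vertex of
-- K₄, 1 to the opposite triangle, 0 to contracted edges and 2 to deleted edges
-- yields an optimum of value 3/2 for integral bounds and weights, whereas an
-- integral dual solution has an integral value.

module Submission where

open import Algebra.Bundles using (CommutativeMonoid; CommutativeRing)
open import Data.Bool.Base using (Bool; true; false; if_then_else_; _∧_; _xor_; not)
import Data.Bool.Properties as Bool
open import Data.Empty using (⊥; ⊥-elim)
open import Data.Fin.Base using (Fin; zero; suc; punchIn; punchOut)
open import Data.Fin.Patterns using (0F; 1F; 2F; 3F; 4F; 5F)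
open import Data.Fin.Properties using (_≟_; any?; all?; punchIn-punchOut; punchOut-injective; punchInᵢ≢i; punchIn-injective; injective⇒≤; punchOut-cong; punchOut-punchIn)
open import Data.Fin.Subset using (Subset; _∈_; _⊂_)
open import Data.Fin.Subset.Induction using (⊂-wellFounded)
open import Data.Integer.Base as ℤ using (ℤ)
import Data.Integer.DivMod as ℤ
import Data.Integer.Properties as ℤ
import Data.Integer.Tactic.RingSolver as ℤ-Solver
open import Data.List.Base as List using (List; []; _∷_; _++_; length; reverse; _ʳ++_)
import Data.List.Membership.DecPropositional as DecMembership
open import Data.List.Membership.Propositional using () renaming (_∈_ to _∈ₗ_)
open import Data.List.Membership.Propositional.Properties using (∈-++⁺ˡ; ∈-++⁺ʳ; ∈-++⁻; ∈-lookup; ∈-map⁺; ∈-filter⁺; ∈-filter⁻)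
open import Data.List.Properties using (++-assoc; ++-ʳ++; ʳ++-defn; length-reverse; length-++)
open import Data.List.Relation.Binary.Permutation.Propositional using (_↭_; ↭-sym; ↭-trans; prep; ↭⇒↭ₛ)
open import Data.List.Relation.Binary.Permutation.Propositional.Properties using (↭-length; shift; ↭-reverse; ++⁺ʳ)
open import Data.List.Relation.Binary.Permutation.Setoid.Properties using (Unique-resp-↭)
import Data.List.Relation.Unary.All as All
import Data.List.Relation.Unary.All.Properties as Allₚ
import Data.List.Relation.Unary.AllPairs as AllPairs
open import Data.List.Relation.Unary.Any as Any using (here; there)
open import Data.List.Relation.Unary.Any.Properties using (lookup-index)
import Data.List.Relation.Unary.Linked as Linked
open import Data.List.Relation.Unary.Unique.Propositional using (Unique)
open import Data.Maybe.Base as Maybe using (Maybe; just; nothing; _>>=_; maybe)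
open import Data.Maybe.Properties using (just-injective) renaming (≡-dec to ≡-decᴹ)
open import Data.Nat.Base as ℕ using (ℕ; zero; suc)
import Data.Nat.Coprimality as Coprime
import Data.Nat.Properties as ℕ
open import Data.Product.Base using (∃-syntax; _×_; _,_; proj₁; proj₂)
open import Data.Product.Properties using (≡-dec)
open import Data.Rational.Base as ℚ using (ℚ; mkℚ; 0ℚ; 1ℚ; ½; ↧_)
import Data.Rational.Base as ℚ-Base
import Data.Rational.Properties as ℚ
open import Data.Sum.Base as Sum using (_⊎_; inj₁; inj₂)
open import Data.Vec.Base as Vec using (lookup; tabulate)
open import Data.Vec.Properties using ([]=⇒lookup; lookup⇒[]=; lookup∘tabulate)
open import Defs
open import Function.Base using (_∘_)
open import Function.Bundles using (_⇔_; Inverse; mk⇔; mk↔ₛ′; Equivalence)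
open import Induction.WellFounded using (Acc; acc)
open import Relation.Binary.Construct.Closure.ReflexiveTransitive using (Star; ε; _◅_; _◅◅_)
open import Relation.Binary.Definitions using (tri<; tri≈; tri>)
open import Relation.Binary.PropositionalEquality
open import Relation.Nullary
open import Relation.Nullary.Decidable using (dec⇒maybe; from-yes)
open import Tactic.RingSolver using (solve; solve-∀)
open import Tactic.RingSolver.Core.AlmostCommutativeRing using (AlmostCommutativeRing; fromCommutativeRing)

-- Rounding of rationals to integers

-- The obstacle is the parallel case. There `s` is itself a coordinate of the smaller problem: it is
-- rounded by the induction hypothesis, against a weight that must be fixed in advance. Hence `c e`
-- and `c f` cannot be rounded to numbers beforehand. They are moved, at fixed `s` and without
-- raising the cost, until they are affine functions of `s` with integral constant term and slope 0,
-- 1 or -1. The slopes determine the weight that `s` receives in the smaller problem, and whatever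
-- value `s` is rounded to there, both functions follow.
--
-- Two choices keep the induction free of reindexing. Vertices and edges stay `Fin n` and `Fin m`
-- throughout; only a set `A` of active edges shrinks, and a contracted edge leaves an isolated
-- vertex behind. The absence of a K₄ minor is carried along as the absence of four connected,
-- pairwise linked branch sets. An even set is one that meets every cut evenly, not only the stars
-- of vertices, since cuts pull back along the identification of vertices.
--
-- No optimum has to be constructed for the direction from minors to integrality: the optimal dual
-- solution supplied by the definition is the one that is rounded.

ℚ-ring : AlmostCommutativeRing _ _
ℚ-ring = fromCommutativeRing ℚ.+-*-commutativeRing λ x → Maybe.map sym (dec⇒maybe (x ℚ.≟ 0ℚ))

module LinearArithmetic where
  open ℚ-Base using (_+_; _-_; -_; _*_; _≤_; nonNegative; nonPositive)

  slack : ∀ {a b} → a ≤ b → 0ℚ ≤ b - a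
  slack {a} {b} a≤b = subst (_≤ b - a) (ℚ.+-inverseʳ a) (ℚ.+-monoˡ-≤ (- a) a≤b)

  -- The form of nearly all linear inequalities below: `d` is a combination of slacks of hypotheses,
  -- and the ring solver identifies it with `b - a`.
  ≤-from : ∀ {a b d} → 0ℚ ≤ d → d ≡ b - a → a ≤ b
  ≤-from {a} {b} 0≤d refl =
    subst₂ _≤_ (ℚ.+-identityˡ a) (lemma a b) (ℚ.+-monoˡ-≤ a 0≤d)
    where
    lemma : ∀ a b → b - a + a ≡ b
    lemma = solve-∀ ℚ-ring

  infixl 6 _⊕_
  infixl 7 _⊗_

  _⊕_ : ∀ {p q} → 0ℚ ≤ p → 0ℚ ≤ q → 0ℚ ≤ p + q
  0≤p ⊕ 0≤q = ℚ.+-mono-≤ 0≤p 0≤q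

  _⊗_ : ∀ {p q} → 0ℚ ≤ p → 0ℚ ≤ q → 0ℚ ≤ p * q
  _⊗_ {p} {q} 0≤p 0≤q = subst (_≤ p * q) (ℚ.*-zeroʳ p)
    (ℚ.*-monoˡ-≤-nonNeg p {{ℚ.nonNegative 0≤p}} 0≤q)

  half-nonneg : ∀ {p} → 0ℚ ≤ p + p → 0ℚ ≤ p
  half-nonneg {p} 0≤2p = subst (0ℚ ≤_) (lemma p) (ℚ.nonNegative⁻¹ ½ ⊗ 0≤2p)
    where
    lemma : ∀ p → ½ * (p + p) ≡ p
    lemma = solve-∀ ℚ-ring

open LinearArithmetic

-- `fromℤ z` normalises a fraction and is stuck on a variable `z`; here the denominator 1 is
-- visible, so order and arithmetic reduce to integers.
integral : ℤ → ℚ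
integral z = mkℚ z 0 (Coprime.sym (Coprime.1-coprimeTo ℤ.∣ z ∣))

fromℤ≡integral : ∀ z → fromℤ z ≡ integral z
fromℤ≡integral z = ℚ.↥p/↧p≡p (integral z)

fromℤ-+ : ∀ a b → fromℤ (a ℤ.+ b) ≡ fromℤ a ℚ.+ fromℤ b
fromℤ-+ a b rewrite fromℤ≡integral a | fromℤ≡integral b
  | ℤ.*-identityʳ a | ℤ.*-identityʳ b = refl

fromℤ-* : ∀ a b → fromℤ (a ℤ.* b) ≡ fromℤ a ℚ.* fromℤ b
fromℤ-* a b rewrite fromℤ≡integral a | fromℤ≡integral b = refl

fromℤ-neg : ∀ a → fromℤ (ℤ.- a) ≡ ℚ.- fromℤ a
fromℤ-neg a = begin
  fromℤ (ℤ.- a)                               ≡⟨ ℚ.+-identityʳ _ ⟨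
  fromℤ (ℤ.- a) ℚ.+ 0ℚ                        ≡⟨ cong (fromℤ (ℤ.- a) ℚ.+_) (ℚ.+-inverseʳ (fromℤ a)) ⟨
  fromℤ (ℤ.- a) ℚ.+ (fromℤ a ℚ.- fromℤ a)     ≡⟨ ℚ.+-assoc (fromℤ (ℤ.- a)) _ _ ⟨
  fromℤ (ℤ.- a) ℚ.+ fromℤ a ℚ.- fromℤ a       ≡⟨ cong (ℚ._- fromℤ a) (fromℤ-+ (ℤ.- a) a) ⟨
  fromℤ (ℤ.- a ℤ.+ a) ℚ.- fromℤ a             ≡⟨ cong (λ z → fromℤ z ℚ.- fromℤ a) (ℤ.+-inverseˡ a) ⟩
  0ℚ ℚ.- fromℤ a                              ≡⟨ ℚ.+-identityˡ _ ⟩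
  ℚ.- fromℤ a                                 ∎
  where open ≡-Reasoning

fromℤ-sub : ∀ a b → fromℤ (a ℤ.- b) ≡ fromℤ a ℚ.- fromℤ b
fromℤ-sub a b = trans (fromℤ-+ a (ℤ.- b)) (cong (fromℤ a ℚ.+_) (fromℤ-neg b))

fromℤ-mono-≤ : ∀ {a b} → a ℤ.≤ b → fromℤ a ℚ.≤ fromℤ b
fromℤ-mono-≤ {a} {b} a≤b rewrite fromℤ≡integral a | fromℤ≡integral b =
  ℚ.*≤* (subst₂ ℤ._≤_ (sym (ℤ.*-identityʳ a)) (sym (ℤ.*-identityʳ b)) a≤b)

fromℤ-cancel-≤ : ∀ {a b} → fromℤ a ℚ.≤ fromℤ b → a ℤ.≤ b
fromℤ-cancel-≤ {a} {b} a≤b rewrite fromℤ≡integral a | fromℤ≡integral b =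
  subst₂ ℤ._≤_ (ℤ.*-identityʳ a) (ℤ.*-identityʳ b) (ℚ.drop-*≤* a≤b)

fromℤ-cancel-< : ∀ {a b} → fromℤ a ℚ.< fromℤ b → a ℤ.< b
fromℤ-cancel-< {a} {b} a<b rewrite fromℤ≡integral a | fromℤ≡integral b =
  subst₂ ℤ._<_ (ℤ.*-identityʳ a) (ℤ.*-identityʳ b) (ℚ.drop-*<* a<b)

record IsFloor (x : ℚ) (f : ℤ) : Set where
  constructor _,_
  field
    below    : fromℤ f ℚ.≤ x
    greatest : ∀ k → fromℤ k ℚ.≤ x → fromℤ k ℚ.≤ fromℤ f

record IsCeiling (x : ℚ) (c : ℤ) : Set where
  constructor _,_
  field
    above : x ℚ.≤ fromℤ c
    least : ∀ k → x ℚ.≤ fromℤ k → fromℤ c ℚ.≤ fromℤ k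

floor : ∀ x → ∃[ f ] IsFloor x f
floor x@(mkℚ n d-1 _) = f , f≤x , greatest
  where
  f : ℤ
  f = n ℤ./ℕ suc d-1
  f≤x : fromℤ f ℚ.≤ x
  f≤x = subst (ℚ._≤ x) (sym (fromℤ≡integral f))
    (ℚ.*≤* (subst (f ℤ.* ↧ x ℤ.≤_) (sym (ℤ.*-identityʳ n)) (ℤ.[n/ℕd]*d≤n n (suc d-1))))
  x<f+1 : x ℚ.< fromℤ (ℤ.suc f)
  x<f+1 = subst (x ℚ.<_) (sym (fromℤ≡integral (ℤ.suc f)))
    (ℚ.*<* (subst (ℤ._< ℤ.suc f ℤ.* ↧ x) (sym (ℤ.*-identityʳ n)) (ℤ.n<s[n/ℕd]*d n (suc d-1))))
  greatest : ∀ k → fromℤ k ℚ.≤ x → fromℤ k ℚ.≤ fromℤ f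
  greatest k k≤x = fromℤ-mono-≤ (subst (k ℤ.≤_) (ℤ.pred-suc f)
    (ℤ.i<j⇒i≤pred[j] {k} {ℤ.suc f} (fromℤ-cancel-< (ℚ.≤-<-trans k≤x x<f+1))))

swap-neg-≤ : ∀ {a b} → a ℚ.≤ ℚ.- b → b ℚ.≤ ℚ.- a
swap-neg-≤ {a} {b} a≤-b = ≤-from (slack a≤-b) (solve (a ∷ b ∷ []) ℚ-ring)

neg-swap-≤ : ∀ {a b} → ℚ.- a ℚ.≤ b → ℚ.- b ℚ.≤ a
neg-swap-≤ {a} {b} -a≤b = ≤-from (slack -a≤b) (solve (a ∷ b ∷ []) ℚ-ring)

ceiling : ∀ x → ∃[ c ] IsCeiling x c
ceiling x with floor (ℚ.- x)
... | f , f≤-x , greatest = ℤ.- f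
  , subst (x ℚ.≤_) (sym (fromℤ-neg f)) (swap-neg-≤ f≤-x)
  , λ k x≤k → subst (ℚ._≤ fromℤ k) (sym (fromℤ-neg f))
      (neg-swap-≤ (subst (ℚ._≤ fromℤ f) (fromℤ-neg k)
        (greatest (ℤ.- k) (subst (ℚ._≤ ℚ.- x) (sym (fromℤ-neg k)) (ℚ.neg-antimono-≤ x≤k)))))

infix 4 _⊑_

-- x lies in the smallest interval with integer ends that contains y.
record _⊑_ (x y : ℚ) : Set where
  constructor rounds
  field
    upper : ∀ k → y ℚ.≤ fromℤ k → x ℚ.≤ fromℤ k
    lower : ∀ k → fromℤ k ℚ.≤ y → fromℤ k ℚ.≤ x
open _⊑_

⊑-refl : ∀ {x} → x ⊑ x
⊑-refl = rounds (λ _ p → p) (λ _ p → p)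

⊑-trans : ∀ {x y z} → x ⊑ y → y ⊑ z → x ⊑ z
⊑-trans p q = rounds (λ k r → upper p k (upper q k r)) (λ k r → lower p k (lower q k r))

⊑-between : ∀ {x y f c} → IsFloor y f → IsCeiling y c → fromℤ f ℚ.≤ x → x ℚ.≤ fromℤ c → x ⊑ y
⊑-between (_ , greatest) (_ , least) f≤x x≤c =
  rounds (λ k y≤k → ℚ.≤-trans x≤c (least k y≤k)) (λ k k≤y → ℚ.≤-trans (greatest k k≤y) f≤x)

⊑-nonneg : ∀ {x y} → x ⊑ y → 0ℚ ℚ.≤ y → 0ℚ ℚ.≤ x
⊑-nonneg p = lower p (ℤ.+ 0)

⊑-neg : ∀ {x y} → x ⊑ y → ℚ.- x ⊑ ℚ.- y
⊑-neg {x} {y} p = rounds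
  (λ k -y≤k → neg-swap-≤ (subst (ℚ._≤ x) (fromℤ-neg k)
     (lower p (ℤ.- k) (subst (ℚ._≤ y) (sym (fromℤ-neg k)) (neg-swap-≤ -y≤k)))))
  (λ k k≤-y → swap-neg-≤ (subst (x ℚ.≤_) (fromℤ-neg k)
     (upper p (ℤ.- k) (subst (y ℚ.≤_) (sym (fromℤ-neg k)) (swap-neg-≤ k≤-y)))))

⊑-+ : ∀ {x y} k → x ⊑ y → fromℤ k ℚ.+ x ⊑ fromℤ k ℚ.+ y
⊑-+ {x} {y} k p = rounds
  (λ j h → ≤-from (slack (upper p (j ℤ.- k) (subst (y ℚ.≤_) (sym (fromℤ-sub j k))
     (≤-from (slack h) (lemma₁ (fromℤ j) (fromℤ k) y)))))
     (trans (cong (λ q → q ℚ.- x) (fromℤ-sub j k)) (sym (lemma₁ (fromℤ j) (fromℤ k) x))))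
  (λ j h → ≤-from (slack (lower p (j ℤ.- k) (subst (ℚ._≤ y) (sym (fromℤ-sub j k))
     (≤-from (slack h) (lemma₂ (fromℤ j) (fromℤ k) y)))))
     (trans (cong (λ q → x ℚ.- q) (fromℤ-sub j k)) (sym (lemma₂ (fromℤ j) (fromℤ k) x))))
  where
  lemma₁ : ∀ j k y → j ℚ.- (k ℚ.+ y) ≡ (j ℚ.- k) ℚ.- y
  lemma₁ = solve-∀ ℚ-ring
  lemma₂ : ∀ j k y → (k ℚ.+ y) ℚ.- j ≡ y ℚ.- (j ℚ.- k)
  lemma₂ = solve-∀ ℚ-ring

Integer : ℚ → Set
Integer x = ∃[ k ] x ≡ fromℤ k

module Moves where
  open ℚ-Base using (_+_; _-_; -_; _*_; _≤_; nonNegative; nonPositive)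

  -- The outcome of moving x inside [lo , hi], in the direction in which
  -- w x decreases, up to the first integer or the end of the interval.
  record Moved (lo x hi w : ℚ) : Set where
    field
      target : ℚ
      within : target ⊑ x
      ≥lo    : lo ≤ target
      ≤hi    : target ≤ hi
      cost   : w * target ≤ w * x
      stop   : Integer target ⊎ target ≡ lo ⊎ target ≡ hi

  move-down : ∀ {lo x hi f c w} → lo ≤ x → x ≤ hi → IsFloor x f → IsCeiling x c → 0ℚ ≤ w →
              lo ≤ fromℤ f ⊎ fromℤ f ≤ lo → Moved lo x hi w
  move-down {f = f} {w = w} lo≤x x≤hi fl@(f≤x , _) ce@(x≤c , _) 0≤w (inj₁ lo≤f) = record
    { within = ⊑-between fl ce ℚ.≤-refl (ℚ.≤-trans f≤x x≤c) ; ≥lo = lo≤f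
    ; ≤hi = ℚ.≤-trans f≤x x≤hi ; cost = ℚ.*-monoˡ-≤-nonNeg w {{nonNegative 0≤w}} f≤x
    ; stop = inj₁ (f , refl) }
  move-down {lo} {w = w} lo≤x x≤hi fl ce@(x≤c , _) 0≤w (inj₂ f≤lo) = record
    { within = ⊑-between fl ce f≤lo (ℚ.≤-trans lo≤x x≤c) ; ≥lo = ℚ.≤-refl
    ; ≤hi = ℚ.≤-trans lo≤x x≤hi ; cost = ℚ.*-monoˡ-≤-nonNeg w {{nonNegative 0≤w}} lo≤x
    ; stop = inj₂ (inj₁ refl) }

  move-up : ∀ {lo x hi f c w} → lo ≤ x → x ≤ hi → IsFloor x f → IsCeiling x c → w ≤ 0ℚ →
            fromℤ c ≤ hi ⊎ hi ≤ fromℤ c → Moved lo x hi w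
  move-up {c = c} {w = w} lo≤x x≤hi fl@(f≤x , _) ce@(x≤c , _) w≤0 (inj₁ c≤hi) = record
    { within = ⊑-between fl ce (ℚ.≤-trans f≤x x≤c) ℚ.≤-refl
    ; ≥lo = ℚ.≤-trans lo≤x x≤c ; ≤hi = c≤hi
    ; cost = ℚ.*-monoˡ-≤-nonPos w {{nonPositive w≤0}} x≤c ; stop = inj₁ (c , refl) }
  move-up {hi = hi} {w = w} lo≤x x≤hi fl@(f≤x , _) ce w≤0 (inj₂ hi≤c) = record
    { within = ⊑-between fl ce (ℚ.≤-trans f≤x x≤hi) hi≤c
    ; ≥lo = ℚ.≤-trans lo≤x x≤hi ; ≤hi = ℚ.≤-refl
    ; cost = ℚ.*-monoˡ-≤-nonPos w {{nonPositive w≤0}} x≤hi ; stop = inj₂ (inj₂ refl) }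

  move : ∀ {lo x hi} w → lo ≤ x → x ≤ hi → Moved lo x hi w
  move {lo} {x} {hi} w lo≤x x≤hi = helper (floor x) (ceiling x) (ℚ.≤-total 0ℚ w)
    where
    helper : ∃[ f ] IsFloor x f → ∃[ c ] IsCeiling x c → 0ℚ ≤ w ⊎ w ≤ 0ℚ → Moved lo x hi w
    helper (f , fl) (c , ce) (inj₁ 0≤w) = move-down lo≤x x≤hi fl ce 0≤w (ℚ.≤-total lo (fromℤ f))
    helper (f , fl) (c , ce) (inj₂ w≤0) = move-up lo≤x x≤hi fl ce w≤0 (ℚ.≤-total (fromℤ c) hi)

open Moves

-- Rounding in the cone of triangle inequalities

module Triangles where
  open ℚ-Base using (_+_; _-_; -_; _*_; _≤_)

  -- The cone generated by (1,1,0), (1,0,1) and (0,1,1). For parallel edges carrying `x` and `y`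
  -- these are the circuit formed by the pair, and a unit of the flow `s` through the one or the
  -- other edge.
  Triangle : ℚ → ℚ → ℚ → Set
  Triangle x y s = x ≤ y + s × y ≤ x + s × s ≤ x + y

  triangle-swap : ∀ {x y s} → Triangle x y s → Triangle y x s
  triangle-swap {x} {y} {s} (p , q , r) = q , p , subst (s ≤_) (ℚ.+-comm x y) r

  triangle-nonneg : ∀ {x y s} → Triangle x y s → 0ℚ ≤ x × 0ℚ ≤ y × 0ℚ ≤ s
  triangle-nonneg {x} {y} {s} (p , q , r) =
      half-nonneg (≤-from′ (slack q ⊕ slack r) (solve (x ∷ y ∷ s ∷ []) ℚ-ring))
    , half-nonneg (≤-from′ (slack p ⊕ slack r) (solve (x ∷ y ∷ s ∷ []) ℚ-ring))
    , half-nonneg (≤-from′ (slack p ⊕ slack q) (solve (x ∷ y ∷ s ∷ []) ℚ-ring))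
    where
    ≤-from′ : ∀ {a b} → 0ℚ ≤ a → a ≡ b → 0ℚ ≤ b
    ≤-from′ 0≤a refl = 0≤a

  -- The affine function t ↦ k + δ t with integer coefficients k and δ.
  Affine : Set
  Affine = ℤ × ℤ

  eval : Affine → ℚ → ℚ
  eval (k , δ) t = fromℤ k + fromℤ δ * t

  evalℤ : Affine → ℤ → ℤ
  evalℤ (k , δ) t = k ℤ.+ δ ℤ.* t

  fromℤ-eval : ∀ a t → fromℤ (evalℤ a t) ≡ eval a (fromℤ t)
  fromℤ-eval (k , δ) t = trans (fromℤ-+ k (δ ℤ.* t)) (cong (fromℤ k +_) (fromℤ-* δ t))

  const up down : ℤ → Affine
  const k = k , ℤ.+ 0
  up    k = k , ℤ.+ 1
  down  k = k , ℤ.-[1+ 0 ]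

  const-eval : ∀ k t → eval (const k) t ≡ fromℤ k
  const-eval k = lemma (fromℤ k)
    where
    lemma : ∀ k t → k + 0ℚ * t ≡ k
    lemma = solve-∀ ℚ-ring

  up-eval : ∀ k t → eval (up k) t ≡ fromℤ k + t
  up-eval k = lemma (fromℤ k)
    where
    lemma : ∀ k t → k + 1ℚ * t ≡ k + t
    lemma = solve-∀ ℚ-ring

  down-eval : ∀ k t → eval (down k) t ≡ fromℤ k - t
  down-eval k = lemma (fromℤ k)
    where
    lemma : ∀ k t → k + (- 1ℚ) * t ≡ k - t
    lemma = solve-∀ ℚ-ring

  -- Slopes 0, 1 and -1 have this property, but slope 2 does not: it sends 1/2 to the integer 1,
  -- while the roundings 0 and 1 of 1/2 go to 0 and 2.
  Monotone : Affine → Set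
  Monotone a = ∀ {t s} → t ⊑ s → eval a t ⊑ eval a s

  const-monotone : ∀ k → Monotone (const k)
  const-monotone k {t} {s} _ =
    subst₂ _⊑_ (sym (const-eval k t)) (sym (const-eval k s)) ⊑-refl

  up-monotone : ∀ k → Monotone (up k)
  up-monotone k {t} {s} t⊑s =
    subst₂ _⊑_ (sym (up-eval k t)) (sym (up-eval k s)) (⊑-+ k t⊑s)

  down-monotone : ∀ k → Monotone (down k)
  down-monotone k {t} {s} t⊑s =
    subst₂ _⊑_ (sym (down-eval k t)) (sym (down-eval k s)) (⊑-+ k (⊑-neg t⊑s))

  -- Making x and y affine functions of s lets the rounding of s be postponed.
  record Rounding (x y s wx wy : ℚ) : Set where
    field
      X Y      : Affine
      X-monotone : Monotone X
      Y-monotone : Monotone Y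
      X⊑       : eval X s ⊑ x
      Y⊑       : eval Y s ⊑ y
      cost     : wx * eval X s + wy * eval Y s ≤ wx * x + wy * y
      triangle : ∀ t → t ⊑ s → Triangle (eval X t) (eval Y t) t

  Rounding-swap : ∀ {x y s wx wy} → Rounding y x s wy wx → Rounding x y s wx wy
  Rounding-swap {x} {y} {s} {wx} {wy} R = record
    { X = Y ; Y = X ; X-monotone = Y-monotone ; Y-monotone = X-monotone ; X⊑ = Y⊑ ; Y⊑ = X⊑
    ; cost = subst₂ _≤_ (ℚ.+-comm (wy * eval X s) _) (ℚ.+-comm (wy * y) _) cost
    ; triangle = λ t t⊑s → triangle-swap (triangle t t⊑s) }
    where open Rounding R

  Rounding-trans : ∀ {x y x′ y′ s wx wy} → x′ ⊑ x → y′ ⊑ y → wx * x′ + wy * y′ ≤ wx * x + wy * y →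
                   Rounding x′ y′ s wx wy → Rounding x y s wx wy
  Rounding-trans x′⊑x y′⊑y c R = record
    { X = X ; Y = Y ; X-monotone = X-monotone ; Y-monotone = Y-monotone
    ; X⊑ = ⊑-trans X⊑ x′⊑x ; Y⊑ = ⊑-trans Y⊑ y′⊑y
    ; cost = ℚ.≤-trans cost c ; triangle = triangle }
    where open Rounding R

  exact : ∀ {x y s wx wy} X Y → Monotone X → Monotone Y → x ≡ eval X s → y ≡ eval Y s →
          (∀ t → t ⊑ s → Triangle (eval X t) (eval Y t) t) → Rounding x y s wx wy
  exact X Y X-monotone Y-monotone refl refl triangle = record
    { X = X ; Y = Y ; X-monotone = X-monotone ; Y-monotone = Y-monotone
    ; X⊑ = ⊑-refl ; Y⊑ = ⊑-refl ; cost = ℚ.≤-refl ; triangle = triangle }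

  -- With `x` and `y` integral, the triangle inequalities bound `s` by the integers `x - y`, `y - x`
  -- and `x + y`, and a rounding of `s` respects integer bounds.
  round-const-const : ∀ {x y s wx wy} → Integer x → Integer y → Triangle x y s → Rounding x y s wx wy
  round-const-const {s = s} (k , refl) (l , refl) (p , q , r) =
    exact (const k) (const l) (const-monotone k) (const-monotone l)
      (sym (const-eval k s)) (sym (const-eval l s)) λ t t⊑s →
      subst₂ (λ x y → Triangle x y t) (sym (const-eval k t)) (sym (const-eval l t))
        ( bound k l t⊑s p
        , bound l k t⊑s q
        , subst (t ≤_) (fromℤ-+ k l)
            (upper t⊑s (k ℤ.+ l) (subst (s ≤_) (sym (fromℤ-+ k l)) r)) )
    where
    bound : ∀ {t s} k l → t ⊑ s → fromℤ k ≤ fromℤ l + s → fromℤ k ≤ fromℤ l + t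
    bound {t} {s} k l t⊑s h = ≤-from (slack k-l≤t) (lemma (fromℤ k) (fromℤ l) t)
      where
      lemma : ∀ k l t → t - (k - l) ≡ l + t - k
      lemma = solve-∀ ℚ-ring
      k-l≤t : fromℤ k - fromℤ l ≤ t
      k-l≤t = subst (_≤ t) (fromℤ-sub k l) (lower t⊑s (k ℤ.- l) (subst (_≤ s) (sym (fromℤ-sub k l))
        (≤-from (slack h) (sym (lemma (fromℤ k) (fromℤ l) s)))))

  -- This and the next two lemmas treat integral `x` with one triangle inequality tight, so that `y`
  -- is `x + s`, `s - x` or `x - s`. The inequalities that are not tight then compare `s` or `x`
  -- with 0, or `s` with the integer `x`, and so survive the rounding of `s`.
  round-const-up : ∀ {x y s wx wy} → Integer x → 0ℚ ≤ x → 0ℚ ≤ s → y ≡ x + s → Rounding x y s wx wy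
  round-const-up {s = s} (k , refl) 0≤k 0≤s y≡ =
    exact (const k) (up k) (const-monotone k) (up-monotone k)
      (sym (const-eval k s)) (trans y≡ (sym (up-eval k s))) λ t t⊑s →
      subst₂ (λ x y → Triangle x y t) (sym (const-eval k t)) (sym (up-eval k t))
        (triangle 0≤k (⊑-nonneg t⊑s 0≤s))
    where
    triangle : ∀ {k t} → 0ℚ ≤ k → 0ℚ ≤ t → Triangle k (k + t) t
    triangle {k} {t} 0≤k 0≤t =
        ≤-from (0≤t ⊕ 0≤t) (solve (k ∷ t ∷ []) ℚ-ring)
      , ℚ.≤-refl
      , ≤-from (0≤k ⊕ 0≤k) (solve (k ∷ t ∷ []) ℚ-ring)

  round-const-shift : ∀ {x y s wx wy} → Integer x → 0ℚ ≤ x → x ≤ s → y ≡ s - x → Rounding x y s wx wy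
  round-const-shift {s = s} (k , refl) 0≤k k≤s y≡ =
    exact (const k) (up (ℤ.- k)) (const-monotone k) (up-monotone (ℤ.- k))
      (sym (const-eval k s)) (trans y≡ (sym (up-neg-eval s))) λ t t⊑s →
      subst₂ (λ x y → Triangle x y t) (sym (const-eval k t)) (sym (up-neg-eval t))
        (triangle 0≤k (lower t⊑s k k≤s))
    where
    up-neg-eval : ∀ t → eval (up (ℤ.- k)) t ≡ t - fromℤ k
    up-neg-eval t = trans (up-eval (ℤ.- k) t)
      (trans (cong (_+ t) (fromℤ-neg k)) (ℚ.+-comm (- fromℤ k) t))
    triangle : ∀ {k t} → 0ℚ ≤ k → k ≤ t → Triangle k (t - k) t
    triangle {k} {t} 0≤k k≤t =
        ≤-from (slack k≤t ⊕ slack k≤t) (solve (k ∷ t ∷ []) ℚ-ring)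
      , ≤-from (0≤k ⊕ 0≤k) (solve (k ∷ t ∷ []) ℚ-ring)
      , ℚ.≤-reflexive (solve (k ∷ t ∷ []) ℚ-ring)

  round-const-down : ∀ {x y s wx wy} → Integer x → 0ℚ ≤ s → s ≤ x → y ≡ x - s → Rounding x y s wx wy
  round-const-down {s = s} (k , refl) 0≤s s≤k y≡ =
    exact (const k) (down k) (const-monotone k) (down-monotone k)
      (sym (const-eval k s)) (trans y≡ (sym (down-eval k s))) λ t t⊑s →
      subst₂ (λ x y → Triangle x y t) (sym (const-eval k t)) (sym (down-eval k t))
        (triangle (⊑-nonneg t⊑s 0≤s) (upper t⊑s k s≤k))
    where
    triangle : ∀ {k t} → 0ℚ ≤ t → t ≤ k → Triangle k (k - t) t
    triangle {k} {t} 0≤t t≤k =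
        ℚ.≤-reflexive (solve (k ∷ t ∷ []) ℚ-ring)
      , ≤-from (0≤t ⊕ 0≤t) (solve (k ∷ t ∷ []) ℚ-ring)
      , ≤-from (slack t≤k ⊕ slack t≤k) (solve (k ∷ t ∷ []) ℚ-ring)

  triangle-range : ∀ {x y s} → Triangle x y s → s - x ≤ y × x - s ≤ y × y ≤ x + s
  triangle-range {x} {y} {s} (p , q , r) =
      ≤-from (slack r) (solve (x ∷ y ∷ s ∷ []) ℚ-ring)
    , ≤-from (slack p) (solve (x ∷ y ∷ s ∷ []) ℚ-ring)
    , q

  range-triangle : ∀ {x y s} → s - x ≤ y → x - s ≤ y → y ≤ x + s → Triangle x y s
  range-triangle {x} {y} {s} p q r =
      ≤-from (slack q) (solve (x ∷ y ∷ s ∷ []) ℚ-ring)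
    , r
    , ≤-from (slack p) (solve (x ∷ y ∷ s ∷ []) ℚ-ring)

  -- For fixed x and s the triangle inequalities confine y to the interval
  -- from max (s - x) (x - s) to x + s.
  move-y : ∀ {x y s} w → Triangle x y s →
           ∃[ y′ ] (y′ ⊑ y × w * y′ ≤ w * y × Triangle x y′ s ×
                    (Integer y′ ⊎ y′ ≡ s - x ⊎ y′ ≡ x - s ⊎ y′ ≡ x + s))
  move-y {x} {y} {s} w T = helper (triangle-range T) (ℚ.≤-total (s - x) (x - s))
    where
    Goal = ∃[ y′ ] (y′ ⊑ y × w * y′ ≤ w * y × Triangle x y′ s ×
                    (Integer y′ ⊎ y′ ≡ s - x ⊎ y′ ≡ x - s ⊎ y′ ≡ x + s))
    from-lo : ∀ {lo} → s - x ≤ lo → x - s ≤ lo → Moved lo y (x + s) w →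
              (∀ {y′} → Integer y′ ⊎ y′ ≡ lo ⊎ y′ ≡ x + s →
                        Integer y′ ⊎ y′ ≡ s - x ⊎ y′ ≡ x - s ⊎ y′ ≡ x + s) → Goal
    from-lo p q M cases = target , within , cost
      , range-triangle (ℚ.≤-trans p ≥lo) (ℚ.≤-trans q ≥lo) ≤hi , cases stop
      where open Moved M
    helper : s - x ≤ y × x - s ≤ y × y ≤ x + s → s - x ≤ x - s ⊎ x - s ≤ s - x → Goal
    helper (p , q , r) (inj₁ h) = from-lo h ℚ.≤-refl (move w q r) λ where
      (inj₁ i)        → inj₁ i
      (inj₂ (inj₁ e)) → inj₂ (inj₂ (inj₁ e))
      (inj₂ (inj₂ e)) → inj₂ (inj₂ (inj₂ e))
    helper (p , q , r) (inj₂ h) = from-lo ℚ.≤-refl h (move w p r) λ where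
      (inj₁ i)        → inj₁ i
      (inj₂ (inj₁ e)) → inj₂ (inj₁ e)
      (inj₂ (inj₂ e)) → inj₂ (inj₂ (inj₂ e))

  round-integer : ∀ {x y s wx wy} → Integer x → Triangle x y s → Rounding x y s wx wy
  round-integer {x} {y} {s} {wx} {wy} x∈ℤ T = helper (move-y wy T)
    where
    helper : ∃[ y′ ] (y′ ⊑ y × wy * y′ ≤ wy * y × Triangle x y′ s ×
                      (Integer y′ ⊎ y′ ≡ s - x ⊎ y′ ≡ x - s ⊎ y′ ≡ x + s)) → Rounding x y s wx wy
    helper (y′ , y′⊑y , c , T′ , tight) =
      Rounding-trans ⊑-refl y′⊑y (ℚ.+-monoʳ-≤ (wx * x) c) (vertex tight)
      where
      0≤x = proj₁ (triangle-nonneg T′)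
      0≤y = proj₁ (proj₂ (triangle-nonneg T′))
      0≤s = proj₂ (proj₂ (triangle-nonneg T′))
      vertex : Integer y′ ⊎ y′ ≡ s - x ⊎ y′ ≡ x - s ⊎ y′ ≡ x + s → Rounding x y′ s wx wy
      vertex (inj₁ y′∈ℤ)               = round-const-const x∈ℤ y′∈ℤ T′
      vertex (inj₂ (inj₁ refl))        = round-const-shift x∈ℤ 0≤x
        (≤-from 0≤y (solve (x ∷ s ∷ []) ℚ-ring)) refl
      vertex (inj₂ (inj₂ (inj₁ refl))) = round-const-down x∈ℤ 0≤s
        (≤-from 0≤y (solve (x ∷ s ∷ []) ℚ-ring)) refl
      vertex (inj₂ (inj₂ (inj₂ refl))) = round-const-up x∈ℤ 0≤x 0≤s refl

  -- On the facet `x = y + s` both coordinates move together, with joint weight `wx + wy`. The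
  -- interval for `y` is the one that keeps `y + s` between its floor and its ceiling; hence the
  -- move ends with `y` or `y + s` integral, and both remain roundings of their old values.
  round-sum : ∀ {y s wx wy} → 0ℚ ≤ y → 0ℚ ≤ s → Rounding (y + s) y s wx wy
  round-sum {y} {s} {wx} {wy} 0≤y 0≤s = helper (floor (y + s)) (ceiling (y + s))
    where
    helper : ∃[ f ] IsFloor (y + s) f → ∃[ c ] IsCeiling (y + s) c → Rounding (y + s) y s wx wy
    shift-right : ∀ {f y s} → f ≤ y + s → f - s ≤ y
    shift-right {f} {y} {s} h = ≤-from (slack h) (solve (f ∷ y ∷ s ∷ []) ℚ-ring)
    unshift-right : ∀ {f y s} → f - s ≤ y → f ≤ y + s
    unshift-right {f} {y} {s} h = ≤-from (slack h) (solve (f ∷ y ∷ s ∷ []) ℚ-ring)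
    shift-left : ∀ {c y s} → y + s ≤ c → y ≤ c - s
    shift-left {c} {y} {s} h = ≤-from (slack h) (solve (c ∷ y ∷ s ∷ []) ℚ-ring)
    unshift-left : ∀ {c y s} → y ≤ c - s → y + s ≤ c
    unshift-left {c} {y} {s} h = ≤-from (slack h) (solve (c ∷ y ∷ s ∷ []) ℚ-ring)
    helper (f , fl@(f≤ , _)) (c , ce@(≤c , _)) =
      Rounding-trans x′⊑x within cost′ (vertex stop)
      where
      open Moved (move {fromℤ f - s} {y} {fromℤ c - s} (wx + wy)
        (shift-right f≤) (shift-left ≤c))
      0≤target = ⊑-nonneg within 0≤y
      0≤target+s = 0≤target ⊕ 0≤s
      x′⊑x : target + s ⊑ y + s
      x′⊑x = ⊑-between fl ce (unshift-right ≥lo) (unshift-left ≤hi)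
      cost′ : wx * (target + s) + wy * target ≤ wx * (y + s) + wy * y
      cost′ = ≤-from (slack cost) (lemma wx wy target y s)
        where
        lemma : ∀ wx wy z y s → (wx + wy) * y - (wx + wy) * z ≡
                wx * (y + s) + wy * y - (wx * (z + s) + wy * z)
        lemma = solve-∀ ℚ-ring
      cancel : ∀ k s → k - s + s ≡ k
      cancel = solve-∀ ℚ-ring
      on-grid : ∀ k → target ≡ fromℤ k - s → Rounding (target + s) target s wx wy
      on-grid k e = round-const-down (k , trans (cong (_+ s) e) (cancel (fromℤ k) s)) 0≤s
        (≤-from 0≤target (sym (uncancel target s))) (sym (uncancel target s))
        where
        uncancel : ∀ y s → y + s - s ≡ y
        uncancel = solve-∀ ℚ-ring
      vertex : Integer target ⊎ target ≡ fromℤ f - s ⊎ target ≡ fromℤ c - s →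
               Rounding (target + s) target s wx wy
      vertex (inj₁ i)        = Rounding-swap (round-const-up i 0≤target 0≤s refl)
      vertex (inj₂ (inj₁ e)) = on-grid f e
      vertex (inj₂ (inj₂ e)) = on-grid c e

  -- On the facet `s = x + y` the coordinates move in opposite directions, which gives the joint
  -- weight `wx - wy` and exchanges the roles of floor and ceiling.
  round-difference : ∀ {x s wx wy} → 0ℚ ≤ x → x ≤ s → Rounding x (s - x) s wx wy
  round-difference {x} {s} {wx} {wy} 0≤x x≤s = helper (floor (s - x)) (ceiling (s - x))
    where
    helper : ∃[ f ] IsFloor (s - x) f → ∃[ c ] IsCeiling (s - x) c → Rounding x (s - x) s wx wy
    helper (f , fl@(f≤ , _)) (c , ce@(≤c , _)) =
      Rounding-trans within y′⊑y cost′ (vertex stop)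
      where
      flip : ∀ {a b} s → a ≤ s - b → b ≤ s - a
      flip {a} {b} s h = ≤-from (slack h) (solve (a ∷ b ∷ s ∷ []) ℚ-ring)
      flip′ : ∀ {a b} s → s - b ≤ a → s - a ≤ b
      flip′ {a} {b} s h = ≤-from (slack h) (solve (a ∷ b ∷ s ∷ []) ℚ-ring)
      open Moved (move {s - fromℤ c} {x} {s - fromℤ f} (wx - wy) (flip′ s ≤c) (flip s f≤))
      0≤target = ⊑-nonneg within 0≤x
      y′⊑y : s - target ⊑ s - x
      y′⊑y = ⊑-between fl ce (flip s ≤hi) (flip′ s ≥lo)
      0≤s-target : 0ℚ ≤ s - target
      0≤s-target = ⊑-nonneg y′⊑y (slack x≤s)
      cost′ : wx * target + wy * (s - target) ≤ wx * x + wy * (s - x)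
      cost′ = ≤-from (slack cost) (lemma wx wy target x s)
        where
        lemma : ∀ wx wy z x s → (wx - wy) * x - (wx - wy) * z ≡
                wx * x + wy * (s - x) - (wx * z + wy * (s - z))
        lemma = solve-∀ ℚ-ring
      cancel : ∀ s z → z ≡ s - (s - z)
      cancel = solve-∀ ℚ-ring
      on-grid : ∀ k → target ≡ s - fromℤ k → Rounding target (s - target) s wx wy
      on-grid k e = Rounding-swap (round-const-shift
        (k , trans (cong (λ q → s - q) e) (sym (cancel s (fromℤ k)))) 0≤s-target
        (≤-from 0≤target (cancel s target)) (cancel s target))
      vertex : Integer target ⊎ target ≡ s - fromℤ c ⊎ target ≡ s - fromℤ f →
               Rounding target (s - target) s wx wy
      vertex (inj₁ i) = round-const-shift i 0≤target
        (≤-from 0≤s-target refl) refl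
      vertex (inj₂ (inj₁ e)) = on-grid c e
      vertex (inj₂ (inj₂ e)) = on-grid f e

  -- The slice of the cone at fixed `s` is two-dimensional, so two moves suffice: the first makes
  -- `x` integral or reaches a facet, the second moves `y` or moves along that facet.
  round-triangle : ∀ {x y s} wx wy → Triangle x y s → Rounding x y s wx wy
  round-triangle {x} {y} {s} wx wy T = helper (move-y wx (triangle-swap T))
    where
    helper : ∃[ x′ ] (x′ ⊑ x × wx * x′ ≤ wx * x × Triangle y x′ s ×
                      (Integer x′ ⊎ x′ ≡ s - y ⊎ x′ ≡ y - s ⊎ x′ ≡ y + s)) → Rounding x y s wx wy
    helper (x′ , x′⊑x , c , T′ , tight) =
      Rounding-trans x′⊑x ⊑-refl (ℚ.+-monoˡ-≤ (wy * y) c) (edge tight)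
      where
      0≤y = proj₁ (triangle-nonneg T′)
      0≤x′ = proj₁ (proj₂ (triangle-nonneg T′))
      0≤s = proj₂ (proj₂ (triangle-nonneg T′))
      cancel : ∀ y s → y - s + s ≡ y
      cancel = solve-∀ ℚ-ring
      edge : Integer x′ ⊎ x′ ≡ s - y ⊎ x′ ≡ y - s ⊎ x′ ≡ y + s → Rounding x′ y s wx wy
      edge (inj₁ i) = round-integer i (triangle-swap T′)
      edge (inj₂ (inj₁ refl)) = Rounding-swap (round-difference 0≤y
        (≤-from 0≤x′ refl))
      edge (inj₂ (inj₂ (inj₁ refl))) = subst (λ z → Rounding (y - s) z s wx wy) (cancel y s)
        (Rounding-swap (round-sum 0≤x′ 0≤s))
      edge (inj₂ (inj₂ (inj₂ refl))) = round-sum 0≤y 0≤s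

open Triangles

-- Cuts and circuits

module FiniteSums {c ℓ} (M : CommutativeMonoid c ℓ) where
  open CommutativeMonoid M renaming (Carrier to A; refl to ≈-refl; sym to ≈-sym; trans to ≈-trans; ε to 0#)
  open import Algebra.Properties.CommutativeMonoid.Sum M public
    using (sum; sum-cong-≋; sum-cong-≗; sum-replicate-zero; sum-remove; ∑-distrib-+; ∑-comm)

  sum-zero : ∀ {m} (f : Fin m → A) → (∀ e → f e ≈ 0#) → sum f ≈ 0#
  sum-zero {m} f f≈ε = ≈-trans (sum-cong-≋ f≈ε) (sum-replicate-zero m)

  sum-support : ∀ {k m} (D : Fin k → Fin m) → (∀ {i j} → D i ≡ D j → i ≡ j) →
                (f : Fin m → A) → (∀ e → (∀ i → D i ≢ e) → f e ≈ 0#) → sum f ≈ sum (f ∘ D)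
  sum-support {zero}  D inj f off = sum-zero f λ e → off e λ ()
  sum-support {suc k} {zero} D inj f off with D zero
  ... | ()
  sum-support {suc k} {suc m} D inj f off =
    ≈-trans (sum-remove {i = D zero} f)
      (∙-congˡ (≈-trans (sum-support D′ D′-inj (f ∘ punchIn (D zero)) off′)
        (sum-cong-≋ λ j → reflexive (cong f (punchIn-punchOut (D₀≢ j))))))
    where
    D₀≢ : ∀ j → D zero ≢ D (suc j)
    D₀≢ j eq with inj eq
    ... | ()
    D′ : Fin k → Fin m
    D′ j = punchOut (D₀≢ j)
    D′-inj : ∀ {i j} → D′ i ≡ D′ j → i ≡ j
    D′-inj {i} {j} eq with inj (punchOut-injective (D₀≢ i) (D₀≢ j) eq)
    ... | refl = refl
    off′ : ∀ e → (∀ i → D′ i ≢ e) → f (punchIn (D zero) e) ≈ 0#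
    off′ e avoids = off (punchIn (D zero) e) λ where
      zero    eq → punchInᵢ≢i (D zero) e (sym eq)
      (suc j) eq → avoids j (punchIn-injective (D zero) (D′ j) e
        (trans (punchIn-punchOut (D₀≢ j)) eq))

  sum-single : ∀ {m} (e : Fin m) (f : Fin m → A) → (∀ g → e ≢ g → f g ≈ 0#) → sum f ≈ f e
  sum-single e f off = ≈-trans
    (sum-support {1} (λ _ → e) (λ { {zero} {zero} _ → refl }) f λ g e≢g → off g (e≢g zero))
    (identityʳ (f e))

  sum-pair : ∀ {m} {e e′ : Fin m} → e ≢ e′ → (f : Fin m → A) →
             (∀ g → e ≢ g → e′ ≢ g → f g ≈ 0#) → sum f ≈ f e ∙ f e′
  sum-pair {e = e} {e′} e≢e′ f off = ≈-trans
    (sum-support pair pair-injective f λ g avoids → off g (avoids zero) (avoids (suc zero)))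
    (∙-congˡ (identityʳ (f e′)))
    where
    pair : Fin 2 → Fin _
    pair zero    = e
    pair (suc _) = e′
    pair-injective : ∀ {i j} → pair i ≡ pair j → i ≡ j
    pair-injective {zero}     {zero}     _  = refl
    pair-injective {zero}     {suc zero} eq = contradiction eq e≢e′
    pair-injective {suc zero} {zero}     eq = contradiction (sym eq) e≢e′
    pair-injective {suc zero} {suc zero} _  = refl

module Xor = FiniteSums (CommutativeRing.+-commutativeMonoid Bool.xor-∧-commutativeRing)
module Natural = FiniteSums ℕ.+-0-commutativeMonoid

does-≟-refl : ∀ {n} (v : Fin n) → does (v ≟ v) ≡ true
does-≟-refl v with v ≟ v
... | yes _   = refl
... | no  v≢v = contradiction refl v≢v

does-≟-≢ : ∀ {n} {u v : Fin n} → u ≢ v → does (u ≟ v) ≡ false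
does-≟-≢ {u = u} {v} u≢v with u ≟ v
... | yes u≡v = contradiction u≡v u≢v
... | no _    = refl

true≢false : ∀ {b} → b ≡ true → b ≡ false → ⊥
true≢false refl ()

-- Edge sets and the parities of their cuts

EdgeSet : ℕ → Set
EdgeSet m = Fin m → Bool

Ends : ℕ → ℕ → Set
Ends n m = Fin m → Fin n × Fin n

single : ∀ {m} → Fin m → EdgeSet m
single e g = does (e ≟ g)

infixl 6 _△_
_△_ : ∀ {m} → EdgeSet m → EdgeSet m → EdgeSet m
(F △ G) e = F e xor G e

crosses : ∀ {n} → Fin n × Fin n → (Fin n → Bool) → Bool
crosses (u , v) S = S u xor S v

-- The parity of the number of edges of F in the cut δ(S).
cut : ∀ {n m} → Ends n m → EdgeSet m → (Fin n → Bool) → Bool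
cut ends F S = Xor.sum λ e → F e ∧ crosses (ends e) S

-- F is an element of the cycle space.
Even : ∀ {n m} → Ends n m → EdgeSet m → Set
Even ends F = ∀ S → cut ends F S ≡ false

cut-△ : ∀ {n m} (ends : Ends n m) F G S → cut ends (F △ G) S ≡ cut ends F S xor cut ends G S
cut-△ ends F G S = trans (Xor.sum-cong-≗ λ e → distrib (F e) (G e) (crosses (ends e) S))
  (Xor.∑-distrib-+ (λ e → F e ∧ crosses (ends e) S) (λ e → G e ∧ crosses (ends e) S))
  where
  distrib : ∀ a b c → (a xor b) ∧ c ≡ (a ∧ c) xor (b ∧ c)
  distrib a b c = proj₂ Bool.∧-distrib-xor c a b

Even-△ : ∀ {n m} {ends : Ends n m} {F G} → Even ends F → Even ends G → Even ends (F △ G)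
Even-△ {ends = ends} {F} {G} F-even G-even S =
  trans (cut-△ ends F G S) (cong₂ _xor_ (F-even S) (G-even S))

cut-cong : ∀ {n m} (ends : Ends n m) {F G} → (∀ e → F e ≡ G e) → ∀ S → cut ends F S ≡ cut ends G S
cut-cong ends F≗G S = Xor.sum-cong-≗ λ e → cong (_∧ crosses (ends e) S) (F≗G e)

cut-single : ∀ {n m} (ends : Ends n m) e S → cut ends (single e) S ≡ crosses (ends e) S
cut-single ends e S = trans
  (Xor.sum-single e (λ g → single e g ∧ crosses (ends g) S)
    λ g e≢g → cong (_∧ crosses (ends g) S) (does-≟-≢ e≢g))
  (cong (_∧ crosses (ends e) S) (does-≟-refl e))

cut-xor : ∀ {n m} (ends : Ends n m) F S T →
          cut ends F (λ v → S v xor T v) ≡ cut ends F S xor cut ends F T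
cut-xor ends F S T = trans
  (Xor.sum-cong-≗ λ e → let (u , v) = ends e in distrib (F e) (S u) (T u) (S v) (T v))
  (Xor.∑-distrib-+ (λ e → F e ∧ crosses (ends e) S) (λ e → F e ∧ crosses (ends e) T))
  where
  distrib : ∀ f a b c d → f ∧ ((a xor b) xor (c xor d)) ≡ (f ∧ (a xor c)) xor (f ∧ (b xor d))
  distrib false _     _     _ _     = refl
  distrib true  false false _ _     = refl
  distrib true  false true  false _ = refl
  distrib true  false true  true  d = refl
  distrib true  true  false false _ = refl
  distrib true  true  false true  d = Bool.not-involutive d
  distrib true  true  true  false false = refl
  distrib true  true  true  false true = refl
  distrib true  true  true  true  false = refl
  distrib true  true  true  true  true = refl

cut-const : ∀ {n m} (ends : Ends n m) F S {b} → (∀ v → S v ≡ b) → cut ends F S ≡ false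
cut-const ends F S {b} S≡b = Xor.sum-zero _ λ e →
  trans (cong (F e ∧_) (trans (cong₂ _xor_ (S≡b _) (S≡b _)) (Bool.xor-same b))) (Bool.∧-zeroʳ (F e))

at : ∀ {n} → Fin n → Fin n → Bool
at v u = does (u ≟ v)

-- Cut parity is linear in `S` over the field with two elements, and `S` is the sum of its points.
-- This reduces evenness on all cuts to evenness of all degrees.
cut-expand : ∀ {n m} (ends : Ends n m) F S →
             cut ends F S ≡ Xor.sum λ v → S v ∧ cut ends F (at v)
cut-expand ends F S = begin
  cut ends F S
    ≡⟨ Xor.sum-cong-≗ (λ e → cong (F e ∧_) (crosses-expand (ends e))) ⟩
  (Xor.sum λ e → F e ∧ Xor.sum λ v → S v ∧ crosses (ends e) (at v))
    ≡⟨ Xor.sum-cong-≗ (λ e → push (F e) (λ v → S v ∧ crosses (ends e) (at v))) ⟩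
  (Xor.sum λ e → Xor.sum λ v → F e ∧ (S v ∧ crosses (ends e) (at v)))
    ≡⟨ Xor.∑-comm (λ e v → F e ∧ (S v ∧ crosses (ends e) (at v))) ⟩
  (Xor.sum λ v → Xor.sum λ e → F e ∧ (S v ∧ crosses (ends e) (at v)))
    ≡⟨ Xor.sum-cong-≗ (λ v → Xor.sum-cong-≗ λ e → swap-∧ (F e) (S v) (crosses (ends e) (at v))) ⟩
  (Xor.sum λ v → Xor.sum λ e → S v ∧ (F e ∧ crosses (ends e) (at v)))
    ≡⟨ Xor.sum-cong-≗ (λ v → push (S v) (λ e → F e ∧ crosses (ends e) (at v))) ⟨
  (Xor.sum λ v → S v ∧ cut ends F (at v)) ∎
  where
  open ≡-Reasoning
  push : ∀ {k} b (f : Fin k → Bool) → b ∧ Xor.sum f ≡ Xor.sum λ i → b ∧ f i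
  push false f = sym (Xor.sum-zero (λ i → false ∧ f i) λ _ → refl)
  push true  f = refl
  swap-∧ : ∀ a b c → a ∧ (b ∧ c) ≡ b ∧ (a ∧ c)
  swap-∧ false false _ = refl
  swap-∧ false true  _ = refl
  swap-∧ true  _     _ = refl
  point : ∀ u → S u ≡ Xor.sum λ v → S v ∧ at v u
  point u = sym (trans
    (Xor.sum-single u (λ v → S v ∧ at v u)
      λ v u≢v → trans (cong (S v ∧_) (does-≟-≢ u≢v)) (Bool.∧-zeroʳ (S v)))
    (trans (cong (S u ∧_) (does-≟-refl u)) (Bool.∧-identityʳ (S u))))
  crosses-expand : ∀ p → crosses p S ≡ Xor.sum λ v → S v ∧ crosses p (at v)
  crosses-expand (p , q) = trans (cong₂ _xor_ (point p) (point q))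
    (trans (sym (Xor.∑-distrib-+ (λ v → S v ∧ at v p) (λ v → S v ∧ at v q)))
      (Xor.sum-cong-≗ λ v → sym (proj₁ Bool.∧-distrib-xor (S v) (at v p) (at v q))))

bit : Bool → ℕ
bit b = if b then 1 else 0

odd : ℕ → Bool
odd zero    = false
odd (suc k) = not (odd k)

odd-+ : ∀ a b → odd (a ℕ.+ b) ≡ odd a xor odd b
odd-+ zero    b = refl
odd-+ (suc a) b = trans (cong not (odd-+ a b)) (Bool.not-distribˡ-xor (odd a) (odd b))

odd-sum : ∀ {m} (f : Fin m → ℕ) → odd (Natural.sum f) ≡ Xor.sum (odd ∘ f)
odd-sum {zero}  f = refl
odd-sum {suc m} f = trans (odd-+ (f zero) _) (cong (odd (f zero) xor_) (odd-sum (f ∘ suc)))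

-- Degrees and circuits

module _ {n m} (ends : Ends n m) where

  incidences : Fin n → Fin m → ℕ
  incidences v e = bit (at v (proj₁ (ends e))) ℕ.+ bit (at v (proj₂ (ends e)))

  deg : EdgeSet m → Fin n → ℕ
  deg F v = Natural.sum λ e → if F e then incidences v e else 0

  Touches : EdgeSet m → Fin n → Set
  Touches F v = ∃[ e ] (F e ≡ true × Incident (graph ends) e v)

  Adj : EdgeSet m → Fin n → Fin n → Set
  Adj F u v = ∃[ e ] (F e ≡ true × Joins (ends e) u v)

  record IsCircuit (F : EdgeSet m) : Set where
    field
      nonempty  : ∃[ e ] F e ≡ true
      connected : ∀ u v → Touches F u → Touches F v → Star (Adj F) u v
      2-regular : ∀ v → Touches F v → deg F v ≡ 2

  touches? : ∀ F v → Dec (Touches F v)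
  touches? F v = any? λ e → (F e Bool.≟ true) ×-dec
    ((proj₁ (ends e) ≟ v) ⊎-dec (proj₂ (ends e) ≟ v))

  deg-parity : ∀ F v → odd (deg F v) ≡ cut ends F (at v)
  deg-parity F v = trans (odd-sum (λ e → if F e then incidences v e else 0))
    (Xor.sum-cong-≗ λ e → term (F e) (at v (proj₁ (ends e))) (at v (proj₂ (ends e))))
    where
    term : ∀ f a b → odd (if f then bit a ℕ.+ bit b else 0) ≡ f ∧ (a xor b)
    term false _     _     = refl
    term true  false false = refl
    term true  false true  = refl
    term true  true  false = refl
    term true  true  true  = refl

  incidences-zero : ∀ {v e} → ¬ Incident (graph ends) e v → incidences v e ≡ 0
  incidences-zero ¬inc =
    cong₂ (λ a b → bit a ℕ.+ bit b) (does-≟-≢ (¬inc ∘ inj₁)) (does-≟-≢ (¬inc ∘ inj₂))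

  deg-zero : ∀ {F v} → ¬ Touches F v → deg F v ≡ 0
  deg-zero {F} {v} ¬touch = Natural.sum-zero _ term
    where
    term : ∀ e → (if F e then incidences v e else 0) ≡ 0
    term e with F e in eq
    ... | false = refl
    ... | true  = incidences-zero λ inc → ¬touch (e , eq , inc)

  deg-nonzero : ∀ {F v} → Touches F v → deg F v ≢ 0
  deg-nonzero {F} {v} (e , Fe , inc) deg≡0 = incident-nonzero inc
    (trans (sym (cong (λ b → if b then incidences v e else 0) Fe))
      (term-zero (λ e → if F e then incidences v e else 0) deg≡0 e))
    where
    term-zero : ∀ {k} (f : Fin k → ℕ) → Natural.sum f ≡ 0 → ∀ i → f i ≡ 0
    term-zero f eq zero    = ℕ.m+n≡0⇒m≡0 (f zero) eq
    term-zero f eq (suc i) = term-zero (f ∘ suc) (ℕ.m+n≡0⇒n≡0 (f zero) eq) i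
    incident-nonzero : Incident (graph ends) e v → incidences v e ≢ 0
    incident-nonzero (inj₁ p≡v) eq with trans (sym (cong bit
      (trans (cong (at v) p≡v) (does-≟-refl v)))) (ℕ.m+n≡0⇒m≡0 (bit (at v (proj₁ (ends e)))) eq)
    ... | ()
    incident-nonzero (inj₂ p≡v) eq with trans (sym (cong bit
      (trans (cong (at v) p≡v) (does-≟-refl v)))) (ℕ.m+n≡0⇒n≡0 (bit (at v (proj₁ (ends e)))) eq)
    ... | ()

  circuit⇒even : ∀ {F} → IsCircuit F → Even ends F
  circuit⇒even {F} circ S = trans (cut-expand ends F S) (Xor.sum-zero _ λ v →
    trans (cong (S v ∧_) (trans (sym (deg-parity F v)) (deg-even v))) (Bool.∧-zeroʳ (S v)))
    where
    deg-even : ∀ v → odd (deg F v) ≡ false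
    deg-even v with touches? F v
    ... | yes t = cong odd (IsCircuit.2-regular circ v t)
    ... | no ¬t = cong odd (deg-zero {F} ¬t)

  deg-cong : ∀ {F G} → (∀ e → F e ≡ G e) → ∀ v → deg F v ≡ deg G v
  deg-cong F≗G v = Natural.sum-cong-≗ λ e → cong (λ b → if b then incidences v e else 0) (F≗G e)

  deg-△-single : ∀ {F e} → F e ≡ false → ∀ v → deg (F △ single e) v ≡ deg F v ℕ.+ incidences v e
  deg-△-single {F} {e} Fe v = trans (Natural.sum-cong-≗ split)
    (trans (Natural.∑-distrib-+ (λ g → if F g then incidences v g else 0)
                                (λ g → if single e g then incidences v g else 0))
      (cong (deg F v ℕ.+_) (trans
        (Natural.sum-single e (λ g → if single e g then incidences v g else 0)
          λ g e≢g → cong (λ b → if b then incidences v g else 0) (does-≟-≢ e≢g))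
        (cong (λ b → if b then incidences v e else 0) (does-≟-refl e)))))
    where
    split : ∀ g → (if (F △ single e) g then incidences v g else 0) ≡
                  (if F g then incidences v g else 0) ℕ.+ (if single e g then incidences v g else 0)
    split g with e ≟ g
    ... | yes refl rewrite Fe = refl
    ... | no  _    rewrite Bool.xor-identityʳ (F g) = sym (ℕ.+-identityʳ _)

  circuit⇒Circuit : ∀ {F} → IsCircuit F → Circuit (graph ends) (tabulate F)
  circuit⇒Circuit {F} circ =
      (let (e , Fe) = nonempty in e , member Fe)
    , (λ u v tu tv → star-map (connected u v (back tu) (back tv)))
    , (λ v t → trans (deg-cong (lookup∘tabulate F) v) (2-regular v (back t)))
    where
    open IsCircuit circ
    member : ∀ {e} → F e ≡ true → e ∈ tabulate F
    member {e} Fe = lookup⇒[]= e (tabulate F) (trans (lookup∘tabulate F e) Fe)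
    member⁻ : ∀ {e} → e ∈ tabulate F → F e ≡ true
    member⁻ {e} e∈ = trans (sym (lookup∘tabulate F e)) ([]=⇒lookup e∈)
    back : ∀ {v} → Covers (graph ends) (tabulate F) v → Touches F v
    back (e , e∈ , inc) = e , member⁻ e∈ , inc
    star-map : ∀ {u v} → Star (Adj F) u v → Star (Adjacent (graph ends) (tabulate F)) u v
    star-map ε = ε
    star-map ((e , Fe , j) ◅ p) = (e , member Fe , j) ◅ star-map p

  Circuit⇒circuit : ∀ {C} → Circuit (graph ends) C → IsCircuit (lookup C)
  Circuit⇒circuit {C} ((e , e∈) , connected , 2-regular) = record
    { nonempty  = e , []=⇒lookup e∈
    ; connected = λ u v tu tv → star-map (connected u v (back tu) (back tv))
    ; 2-regular = λ v t → 2-regular v (back t) }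
    where
    back : ∀ {v} → Touches (lookup C) v → Covers (graph ends) C v
    back (e , Ce , inc) = e , lookup⇒[]= e C Ce , inc
    star-map : ∀ {u v} → Star (Adjacent (graph ends) C) u v → Star (Adj (lookup C)) u v
    star-map ε = ε
    star-map ((e , e∈ , j) ◅ p) = (e , []=⇒lookup e∈ , j) ◅ star-map p

  loop-circuit : ∀ e → proj₁ (ends e) ≡ proj₂ (ends e) → IsCircuit (single e)
  loop-circuit e loop = record
    { nonempty  = e , does-≟-refl e
    ; connected = λ u v tu tv → subst (Star _ u) (trans (sym (only tu)) (only tv)) ε
    ; 2-regular = λ v t → trans (deg-loop v) (both v (only t)) }
    where
    only : ∀ {v} → Touches (single e) v → proj₁ (ends e) ≡ v
    only (g , g≡ , inc) with e ≟ g
    only (g , g≡ , inj₁ p) | yes refl = p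
    only (g , g≡ , inj₂ p) | yes refl = trans loop p
    only (g , () , inc)    | no _
    deg-loop : ∀ v → deg (single e) v ≡ incidences v e
    deg-loop v = trans
      (Natural.sum-single e (λ g → if single e g then incidences v g else 0)
        λ g e≢g → cong (λ b → if b then incidences v g else 0) (does-≟-≢ e≢g))
      (cong (λ b → if b then incidences v e else 0) (does-≟-refl e))
    both : ∀ v → proj₁ (ends e) ≡ v → incidences v e ≡ 2
    both v p≡v = cong₂ (λ a b → bit a ℕ.+ bit b)
      (trans (cong (at v) p≡v) (does-≟-refl v))
      (trans (cong (at v) (trans (sym loop) p≡v)) (does-≟-refl v))

-- Identifying v with u; v is kept as an isolated vertex.
merge : ∀ {n} → Fin n → Fin n → Fin n → Fin n
merge u v w = if does (w ≟ v) then u else w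

merge-kernel : ∀ {n} (u v : Fin n) {a b} → merge u v a ≡ merge u v b →
               a ≡ b ⊎ (a ≡ u × b ≡ v) ⊎ (a ≡ v × b ≡ u)
merge-kernel u v {a} {b} eq with a ≟ v | b ≟ v
... | yes refl | yes refl = inj₁ refl
... | yes refl | no _     = inj₂ (inj₂ (refl , sym eq))
... | no _     | yes refl = inj₂ (inj₁ (eq , refl))
... | no _     | no _     = inj₁ eq

module Contraction {n m} (ends : Ends n m) (e : Fin m) (u v : Fin n) (ends-e : Joins (ends e) u v)
                   (u≢v : u ≢ v) where

  ends′ : Ends n m
  ends′ = mapEnds (merge u v) ∘ ends

  merge-u : merge u v u ≡ u
  merge-u rewrite does-≟-≢ u≢v = refl

  merge-v : merge u v v ≡ u
  merge-v rewrite does-≟-refl v = refl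

  merge-other : ∀ {w} → w ≢ v → merge u v w ≡ w
  merge-other w≢v rewrite does-≟-≢ w≢v = refl

  crosses-e : ∀ S → crosses (ends e) S ≡ S u xor S v
  crosses-e S = cases ends-e
    where
    cases : Joins (ends e) u v → crosses (ends e) S ≡ S u xor S v
    cases (inj₁ eq) = cong (λ p → crosses p S) eq
    cases (inj₂ eq) = trans (cong (λ p → crosses p S) eq) (Bool.xor-comm (S v) (S u))

  -- The cut of `S` after the identification is the cut of `S ∘ merge u v` before it, and `e`, now a
  -- loop, crosses nothing and may be toggled.
  even-contract : ∀ {F} → Even ends F → Even ends′ (F △ single e)
  even-contract {F} F-even S = trans (cut-△ ends F (single e) (S ∘ merge u v))
    (cong₂ _xor_ (F-even (S ∘ merge u v)) (trans (cut-single ends e (S ∘ merge u v))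
      (trans (crosses-e (S ∘ merge u v))
        (trans (cong₂ _xor_ (cong S merge-u) (cong S merge-v)) (Bool.xor-same (S u))))))

  bit-merge-u : ∀ p → bit (at u (merge u v p)) ≡ bit (at u p) ℕ.+ bit (at v p)
  bit-merge-u p with p ≟ v
  ... | yes refl rewrite does-≟-refl u | does-≟-≢ (u≢v ∘ sym) = refl
  ... | no _ = sym (ℕ.+-identityʳ _)

  bit-merge-other : ∀ {w} → w ≢ u → w ≢ v → ∀ p → bit (at w (merge u v p)) ≡ bit (at w p)
  bit-merge-other {w} w≢u w≢v p with p ≟ v
  ... | yes refl rewrite does-≟-≢ (w≢u ∘ sym) | does-≟-≢ (w≢v ∘ sym) = refl
  ... | no _ = refl

  deg-u : ∀ F → deg ends′ F u ≡ deg ends F u ℕ.+ deg ends F v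
  deg-u F = trans (Natural.sum-cong-≗ term)
    (Natural.∑-distrib-+ (λ g → if F g then incidences ends u g else 0)
                         (λ g → if F g then incidences ends v g else 0))
    where
    swap-middle : ∀ a b c d → (a ℕ.+ b) ℕ.+ (c ℕ.+ d) ≡ (a ℕ.+ c) ℕ.+ (b ℕ.+ d)
    swap-middle a b c d = trans (ℕ.+-assoc a b (c ℕ.+ d)) (trans (cong (a ℕ.+_)
      (trans (sym (ℕ.+-assoc b c d)) (trans (cong (ℕ._+ d) (ℕ.+-comm b c)) (ℕ.+-assoc c b d))))
      (sym (ℕ.+-assoc a c (b ℕ.+ d))))
    term : ∀ g → (if F g then incidences ends′ u g else 0) ≡
           (if F g then incidences ends u g else 0) ℕ.+ (if F g then incidences ends v g else 0)
    term g with F g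
    ... | false = refl
    ... | true  = trans (cong₂ ℕ._+_ (bit-merge-u (proj₁ (ends g))) (bit-merge-u (proj₂ (ends g))))
      (swap-middle (bit (at u (proj₁ (ends g)))) (bit (at v (proj₁ (ends g))))
                   (bit (at u (proj₂ (ends g)))) (bit (at v (proj₂ (ends g)))))

  deg-other : ∀ F {w} → w ≢ u → w ≢ v → deg ends′ F w ≡ deg ends F w
  deg-other F {w} w≢u w≢v = Natural.sum-cong-≗ λ g →
    cong (λ k → if F g then k else 0)
      (cong₂ ℕ._+_ (bit-merge-other w≢u w≢v (proj₁ (ends g)))
                   (bit-merge-other w≢u w≢v (proj₂ (ends g))))

  touches′ : ∀ {F w} → Touches ends F w → Touches ends′ F (merge u v w)
  touches′ (g , Fg , inj₁ p) = g , Fg , inj₁ (cong (merge u v) p)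
  touches′ (g , Fg , inj₂ p) = g , Fg , inj₂ (cong (merge u v) p)

  touches′-other : ∀ {F w} → w ≢ v → Touches ends F w → Touches ends′ F w
  touches′-other {F} w≢v t = subst (Touches ends′ F) (merge-other w≢v) (touches′ t)

  -- A walk after the identification lifts edge by edge. Consecutive lifted edges need not meet, but
  -- their ends have the same image, and `fibre` connects them.
  star-lift : ∀ {C D} → (∀ {g} → C g ≡ true → D g ≡ true) →
              (∀ {a b} → Touches ends C a → Touches ends C b → merge u v a ≡ merge u v b →
                         Star (Adj ends D) a b) →
              ∀ {p q a b} → Star (Adj ends′ C) p q → Touches ends C a → Touches ends C b →
              merge u v a ≡ p → merge u v b ≡ q → Star (Adj ends D) a b
  star-lift C⊆D fibre ε ta tb refl eq = fibre ta tb (sym eq)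
  star-lift {C} {D} C⊆D fibre {a = a} {b} ((g , Cg , j) ◅ rest) ta tb refl eq = step j
    where
    s = proj₁ (ends g)
    t = proj₂ (ends g)
    ts : Touches ends C s
    ts = g , Cg , inj₁ refl
    tt : Touches ends C t
    tt = g , Cg , inj₂ refl
    step : Joins (ends′ g) _ _ → Star (Adj ends D) a b
    step (inj₁ j) = fibre ta ts (sym (cong proj₁ j)) ◅◅ (g , C⊆D Cg , inj₁ refl) ◅
                    star-lift C⊆D fibre rest tt tb (cong proj₂ j) eq
    step (inj₂ j) = fibre ta tt (sym (cong proj₂ j)) ◅◅ (g , C⊆D Cg , inj₂ refl) ◅
                    star-lift C⊆D fibre rest ts tb (cong proj₁ j) eq

  -- The degrees of `u` and `v` in `C` add up to that of the merged vertex. If `C` touches only one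
  -- of them, nothing has changed; if it touches both, each has degree 1 when `C` passes through the
  -- merged vertex, and `e` closes the gap.
  circuit-lift : ∀ {C} → IsCircuit ends′ C → C e ≡ false →
                 IsCircuit ends C ⊎ IsCircuit ends (C △ single e)
  circuit-lift {C} circ Ce = lift (touches? ends C u) (touches? ends C v)
    where
    open IsCircuit circ
    deg-sum : Touches ends C u ⊎ Touches ends C v → deg ends C u ℕ.+ deg ends C v ≡ 2
    deg-sum t = trans (sym (deg-u C)) (2-regular u (touched t))
      where
      touched : Touches ends C u ⊎ Touches ends C v → Touches ends′ C u
      touched (inj₁ tu) = touches′-other u≢v tu
      touched (inj₂ tv) = subst (Touches ends′ C) merge-v (touches′ tv)

    unchanged : ¬ (Touches ends C u × Touches ends C v) → IsCircuit ends C
    unchanged ¬both = record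
      { nonempty  = nonempty
      ; connected = λ a b ta tb → star-lift (λ Cg → Cg) fibre
          (connected _ _ (touches′ ta) (touches′ tb)) ta tb refl refl
      ; 2-regular = regular }
      where
      fibre : ∀ {a b} → Touches ends C a → Touches ends C b → merge u v a ≡ merge u v b →
              Star (Adj ends C) a b
      fibre {a} {b} ta tb eq with merge-kernel u v {a} {b} eq
      ... | inj₁ refl                  = ε
      ... | inj₂ (inj₁ (refl , refl)) = contradiction (ta , tb) ¬both
      ... | inj₂ (inj₂ (refl , refl)) = contradiction (tb , ta) ¬both
      regular : ∀ w → Touches ends C w → deg ends C w ≡ 2
      regular w t with w ≟ u | w ≟ v
      ... | yes refl | _ = trans (sym (trans
        (cong (deg ends C u ℕ.+_) (deg-zero ends {C} λ tv → ¬both (t , tv))) (ℕ.+-identityʳ _)))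
        (deg-sum (inj₁ t))
      ... | no _ | yes refl = trans (sym
        (cong (ℕ._+ deg ends C v) (deg-zero ends {C} λ tu → ¬both (tu , t))))
        (deg-sum (inj₂ t))
      ... | no w≢u | no w≢v =
        trans (sym (deg-other C w≢u w≢v)) (2-regular w (touches′-other w≢v t))

    extended : Touches ends C u → Touches ends C v → IsCircuit ends (C △ single e)
    extended tu tv = record
      { nonempty  = e , D-e
      ; connected = λ a b ta tb → star-lift C⊆D fibre
          (connected _ _ (touches′ (shrink ta)) (touches′ (shrink tb))) (shrink ta) (shrink tb) refl refl
      ; 2-regular = λ w t → trans (deg-△-single ends {C} Ce w) (regular w (shrink t)) }
      where
      D = C △ single e
      D-e : D e ≡ true
      D-e rewrite Ce = does-≟-refl e
      C⊆D : ∀ {g} → C g ≡ true → D g ≡ true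
      C⊆D {g} Cg with e ≟ g
      ... | yes refl = contradiction Ce λ Ce → true≢false Cg Ce
      ... | no _ rewrite Cg = refl
      end-touch : ∀ {w} → Incident (graph ends) e w → Touches ends C w
      end-touch {w} inc = cases ends-e inc
        where
        cases : Joins (ends e) u v → Incident (graph ends) e w → Touches ends C w
        cases (inj₁ eq) (inj₁ p) = subst (Touches ends C) (trans (sym (cong proj₁ eq)) p) tu
        cases (inj₁ eq) (inj₂ p) = subst (Touches ends C) (trans (sym (cong proj₂ eq)) p) tv
        cases (inj₂ eq) (inj₁ p) = subst (Touches ends C) (trans (sym (cong proj₁ eq)) p) tv
        cases (inj₂ eq) (inj₂ p) = subst (Touches ends C) (trans (sym (cong proj₂ eq)) p) tu
      shrink : ∀ {w} → Touches ends D w → Touches ends C w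
      shrink (g , Dg , inc) with e ≟ g
      ... | yes refl = end-touch inc
      ... | no _     = g , trans (sym (Bool.xor-identityʳ (C g))) Dg , inc
      fibre : ∀ {a b} → Touches ends C a → Touches ends C b → merge u v a ≡ merge u v b →
              Star (Adj ends D) a b
      fibre {a} {b} ta tb eq with merge-kernel u v {a} {b} eq
      ... | inj₁ refl                  = ε
      ... | inj₂ (inj₁ (refl , refl)) = (e , D-e , ends-e) ◅ ε
      ... | inj₂ (inj₂ (refl , refl)) = (e , D-e , Sum.swap ends-e) ◅ ε
      ones : ∀ {a b} → a ≢ 0 → b ≢ 0 → a ℕ.+ b ≡ 2 → a ≡ 1 × b ≡ 1
      ones {zero}         a≢0 _   _    = contradiction refl a≢0
      ones {suc zero} {b} _   _   eq   = refl , ℕ.suc-injective eq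
      ones {suc (suc zero)} {zero} _ b≢0 _ = contradiction refl b≢0
      du≡1 = proj₁ (ones (deg-nonzero ends {C} tu) (deg-nonzero ends {C} tv) (deg-sum (inj₁ tu)))
      dv≡1 = proj₂ (ones (deg-nonzero ends {C} tu) (deg-nonzero ends {C} tv) (deg-sum (inj₁ tu)))
      incidences-e : ∀ w → incidences ends w e ≡ bit (at w u) ℕ.+ bit (at w v)
      incidences-e w = cases ends-e
        where
        cases : Joins (ends e) u v → incidences ends w e ≡ bit (at w u) ℕ.+ bit (at w v)
        cases (inj₁ eq) = cong (λ p → bit (at w (proj₁ p)) ℕ.+ bit (at w (proj₂ p))) eq
        cases (inj₂ eq) = trans (cong (λ p → bit (at w (proj₁ p)) ℕ.+ bit (at w (proj₂ p))) eq)
                                (ℕ.+-comm (bit (at w v)) _)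
      regular : ∀ w → Touches ends C w → deg ends C w ℕ.+ incidences ends w e ≡ 2
      regular w t rewrite incidences-e w with w ≟ u | w ≟ v
      ... | yes refl | _ rewrite does-≟-refl u | does-≟-≢ (u≢v ∘ sym) = cong (ℕ._+ 1) du≡1
      ... | no w≢u | yes refl rewrite does-≟-≢ u≢v | does-≟-refl v = cong (ℕ._+ 1) dv≡1
      ... | no w≢u | no w≢v rewrite does-≟-≢ (w≢u ∘ sym) | does-≟-≢ (w≢v ∘ sym) =
        trans (ℕ.+-identityʳ _) (trans (sym (deg-other C w≢u w≢v)) (2-regular w (touches′-other w≢v t)))

    lift : Dec (Touches ends C u) → Dec (Touches ends C v) → IsCircuit ends C ⊎ IsCircuit ends (C △ single e)
    lift (yes tu) (yes tv) = inj₂ (extended tu tv)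
    lift (yes _)  (no ¬tv) = inj₁ (unchanged (¬tv ∘ proj₂))
    lift (no ¬tu) _        = inj₁ (unchanged (¬tu ∘ proj₁))

-- Even edge sets as disjoint unions of circuits

infix 4 _⊆ₑ_
_⊆ₑ_ : ∀ {m} → EdgeSet m → EdgeSet m → Set
F ⊆ₑ G = ∀ {e} → F e ≡ true → G e ≡ true

⊆ₑ⇒⊂ : ∀ {m} {F G : EdgeSet m} {e} → F ⊆ₑ G → G e ≡ true → F e ≡ false → tabulate F ⊂ tabulate G
⊆ₑ⇒⊂ {F = F} {G} {e} F⊆G Ge Fe =
    (λ {g} g∈F → lookup⇒[]= g _ (trans (lookup∘tabulate G g)
      (F⊆G (trans (sym (lookup∘tabulate F g)) ([]=⇒lookup g∈F)))))
  , e , lookup⇒[]= e _ (trans (lookup∘tabulate G e) Ge)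
  , λ e∈F → true≢false (trans (sym (lookup∘tabulate F e)) ([]=⇒lookup e∈F)) Fe

△-single-⊆ : ∀ {m} {F : EdgeSet m} {e} → F e ≡ true → F △ single e ⊆ₑ F
△-single-⊆ {F = F} {e} Fe {g} h with e ≟ g
... | yes refl = Fe
... | no _     = trans (sym (Bool.xor-identityʳ (F g))) h

△-single-∉ : ∀ {m} {F : EdgeSet m} {e} → F e ≡ true → (F △ single e) e ≡ false
△-single-∉ {e = e} Fe rewrite Fe | does-≟-refl e = refl

-- Induction by contracting an edge of `F`, which replaces the usual walk along edges: a loop is a
-- circuit, and a circuit of the contracted graph lifts, with or without `e`. If `e` is not a loop,
-- `F` cannot consist of `e` alone, because the star of `v` would then be met once.
even⇒circuit : ∀ {n m} (ends : Ends n m) (F : EdgeSet m) → Acc _⊂_ (tabulate F) → Even ends F →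
               (∃[ e ] F e ≡ true) → ∃[ C ] (IsCircuit ends C × C ⊆ₑ F)
even⇒circuit {n} ends F (acc rec) F-even (e , Fe) with proj₁ (ends e) ≟ proj₂ (ends e)
... | yes loop = single e , loop-circuit ends e loop , single⊆
  where
  single⊆ : single e ⊆ₑ F
  single⊆ {g} h with e ≟ g
  ... | yes refl = Fe
  single⊆ {g} () | no _
... | no u≢v = from-smaller (any? λ g → F′ g Bool.≟ true)
  where
  u v : Fin n
  u = proj₁ (ends e)
  v = proj₂ (ends e)
  open Contraction ends e u v (inj₁ refl) u≢v
  F′ = F △ single e
  F′⊆F : F′ ⊆ₑ F
  F′⊆F = △-single-⊆ {F = F} Fe
  F′e : F′ e ≡ false
  F′e = △-single-∉ {F = F} Fe
  from-smaller : Dec (∃[ g ] F′ g ≡ true) → ∃[ C ] (IsCircuit ends C × C ⊆ₑ F)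
  from-smaller (yes nonempty) with even⇒circuit ends′ F′ (rec (⊆ₑ⇒⊂ F′⊆F Fe F′e)) (even-contract F-even) nonempty
  ... | C , circ , C⊆F′ with circuit-lift circ (Bool.¬-not λ Ce → true≢false (C⊆F′ Ce) F′e)
  ... | inj₁ C-circ  = C , C-circ , λ Cg → F′⊆F (C⊆F′ Cg)
  ... | inj₂ C+e-circ = C △ single e , C+e-circ , λ {g} → C+e⊆ g
    where
    C+e⊆ : ∀ g → (C △ single e) g ≡ true → F g ≡ true
    C+e⊆ g h with e ≟ g
    ... | yes refl = Fe
    ... | no _     = F′⊆F (C⊆F′ (trans (sym (Bool.xor-identityʳ (C g))) h))
  from-smaller (no empty) = ⊥-elim (true≢false crossing (F-even (at v)))
    where
    F≗single : ∀ g → F g ≡ single e g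
    F≗single g = xor-false (F g) (single e g) (Bool.¬-not λ h → empty (g , h))
      where
      xor-false : ∀ a b → a xor b ≡ false → a ≡ b
      xor-false false b eq = sym eq
      xor-false true true eq = refl
    crossing : cut ends F (at v) ≡ true
    crossing = trans (cut-cong ends F≗single (at v)) (trans (cut-single ends e (at v))
      (cong₂ _xor_ (does-≟-≢ u≢v) (does-≟-refl v)))

-- Multiplicity functions are known only pointwise, so the constructors carry pointwise equations
-- instead of fixing the index.
data SumOf {m} (P : EdgeSet m → Set) (k : Fin m → ℕ) : Set where
  sum-none : (∀ e → k e ≡ 0) → SumOf P k
  sum-more : ∀ {F k′} → P F → SumOf P k′ → (∀ e → k e ≡ bit (F e) ℕ.+ k′ e) → SumOf P k

SumOf-cong : ∀ {m} {P : EdgeSet m → Set} {k l} → (∀ e → l e ≡ k e) → SumOf P k → SumOf P l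
SumOf-cong l≗k (sum-none k≗0)       = sum-none λ e → trans (l≗k e) (k≗0 e)
SumOf-cong l≗k (sum-more p rest eq) = sum-more p rest λ e → trans (l≗k e) (eq e)

SumOf-+ : ∀ {m} {P : EdgeSet m → Set} {k l} → SumOf P k → SumOf P l → SumOf P (λ e → k e ℕ.+ l e)
SumOf-+ {l = l} (sum-none k≗0) s = SumOf-cong (λ e → cong (ℕ._+ l e) (k≗0 e)) s
SumOf-+ {l = l} (sum-more {F} p rest eq) s = sum-more p (SumOf-+ rest s) λ e →
  trans (cong (ℕ._+ l e) (eq e)) (ℕ.+-assoc (bit (F e)) _ _)

SumOf-bind : ∀ {m} {P Q : EdgeSet m → Set} → (∀ {F} → P F → SumOf Q (bit ∘ F)) →
             ∀ {k} → SumOf P k → SumOf Q k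
SumOf-bind f (sum-none k≗0)       = sum-none k≗0
SumOf-bind f (sum-more p rest eq) = SumOf-cong eq (SumOf-+ (f p) (SumOf-bind f rest))

-- Circuits are even, so removing one from `F` leaves a smaller even set.
even⇒circuits : ∀ {n m} {ends : Ends n m} {F : EdgeSet m} → Even ends F →
                SumOf (IsCircuit ends) (bit ∘ F)
even⇒circuits {ends = ends} {F} = go F (⊂-wellFounded _)
  where
  go : ∀ F → Acc _⊂_ (tabulate F) → Even ends F → SumOf (IsCircuit ends) (bit ∘ F)
  go F (acc rec) F-even with any? (λ e → F e Bool.≟ true)
  ... | no empty = sum-none λ e → cong bit (Bool.¬-not λ Fe → empty (e , Fe))
  ... | yes nonempty with even⇒circuit ends F (⊂-wellFounded _) F-even nonempty
  ... | C , circ , C⊆F = sum-more circ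
      (go (F △ C) (rec (⊆ₑ⇒⊂ rest⊆F (C⊆F Ce) rest-e)) (Even-△ {ends = ends} {F} {C} F-even (circuit⇒even ends circ)))
      λ g → split (F g) (C g) C⊆F
    where
    e  = proj₁ (IsCircuit.nonempty circ)
    Ce = proj₂ (IsCircuit.nonempty circ)
    rest⊆F : F △ C ⊆ₑ F
    rest⊆F {g} = below (F g) (C g) C⊆F
      where
      below : ∀ f c → (c ≡ true → f ≡ true) → f xor c ≡ true → f ≡ true
      below true  _    _   _ = refl
      below false true imp _ = imp refl
    rest-e : (F △ C) e ≡ false
    rest-e rewrite C⊆F Ce | Ce = refl
    split : ∀ f c → (c ≡ true → f ≡ true) → bit f ≡ bit c ℕ.+ bit (f xor c)
    split false false _ = refl
    split true  false _ = refl
    split true  true  _ = refl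
    split false true  imp with imp refl
    ... | ()

-- Box-integrality of the cycle cone under series and parallel extensions

module Rational = FiniteSums ℚ.+-0-commutativeMonoid

open ℚ-Base using (_+_; _-_; -_; _*_; _≤_)

module _ {m : ℕ} {A : Set} where

  override : Fin m → A → (Fin m → A) → Fin m → A
  override e x f g = if does (e ≟ g) then x else f g

  override-same : ∀ e x f → override e x f e ≡ x
  override-same e x f rewrite does-≟-refl e = refl

  override-other : ∀ {e g} x f → e ≢ g → override e x f g ≡ f g
  override-other x f e≢g rewrite does-≟-≢ e≢g = refl

toggle : ∀ {m} → Bool → Fin m → EdgeSet m → EdgeSet m
toggle b e F = F △ λ g → b ∧ single e g

module _ {m : ℕ} (b : Bool) where

  toggle-same : ∀ (e : Fin m) F → toggle b e F e ≡ F e xor b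
  toggle-same e F rewrite does-≟-refl e | Bool.∧-identityʳ b = refl

  toggle-other : ∀ {e g : Fin m} F → e ≢ g → toggle b e F g ≡ F g
  toggle-other {g = g} F e≢g rewrite does-≟-≢ e≢g | Bool.∧-zeroʳ b = Bool.xor-identityʳ (F g)

cut-toggle : ∀ {n m} (ends : Ends n m) b e F S →
             cut ends (toggle b e F) S ≡ cut ends F S xor (b ∧ crosses (ends e) S)
cut-toggle ends b e F S = trans (cut-△ ends F (λ g → b ∧ single e g) S) (cong (cut ends F S xor_) (scaled b))
  where
  scaled : ∀ b → cut ends (λ g → b ∧ single e g) S ≡ b ∧ crosses (ends e) S
  scaled false = Xor.sum-zero (λ g → false ∧ crosses (ends g) S) λ _ → refl
  scaled true  = cut-single ends e S

-- Removal is written as a symmetric difference so that `cut-toggle` computes its effect on cuts.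
drop : ∀ {m} → Fin m → EdgeSet m → EdgeSet m
drop e F = toggle (F e) e F

drop-same : ∀ {m} (e : Fin m) F → drop e F e ≡ false
drop-same e F = trans (toggle-same (F e) e F) (Bool.xor-same (F e))

drop-other : ∀ {m} {e g : Fin m} F → e ≢ g → drop e F g ≡ F g
drop-other {e = e} F = toggle-other (F e) F

drop-⊆ : ∀ {m} (e : Fin m) F → drop e F ⊆ₑ F
drop-⊆ e F {g} h with e ≟ g
... | no _ = trans (sym (Bool.xor-identityʳ (F g))) (subst (λ b → F g xor b ≡ true) (Bool.∧-zeroʳ (F e)) h)
... | yes refl with F e
...   | true  = refl
...   | false = h

drop-mono : ∀ {m} {F A : EdgeSet m} e → F ⊆ₑ A → drop e F ⊆ₑ drop e A
drop-mono {F = F} {A} e F⊆A {g} h = in-drop (e ≟ g)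
  where
  in-drop : Dec (e ≡ g) → drop e A g ≡ true
  in-drop (yes refl) = contradiction h λ h → true≢false h (drop-same e F)
  in-drop (no e≢g)   = trans (drop-other A e≢g) (F⊆A (drop-⊆ e F h))

⊆-drop : ∀ {m} {F A : EdgeSet m} {e} → F ⊆ₑ A → F e ≡ false → F ⊆ₑ drop e A
⊆-drop {F = F} {A} {e} F⊆A Fe {g} h = in-drop (e ≟ g)
  where
  in-drop : Dec (e ≡ g) → drop e A g ≡ true
  in-drop (yes refl) = contradiction Fe (true≢false h)
  in-drop (no e≢g)   = trans (drop-other A e≢g) (F⊆A h)

𝟙 : Bool → ℚ
𝟙 b = if b then 1ℚ else 0ℚ

data Cone {m} (P : EdgeSet m → Set) (c : Fin m → ℚ) : Set where
  apex : (∀ e → c e ≡ 0ℚ) → Cone P c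
  ray  : ∀ {r F c′} → 0ℚ ≤ r → P F → Cone P c′ → (∀ e → c e ≡ r * 𝟙 (F e) + c′ e) → Cone P c

Cone-map : ∀ {m} {P Q : EdgeSet m → Set} → (∀ {F} → P F → Q F) → ∀ {c} → Cone P c → Cone Q c
Cone-map f (apex c≗0)        = apex c≗0
Cone-map f (ray 0≤r p rest eq) = ray 0≤r (f p) (Cone-map f rest) eq

Cone-nonneg : ∀ {m} {P : EdgeSet m → Set} {c} → Cone P c → ∀ e → 0ℚ ≤ c e
Cone-nonneg (apex c≗0) e = ℚ.≤-reflexive (sym (c≗0 e))
Cone-nonneg (ray {F = F} 0≤r p rest eq) e =
  subst (0ℚ ≤_) (sym (eq e)) (0≤r ⊗ 𝟙-nonneg (F e) ⊕ Cone-nonneg rest e)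
  where
  𝟙-nonneg : ∀ b → 0ℚ ≤ 𝟙 b
  𝟙-nonneg false = ℚ.≤-refl
  𝟙-nonneg true  = ℚ.nonNegative⁻¹ 1ℚ

Cone-drop : ∀ {m} {P Q : EdgeSet m → Set} e → (∀ {F} → P F → Q (drop e F)) →
            ∀ {c} → Cone P c → Cone Q (override e 0ℚ c)
Cone-drop e f {c} (apex c≗0) = apex zero-off
  where
  zero-off : ∀ g → override e 0ℚ c g ≡ 0ℚ
  zero-off g with does (e ≟ g)
  ... | true  = refl
  ... | false = c≗0 g
Cone-drop e f {c} (ray {r} {F} {c′} 0≤r p rest eq) = ray 0≤r (f p) (Cone-drop e f rest) λ g → dropped g (e ≟ g)
  where
  dropped : ∀ g → Dec (e ≡ g) → override e 0ℚ c g ≡ r * 𝟙 (drop e F g) + override e 0ℚ c′ g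
  dropped g (yes refl) = trans (override-same e 0ℚ c) (sym (trans
    (cong₂ (λ b x → r * 𝟙 b + x) (drop-same e F) (override-same e 0ℚ c′)) (lemma r)))
    where
    lemma : ∀ r → r * 0ℚ + 0ℚ ≡ 0ℚ
    lemma = solve-∀ ℚ-ring
  dropped g (no e≢g) = trans (override-other 0ℚ c e≢g) (trans (eq g) (sym
    (cong₂ (λ b x → r * 𝟙 b + x) (drop-other F e≢g) (override-other 0ℚ c′ e≢g))))

SumOf-map : ∀ {m} {P Q : EdgeSet m → Set} → (∀ {F} → P F → Q F) → ∀ {k} → SumOf P k → SumOf Q k
SumOf-map f (sum-none k≗0)       = sum-none k≗0
SumOf-map f (sum-more p rest eq) = sum-more (f p) (SumOf-map f rest) eq

SumOf-copies : ∀ {m} {P : EdgeSet m → Set} {F} → P F → ∀ j → SumOf P (λ e → j ℕ.* bit (F e))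
SumOf-copies p zero    = sum-none λ _ → refl
SumOf-copies p (suc j) = sum-more p (SumOf-copies p j) λ _ → refl

SumOf-avoids : ∀ {m} {P : EdgeSet m → Set} {e} → (∀ {F} → P F → F e ≡ false) →
               ∀ {k} → SumOf P k → k e ≡ 0
SumOf-avoids {e = e} off (sum-none k≗0)       = k≗0 e
SumOf-avoids {e = e} off (sum-more p rest eq) =
  trans (eq e) (cong₂ (λ b k → bit b ℕ.+ k) (off p) (SumOf-avoids off rest))

-- The rounding problem; loops and pendant edges

module _ {n m} (ends : Ends n m) where

  EvenIn : EdgeSet m → EdgeSet m → Set
  EvenIn A F = Even ends F × F ⊆ₑ A

  -- The doubling in `half` cannot be avoided: on three parallel edges, the value 1 on each is half
  -- the sum of the three pairs, but not a sum of even sets, whose total is always even. The cost is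
  -- one sum of differences so that it can be compared coordinatewise with that of a smaller
  -- problem.
  record Rounded (A : EdgeSet m) (c ω : Fin m → ℚ) : Set where
    field
      z      : Fin m → ℤ
      within : ∀ e → fromℤ (z e) ⊑ c e
      cost   : 0ℚ ≤ Rational.sum λ e → ω e * (c e - fromℤ (z e))
      {k}    : Fin m → ℕ
      sum    : SumOf (EvenIn A) k
      half   : ∀ e → z e ℤ.+ z e ≡ ℤ.+ k e

  -- Box-integrality of the cycle cone of the subgraph with edge set A,
  -- together with the fact that its integer points are half sums of even sets.
  Roundable : EdgeSet m → Set
  Roundable A = ∀ c → Cone (EvenIn A) c → ∀ ω → Rounded A c ω

drop-even-loop : ∀ {n m} {ends : Ends n m} {e} → proj₁ (ends e) ≡ proj₂ (ends e) →
                 ∀ {F} → Even ends F → Even ends (drop e F)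
drop-even-loop {ends = ends} {e} loop {F} F-even S = trans (cut-toggle ends (F e) e F S)
  (cong₂ _xor_ (F-even S) (trans (cong (F e ∧_) (trans
    (cong (λ p → S p xor S (proj₂ (ends e))) loop) (Bool.xor-same (S (proj₂ (ends e))))))
    (Bool.∧-zeroʳ (F e))))

roundable-empty : ∀ {n m} {ends : Ends n m} {A} → (∀ e → A e ≡ false) → Roundable ends A
roundable-empty {m = m} {ends} {A} empty c c∈ ω = record
  { z = λ _ → ℤ.+ 0 ; within = λ e → subst (0ℚ ⊑_) (sym (vanishes c∈ e)) ⊑-refl
  ; cost = ℚ.≤-reflexive (sym (Rational.sum-zero (λ e → ω e * (c e - 0ℚ)) λ e →
      trans (cong (λ x → ω e * (x - 0ℚ)) (vanishes c∈ e)) (lemma (ω e))))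
  ; sum = sum-none λ _ → refl ; half = λ _ → refl }
  where
  lemma : ∀ w → w * (0ℚ - 0ℚ) ≡ 0ℚ
  lemma = solve-∀ ℚ-ring
  lemma′ : ∀ r → r * 0ℚ + 0ℚ ≡ 0ℚ
  lemma′ = solve-∀ ℚ-ring
  vanishes : ∀ {c} → Cone (EvenIn ends A) c → ∀ e → c e ≡ 0ℚ
  vanishes (apex c≗0) = c≗0
  vanishes (ray {r} {F} 0≤r (_ , F⊆A) rest eq) e = trans (eq e) (trans
    (cong₂ (λ b x → r * 𝟙 b + x) (Bool.¬-not λ Fe → true≢false (F⊆A Fe) (empty e)) (vanishes rest e))
    (lemma′ r))

-- A reduction changes the cost terms of only one edge, or of two in the next lemma, so only these
-- have to be compared with the smaller problem.
cost-transfer₁ : ∀ {m} (e : Fin m) {d d′ : Fin m → ℚ} → (∀ g → e ≢ g → d g ≡ d′ g) → d′ e ≤ d e →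
                 0ℚ ≤ Rational.sum d′ → 0ℚ ≤ Rational.sum d
cost-transfer₁ {m} e {d} {d′} same better 0≤ = subst (0ℚ ≤_) (sym total) (0≤ ⊕ slack better)
  where
  total : Rational.sum d ≡ Rational.sum d′ + (d e - d′ e)
  total = trans (Rational.sum-cong-≗ λ g → regroup (d g) (d′ g))
    (trans (Rational.∑-distrib-+ d′ (λ g → d g - d′ g)) (cong (Rational.sum d′ +_)
      (Rational.sum-single e (λ g → d g - d′ g) λ g e≢g →
        trans (cong (_- d′ g) (same g e≢g)) (ℚ.+-inverseʳ (d′ g)))))
    where
    regroup : ∀ x y → x ≡ y + (x - y)
    regroup = solve-∀ ℚ-ring

cost-transfer₂ : ∀ {m} {e f : Fin m} → e ≢ f → ∀ {d d′ : Fin m → ℚ} →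
                 (∀ g → e ≢ g → f ≢ g → d g ≡ d′ g) → d′ e + d′ f ≤ d e + d f →
                 0ℚ ≤ Rational.sum d′ → 0ℚ ≤ Rational.sum d
cost-transfer₂ {m} {e} {f} e≢f {d} {d′} same better 0≤ = subst (0ℚ ≤_) (sym total) (0≤ ⊕ slack better)
  where
  regroup : ∀ x y → x ≡ y + (x - y)
  regroup = solve-∀ ℚ-ring
  regroup′ : ∀ x y u v → (x - y) + (u - v) ≡ x + u - (y + v)
  regroup′ = solve-∀ ℚ-ring
  total : Rational.sum d ≡ Rational.sum d′ + (d e + d f - (d′ e + d′ f))
  total = trans (Rational.sum-cong-≗ λ g → regroup (d g) (d′ g))
    (trans (Rational.∑-distrib-+ d′ (λ g → d g - d′ g)) (cong (Rational.sum d′ +_)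
      (trans (Rational.sum-pair e≢f (λ g → d g - d′ g) λ g e≢g f≢g →
        trans (cong (_- d′ g) (same g e≢g f≢g)) (ℚ.+-inverseʳ (d′ g)))
        (regroup′ (d e) (d′ e) (d f) (d′ f)))))

nonneg⇒ℕ : ∀ {z} → 0ℚ ≤ fromℤ z → ∃[ j ] ℤ.+ j ≡ z
nonneg⇒ℕ {z} 0≤z = ℤ.∣ z ∣ , ℤ.0≤i⇒+∣i∣≡i (fromℤ-cancel-≤ {ℤ.+ 0} {z} 0≤z)

round-towards : ∀ w x → ∃[ z ] (fromℤ z ⊑ x × w * fromℤ z ≤ w * x)
round-towards w x = choose (floor x) (ceiling x) (ℚ.≤-total 0ℚ w)
  where
  choose : ∃[ f ] IsFloor x f → ∃[ c ] IsCeiling x c → 0ℚ ≤ w ⊎ w ≤ 0ℚ → _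
  choose (f , fl@(f≤x , _)) (c , ce@(x≤c , _)) (inj₁ 0≤w) =
    f , ⊑-between fl ce ℚ.≤-refl (ℚ.≤-trans f≤x x≤c) , ℚ.*-monoˡ-≤-nonNeg w {{ℚ.nonNegative 0≤w}} f≤x
  choose (f , fl@(f≤x , _)) (c , ce@(x≤c , _)) (inj₂ w≤0) =
    c , ⊑-between fl ce (ℚ.≤-trans f≤x x≤c) ℚ.≤-refl , ℚ.*-monoˡ-≤-nonPos w {{ℚ.nonPositive w≤0}} x≤c

*-slack : ∀ w x y → w * y ≤ w * x → 0ℚ ≤ w * (x - y)
*-slack w x y h = subst (0ℚ ≤_) (lemma w x y) (slack h)
  where
  lemma : ∀ w x y → w * x - w * y ≡ w * (x - y)
  lemma = solve-∀ ℚ-ring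

module _ {n m} {ends : Ends n m} {A : EdgeSet m} where

  EvenIn-drop : ∀ {e F} → EvenIn ends (drop e A) F → EvenIn ends A F
  EvenIn-drop {e} (F-even , F⊆) = F-even , λ h → drop-⊆ e A (F⊆ h)

  EvenIn-drop-avoids : ∀ {ends′ : Ends n m} {e F} → EvenIn ends′ (drop e A) F → F e ≡ false
  EvenIn-drop-avoids {e = e} (_ , F⊆) = Bool.¬-not λ Fe → true≢false (F⊆ Fe) (drop-same e A)

  roundable-loop : ∀ {e} → A e ≡ true → proj₁ (ends e) ≡ proj₂ (ends e) →
                   Roundable ends (drop e A) → Roundable ends A
  roundable-loop {e} Ae loop rec c c∈ ω = assemble
    (rec (override e 0ℚ c) (Cone-drop e (λ {F} (F-even , F⊆A) → drop-even-loop {ends = ends} loop {F} F-even , drop-mono e F⊆A) c∈)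
         (override e 0ℚ ω))
    (round-towards (ω e) (c e))
    where
    c̃ ω̃ : Fin m → ℚ
    c̃ = override e 0ℚ c
    ω̃ = override e 0ℚ ω
    assemble : Rounded ends (drop e A) c̃ ω̃ → ∃[ x ] (fromℤ x ⊑ c e × ω e * fromℤ x ≤ ω e * c e) →
               Rounded ends A c ω
    assemble R (x , x⊑ , x-cost) = with-count (nonneg⇒ℕ (⊑-nonneg x⊑ (Cone-nonneg c∈ e)))
      where
      open Rounded R renaming (z to z̃)
      z : Fin m → ℤ
      z = override e x z̃
      within′ : ∀ g → Dec (e ≡ g) → fromℤ (z g) ⊑ c g
      within′ g (yes refl) = subst (λ y → fromℤ y ⊑ c e) (sym (override-same e x z̃)) x⊑
      within′ g (no e≢g)   = subst₂ (λ y a → fromℤ y ⊑ a) (sym (override-other x z̃ e≢g))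
        (override-other 0ℚ c e≢g) (within g)
      with-count : ∃[ j ] ℤ.+ j ≡ x → Rounded ends A c ω
      with-count (j , +j≡x) = record
        { z = z ; within = λ g → within′ g (e ≟ g)
        ; cost = cost-transfer₁ e
            (λ g e≢g → sym (cong₂ _*_ (override-other 0ℚ ω e≢g)
              (cong₂ (λ a y → a - fromℤ y) (override-other 0ℚ c e≢g) (sym (override-other x z̃ e≢g)))))
            (subst₂ _≤_ (sym (trans (cong (_* (c̃ e - fromℤ (z̃ e))) (override-same e 0ℚ ω)) (ℚ.*-zeroˡ (c̃ e - fromℤ (z̃ e)))))
              (cong (λ y → ω e * (c e - fromℤ y)) (sym (override-same e x z̃)))
              (*-slack (ω e) (c e) (fromℤ x) x-cost))
            cost
        -- The coordinate of the loop is independent of the others. The loop is taken `j + j` times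
        -- because the sum represents `z` doubled.
        ; sum = SumOf-+ (SumOf-copies single-even (j ℕ.+ j)) (SumOf-map EvenIn-drop sum)
        ; half = λ g → half′ g (e ≟ g) }
        where
        single-even : EvenIn ends A (single e)
        single-even = circuit⇒even ends (loop-circuit ends e loop) , member
          where
          member : single e ⊆ₑ A
          member {g} h with e ≟ g
          ... | yes refl = Ae
          member {g} () | no _
        half′ : ∀ g → Dec (e ≡ g) → z g ℤ.+ z g ≡ ℤ.+ ((j ℕ.+ j) ℕ.* bit (single e g) ℕ.+ k g)
        half′ g (yes refl) rewrite does-≟-refl g | SumOf-avoids {e = g} (EvenIn-drop-avoids {ends}) sum
          | ℕ.+-identityʳ ((j ℕ.+ j) ℕ.* 1) | ℕ.*-identityʳ (j ℕ.+ j) | sym +j≡x = refl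
        half′ g (no e≢g) rewrite does-≟-≢ e≢g | ℕ.*-zeroʳ (j ℕ.+ j) = half g

  -- The bridge is a pendant edge: among active edges the star of `v` is `e` alone, so no even set
  -- contains `e` and the cone already lives on the other edges.
  roundable-bridge : ∀ {e u v} → Joins (ends e) u v → u ≢ v →
                     (∀ {g} → A g ≡ true → Incident (graph ends) g v → e ≡ g) →
                     Roundable ends (drop e A) → Roundable ends A
  roundable-bridge {e} {u} {v} ends-e u≢v unique rec c c∈ ω = record
    { z = z ; within = within ; cost = cost ; sum = SumOf-map EvenIn-drop sum ; half = half }
    where
    at-e : crosses (ends e) (at v) ≡ true
    at-e = trans (Contraction.crosses-e ends e u v ends-e u≢v (at v))
      (cong₂ _xor_ (does-≟-≢ u≢v) (does-≟-refl v))
    avoids : ∀ {F} → EvenIn ends A F → F e ≡ false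
    avoids {F} (F-even , F⊆A) = trans (sym (Bool.∧-identityʳ (F e))) (trans (cong (F e ∧_) (sym at-e))
      (trans (sym (Xor.sum-single e (λ g → F g ∧ crosses (ends g) (at v)) off)) (F-even (at v))))
      where
      off : ∀ g → e ≢ g → F g ∧ crosses (ends g) (at v) ≡ false
      off g e≢g with F g in Fg
      ... | false = refl
      ... | true  = cong₂ _xor_ (does-≟-≢ λ p → e≢g (unique (F⊆A Fg) (inj₁ p)))
                                (does-≟-≢ λ p → e≢g (unique (F⊆A Fg) (inj₂ p)))
    open Rounded (rec c (Cone-map (λ {F} P → proj₁ P , ⊆-drop {F = F} {A} {e} (proj₂ P) (avoids P)) c∈) ω)

-- e and f are the only edges at v, so an even set contains both or neither.
module Series {n m} {ends : Ends n m} {A : EdgeSet m} {e f : Fin m} {s t v : Fin n}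
              (e≢f : e ≢ f) (Af : A f ≡ true)
              (ends-e : Joins (ends e) s v) (s≢v : s ≢ v) (ends-f : Joins (ends f) t v) (t≢v : t ≢ v)
              (unique : ∀ {g} → A g ≡ true → Incident (graph ends) g v → e ≡ g ⊎ f ≡ g) where

  open Contraction ends f t v ends-f t≢v using (ends′; crosses-e; merge-u; merge-v)

  at-e : crosses (ends e) (at v) ≡ true
  at-e = trans (Contraction.crosses-e ends e s v ends-e s≢v (at v))
    (cong₂ _xor_ (does-≟-≢ s≢v) (does-≟-refl v))

  at-f : crosses (ends f) (at v) ≡ true
  at-f = trans (crosses-e (at v)) (cong₂ _xor_ (does-≟-≢ t≢v) (does-≟-refl v))

  cut-v : ∀ {F} → F ⊆ₑ A → cut ends F (at v) ≡ F e xor F f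
  cut-v {F} F⊆A = trans (Xor.sum-pair e≢f (λ g → F g ∧ crosses (ends g) (at v)) off)
    (cong₂ _xor_ (trans (cong (F e ∧_) at-e) (Bool.∧-identityʳ (F e)))
                 (trans (cong (F f ∧_) at-f) (Bool.∧-identityʳ (F f))))
    where
    off : ∀ g → e ≢ g → f ≢ g → F g ∧ crosses (ends g) (at v) ≡ false
    off g e≢g f≢g with F g in Fg
    ... | false = refl
    ... | true  = cong₂ _xor_ (does-≟-≢ (not-incident ∘ inj₁)) (does-≟-≢ (not-incident ∘ inj₂))
      where
      not-incident : ¬ Incident (graph ends) g v
      not-incident inc with unique (F⊆A Fg) inc
      ... | inj₁ e≡g = e≢g e≡g
      ... | inj₂ f≡g = f≢g f≡g

  agree : ∀ {F} → EvenIn ends A F → F e ≡ F f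
  agree {F} (F-even , F⊆A) = xor-false (F e) (F f) (trans (sym (cut-v F⊆A)) (F-even (at v)))
    where
    xor-false : ∀ a b → a xor b ≡ false → a ≡ b
    xor-false false b    eq = sym eq
    xor-false true  true eq = refl

  contract : ∀ {F} → EvenIn ends A F → EvenIn ends′ (drop f A) (drop f F)
  contract {F} (F-even , F⊆A) = (λ S → trans (cut-toggle ends′ (F f) f F S)
    (cong₂ _xor_ (F-even (S ∘ merge t v)) (trans (cong (F f ∧_) (trans (crosses-e (S ∘ merge t v))
      (trans (cong₂ _xor_ (cong S merge-u) (cong S merge-v)) (Bool.xor-same (S t)))))
      (Bool.∧-zeroʳ (F f))))) , drop-mono f F⊆A

  -- `S` and `S ∘ merge t v` differ only at `v`, and only if `S` separates `v` from `t`. There the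
  -- star of `v` contributes the parity `F e`, as `f` is absent from `F`; adding `f` exactly when
  -- `e` is present cancels this, because `f` crosses under the same condition.
  expand : ∀ {F} → EvenIn ends′ (drop f A) F → EvenIn ends A (toggle (F e) f F)
  expand {F} (F-even , F⊆A′) = even , λ {g} → member g (f ≟ g)
    where
    F⊆A : F ⊆ₑ A
    F⊆A Fg = drop-⊆ f A (F⊆A′ Fg)
    Ff : F f ≡ false
    Ff = EvenIn-drop-avoids {ends = ends} {A} {ends′} (F-even , F⊆A′)
    member : ∀ g → Dec (f ≡ g) → toggle (F e) f F g ≡ true → A g ≡ true
    member g (yes refl) _ = Af
    member g (no f≢g)   h = F⊆A (trans (sym (toggle-other (F e) F f≢g)) h)
    even : Even ends (toggle (F e) f F)
    even S = trans (cut-toggle ends (F e) f F S) (trans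
      (cong₂ _xor_ cut-F (cong (F e ∧_) (crosses-e S))) (cancel (F e) (S v) (S t)))
      where
      split : ∀ w → S w ≡ S (merge t v w) xor ((S v xor S t) ∧ at v w)
      split w with w ≟ v
      ... | yes refl = cases (S v) (S t)
        where
        cases : ∀ a b → a ≡ b xor ((a xor b) ∧ true)
        cases false false = refl
        cases false true  = refl
        cases true  false = refl
        cases true  true  = refl
      ... | no _ = sym (trans (cong (S w xor_) (Bool.∧-zeroʳ (S v xor S t))) (Bool.xor-identityʳ (S w)))
      scale-cut : ∀ b → cut ends F (λ w → b ∧ at v w) ≡ b ∧ cut ends F (at v)
      scale-cut false = cut-const ends F (λ w → false ∧ at v w) λ _ → refl
      scale-cut true  = refl
      cut-F : cut ends F S ≡ (S v xor S t) ∧ F e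
      cut-F = trans (Xor.sum-cong-≗ λ g → cong (F g ∧_) (cong₂ _xor_ (split _) (split _)))
        (trans (cut-xor ends F (S ∘ merge t v) (λ w → (S v xor S t) ∧ at v w))
          (cong₂ _xor_ (F-even S) (trans (scale-cut (S v xor S t)) (cong ((S v xor S t) ∧_)
            (trans (cut-v F⊆A) (trans (cong (F e xor_) Ff) (Bool.xor-identityʳ (F e))))))))
      cancel : ∀ x a b → ((a xor b) ∧ x) xor (x ∧ (b xor a)) ≡ false
      cancel false a b = trans (Bool.xor-identityʳ ((a xor b) ∧ false)) (Bool.∧-zeroʳ (a xor b))
      cancel true  false false = refl
      cancel true  false true  = refl
      cancel true  true  false = refl
      cancel true  true  true  = refl

  cone-agree : ∀ {c} → Cone (EvenIn ends A) c → c e ≡ c f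
  cone-agree (apex c≗0) = trans (c≗0 e) (sym (c≗0 f))
  cone-agree (ray {r} 0≤r p rest eq) = trans (eq e) (trans
    (cong₂ (λ b x → r * 𝟙 b + x) (agree p) (cone-agree rest)) (sym (eq f)))

  sum-expand : ∀ {k} → SumOf (EvenIn ends′ (drop f A)) k → SumOf (EvenIn ends A) (override f (k e) k)
  sum-expand {k} (sum-none k≗0) = sum-none λ g → zeros g (f ≟ g)
    where
    zeros : ∀ g → Dec (f ≡ g) → override f (k e) k g ≡ 0
    zeros g (yes refl) = trans (override-same f (k e) k) (k≗0 e)
    zeros g (no f≢g)   = trans (override-other (k e) k f≢g) (k≗0 g)
  sum-expand {k} (sum-more {F} {k′} p rest eq) = sum-more (expand p) (sum-expand rest) λ g → terms g (f ≟ g)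
    where
    Ff : F f ≡ false
    Ff = EvenIn-drop-avoids {ends = ends} {A} {ends′} p
    terms : ∀ g → Dec (f ≡ g) → override f (k e) k g ≡ bit (toggle (F e) f F g) ℕ.+ override f (k′ e) k′ g
    terms g (yes refl) = trans (override-same f (k e) k) (trans (eq e) (sym (cong₂ (λ b x → bit b ℕ.+ x)
      (trans (toggle-same (F e) f F) (cong (_xor F e) Ff)) (override-same f (k′ e) k′))))
    terms g (no f≢g) = trans (override-other (k e) k f≢g) (trans (eq g) (sym (cong₂ (λ b x → bit b ℕ.+ x)
      (toggle-other (F e) F f≢g) (override-other (k′ e) k′ f≢g))))

  roundable-series : Roundable ends′ (drop f A) → Roundable ends A
  roundable-series rec c c∈ ω = record
    { z = override f (z̃ e) z̃
    ; within = λ g → within′ g (f ≟ g)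
    ; cost = cost-transfer₂ e≢f costs-other costs-ef cost
    ; sum = sum-expand sum
    ; half = λ g → half′ g (f ≟ g) }
    where
    c̃ ω̃ : Fin m → ℚ
    c̃ = override f 0ℚ c
    -- The coordinates of `e` and `f` agree on the cone, so `e` inherits both weights.
    ω̃ = override f 0ℚ (override e (ω e + ω f) ω)
    open Rounded (rec c̃ (Cone-drop f contract c∈) ω̃) renaming (z to z̃)
    f≢e = e≢f ∘ sym
    within′ : ∀ g → Dec (f ≡ g) → fromℤ (override f (z̃ e) z̃ g) ⊑ c g
    within′ g (yes refl) = subst₂ (λ y a → fromℤ y ⊑ a) (sym (override-same f (z̃ e) z̃))
      (trans (override-other 0ℚ c f≢e) (cone-agree c∈)) (within e)
    within′ g (no f≢g) = subst₂ (λ y a → fromℤ y ⊑ a) (sym (override-other (z̃ e) z̃ f≢g))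
      (override-other 0ℚ c f≢g) (within g)
    costs-other : ∀ g → e ≢ g → f ≢ g →
                  ω g * (c g - fromℤ (override f (z̃ e) z̃ g)) ≡ ω̃ g * (c̃ g - fromℤ (z̃ g))
    costs-other g e≢g f≢g = sym (cong₂ _*_
      (trans (override-other 0ℚ (override e (ω e + ω f) ω) f≢g) (override-other (ω e + ω f) ω e≢g))
      (cong₂ (λ a y → a - fromℤ y) (override-other 0ℚ c f≢g) (sym (override-other (z̃ e) z̃ f≢g))))
    costs-ef : ω̃ e * (c̃ e - fromℤ (z̃ e)) + ω̃ f * (c̃ f - fromℤ (z̃ f)) ≤
               ω e * (c e - fromℤ (override f (z̃ e) z̃ e)) + ω f * (c f - fromℤ (override f (z̃ e) z̃ f))
    costs-ef = ℚ.≤-reflexive (trans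
      (cong₂ _+_ (cong₂ _*_ (trans (override-other 0ℚ (override e (ω e + ω f) ω) f≢e)
                                   (override-same e (ω e + ω f) ω))
                            (cong (_- fromℤ (z̃ e)) (override-other 0ℚ c f≢e)))
                 (cong (_* (c̃ f - fromℤ (z̃ f))) (override-same f 0ℚ (override e (ω e + ω f) ω))))
      (trans (lemma (ω e) (ω f) (c e) (fromℤ (z̃ e)) (c̃ f - fromℤ (z̃ f)))
        (sym (cong₂ _+_
          (cong (λ y → ω e * (c e - fromℤ y)) (override-other (z̃ e) z̃ f≢e))
          (cong₂ (λ a y → ω f * (a - fromℤ y)) (sym (cone-agree c∈)) (override-same f (z̃ e) z̃))))))
      where
      lemma : ∀ a b x y q → (a + b) * (x - y) + 0ℚ * q ≡ a * (x - y) + b * (x - y)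
      lemma = solve-∀ ℚ-ring
    half′ : ∀ g → Dec (f ≡ g) → override f (z̃ e) z̃ g ℤ.+ override f (z̃ e) z̃ g ≡ ℤ.+ override f (k e) k g
    half′ g (yes refl) rewrite override-same f (z̃ e) z̃ | override-same f (k e) k = half e
    half′ g (no f≢g) rewrite override-other (z̃ e) z̃ f≢g | override-other (k e) k f≢g = half g

-- Parallel edges e and f: c e and c f split the flow s that the pair carries
-- through the rest of the graph, up to circulation around {e , f}.
module Parallel {n m} {ends : Ends n m} {A : EdgeSet m} {e f : Fin m} (e≢f : e ≢ f)
                (Ae : A e ≡ true) (Af : A f ≡ true)
                (parallel : Joins (ends f) (proj₁ (ends e)) (proj₂ (ends e))) where

  f≢e : f ≢ e
  f≢e = e≢f ∘ sym

  set : ∀ {B : Set} → B → B → (Fin m → B) → Fin m → B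
  set x y h = override f y (override e x h)

  set-e : ∀ {B : Set} x y (h : Fin m → B) → set x y h e ≡ x
  set-e x y h = trans (override-other y (override e x h) f≢e) (override-same e x h)

  set-f : ∀ {B : Set} x y (h : Fin m → B) → set x y h f ≡ y
  set-f x y h = override-same f y (override e x h)

  set-other : ∀ {B : Set} x y (h : Fin m → B) {g} → e ≢ g → f ≢ g → set x y h g ≡ h g
  set-other x y h e≢g f≢g = trans (override-other y (override e x h) f≢g) (override-other x h e≢g)

  by-cases : ∀ {P : Fin m → Set} → P e → P f → (∀ g → e ≢ g → f ≢ g → P g) → ∀ g → P g
  by-cases Pe Pf P-other g with e ≟ g | f ≟ g
  ... | yes refl | _        = Pe
  ... | no _     | yes refl = Pf
  ... | no e≢g   | no f≢g   = P-other g e≢g f≢g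

  crosses-f : ∀ S → crosses (ends f) S ≡ crosses (ends e) S
  crosses-f S = cases parallel
    where
    cases : Joins (ends f) (proj₁ (ends e)) (proj₂ (ends e)) → crosses (ends f) S ≡ crosses (ends e) S
    cases (inj₁ eq) = cong (λ p → crosses p S) eq
    cases (inj₂ eq) = trans (cong (λ p → crosses p S) eq) (Bool.xor-comm (S (proj₂ (ends e))) _)

  -- Adds the circuit formed by `e` and `f`; a set containing exactly one of the two is thereby
  -- rerouted through the other.
  exchange : Bool → EdgeSet m → EdgeSet m
  exchange b F = toggle b f (toggle b e F)

  exchange-e : ∀ b F → exchange b F e ≡ F e xor b
  exchange-e b F = trans (toggle-other b (toggle b e F) f≢e) (toggle-same b e F)

  exchange-f : ∀ b F → exchange b F f ≡ F f xor b
  exchange-f b F = trans (toggle-same b f (toggle b e F)) (cong (_xor b) (toggle-other b F e≢f))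

  exchange-other : ∀ b F {g} → e ≢ g → f ≢ g → exchange b F g ≡ F g
  exchange-other b F e≢g f≢g = trans (toggle-other b (toggle b e F) f≢g) (toggle-other b F e≢g)

  exchange-even : ∀ b {F} → EvenIn ends A F → EvenIn ends A (exchange b F)
  exchange-even b {F} (F-even , F⊆A) = even , λ {g} → by-cases {λ g → exchange b F g ≡ true → A g ≡ true}
    (λ _ → Ae) (λ _ → Af) (λ g e≢g f≢g h → F⊆A (trans (sym (exchange-other b F e≢g f≢g)) h)) g
    where
    even : Even ends (exchange b F)
    even S = trans (cut-toggle ends b f (toggle b e F) S) (trans
      (cong₂ _xor_ (trans (cut-toggle ends b e F S) (cong (_xor (b ∧ crosses (ends e) S)) (F-even S)))
                   (cong (b ∧_) (crosses-f S)))
      (Bool.xor-same (b ∧ crosses (ends e) S)))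

  fold-even : ∀ {F} → EvenIn ends A F → EvenIn ends (drop f A) (exchange (F f) F)
  fold-even {F} F∈ = proj₁ (exchange-even (F f) F∈)
    , λ {g} → ⊆-drop {F = exchange (F f) F} {A} {f} (λ {g} → proj₂ (exchange-even (F f) F∈) {g})
                     (trans (exchange-f (F f) F) (Bool.xor-same (F f))) {g}

  -- Each ray is rerouted so that it avoids `f`, and `s` collects the rays that contain exactly one
  -- of `e` and `f`. A single ray contributes a point of the triangle cone, which is closed under
  -- addition.
  cone-fold : ∀ {c} → Cone (EvenIn ends A) c →
              ∃[ s ] (Cone (EvenIn ends (drop f A)) (set s 0ℚ c) × Triangle (c e) (c f) s)
  cone-fold {c} (apex c≗0) = 0ℚ
    , apex (by-cases (set-e 0ℚ 0ℚ c) (set-f 0ℚ 0ℚ c) λ g e≢g f≢g → trans (set-other 0ℚ 0ℚ c e≢g f≢g) (c≗0 g))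
    , subst₂ (λ x y → Triangle x y 0ℚ) (sym (c≗0 e)) (sym (c≗0 f)) (ℚ.≤-refl , ℚ.≤-refl , ℚ.≤-refl)
  cone-fold {c} (ray {r} {F} {c′} 0≤r p rest eq) = extend (cone-fold rest)
    where
    extend : ∃[ s ] (Cone (EvenIn ends (drop f A)) (set s 0ℚ c′) × Triangle (c′ e) (c′ f) s) →
             ∃[ s ] (Cone (EvenIn ends (drop f A)) (set s 0ℚ c) × Triangle (c e) (c f) s)
    extend (s′ , c̃′∈ , T) = s , ray 0≤r (fold-even p) c̃′∈ coordinates
      , subst₂ (λ x y → Triangle x y s) (sym (eq e)) (sym (eq f)) (triangle (F e) (F f) T)
      where
      s = r * 𝟙 (F e xor F f) + s′
      F̃ = exchange (F f) F
      lemma : ∀ r → 0ℚ ≡ r * 0ℚ + 0ℚ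
      lemma = solve-∀ ℚ-ring
      coordinates : ∀ g → set s 0ℚ c g ≡ r * 𝟙 (F̃ g) + set s′ 0ℚ c′ g
      coordinates = by-cases
        (trans (set-e s 0ℚ c) (sym (cong₂ (λ b x → r * 𝟙 b + x) (exchange-e (F f) F) (set-e s′ 0ℚ c′))))
        (trans (set-f s 0ℚ c) (trans (lemma r) (sym (cong₂ (λ b x → r * 𝟙 b + x)
          (trans (exchange-f (F f) F) (Bool.xor-same (F f))) (set-f s′ 0ℚ c′)))))
        (λ g e≢g f≢g → trans (set-other s 0ℚ c e≢g f≢g) (trans (eq g) (sym (cong₂ (λ b x → r * 𝟙 b + x)
          (exchange-other (F f) F e≢g f≢g) (set-other s′ 0ℚ c′ e≢g f≢g)))))
      triangle-+ : ∀ {a b d x y s} → Triangle (r * a) (r * b) (r * d) → Triangle x y s →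
                   Triangle (r * a + x) (r * b + y) (r * d + s)
      triangle-+ {a} {b} {d} {x} {y} {s} (p , q , o) (p′ , q′ , o′) =
          ≤-from (slack p ⊕ slack p′) (regroup (r * a) (r * b) (r * d) x y s)
        , ≤-from (slack q ⊕ slack q′) (regroup (r * b) (r * a) (r * d) y x s)
        , ≤-from (slack o ⊕ slack o′) (regroup (r * d) (r * a) (r * b) s x y)
        where
        regroup : ∀ a b d x y s → (b + d - a) + (y + s - x) ≡ (b + y) + (d + s) - (a + x)
        regroup = solve-∀ ℚ-ring
      unit-triangle : ∀ a b → Triangle (r * 𝟙 a) (r * 𝟙 b) (r * 𝟙 (a xor b))
      unit-triangle false false = ≤-from ℚ.≤-refl (solve (r ∷ []) ℚ-ring)
        , ≤-from ℚ.≤-refl (solve (r ∷ []) ℚ-ring) , ≤-from ℚ.≤-refl (solve (r ∷ []) ℚ-ring)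
      unit-triangle false true = ≤-from (0≤r ⊕ 0≤r) (solve (r ∷ []) ℚ-ring)
        , ≤-from ℚ.≤-refl (solve (r ∷ []) ℚ-ring) , ≤-from ℚ.≤-refl (solve (r ∷ []) ℚ-ring)
      unit-triangle true false = ≤-from ℚ.≤-refl (solve (r ∷ []) ℚ-ring)
        , ≤-from (0≤r ⊕ 0≤r) (solve (r ∷ []) ℚ-ring) , ≤-from ℚ.≤-refl (solve (r ∷ []) ℚ-ring)
      unit-triangle true true = ≤-from ℚ.≤-refl (solve (r ∷ []) ℚ-ring)
        , ≤-from ℚ.≤-refl (solve (r ∷ []) ℚ-ring) , ≤-from (0≤r ⊕ 0≤r) (solve (r ∷ []) ℚ-ring)
      triangle : ∀ a b → Triangle (c′ e) (c′ f) s′ →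
                 Triangle (r * 𝟙 a + c′ e) (r * 𝟙 b + c′ f) (r * 𝟙 (a xor b) + s′)
      triangle a b = triangle-+ (unit-triangle a b)

  -- Of the k e even sets through e, reroute β through f.
  sum-unfold : ∀ {k} → SumOf (EvenIn ends (drop f A)) k → ∀ α β → α ℕ.+ β ≡ k e →
               SumOf (EvenIn ends A) (set α β k)
  sum-unfold {k} (sum-none k≗0) α β α+β = sum-none (by-cases
    (trans (set-e α β k) (ℕ.m+n≡0⇒m≡0 α (trans α+β (k≗0 e))))
    (trans (set-f α β k) (ℕ.m+n≡0⇒n≡0 α (trans α+β (k≗0 e))))
    λ g e≢g f≢g → trans (set-other α β k e≢g f≢g) (k≗0 g))
  sum-unfold {k} (sum-more {F} {k′} p rest eq) α β α+β = split (F e) refl α β (trans α+β (eq e))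
    where
    F∈A : EvenIn ends A F
    F∈A = EvenIn-drop p
    Ff : F f ≡ false
    Ff = EvenIn-drop-avoids {ends = ends} {A} {ends} p
    unchanged : ∀ {α β α′ β′ b} → F e ≡ b → α ≡ bit b ℕ.+ α′ → β ≡ β′ →
                SumOf (EvenIn ends A) (set α′ β′ k′) → SumOf (EvenIn ends A) (set α β k)
    unchanged {α} {β} {α′} {β′} refl α≡ refl s = sum-more F∈A s (by-cases
      (trans (set-e α β k) (trans α≡ (cong (bit (F e) ℕ.+_) (sym (set-e α′ β′ k′)))))
      (trans (set-f α β k) (sym (cong₂ (λ b x → bit b ℕ.+ x) Ff (set-f α′ β′ k′))))
      λ g e≢g f≢g → trans (set-other α β k e≢g f≢g) (trans (eq g)
        (cong (bit (F g) ℕ.+_) (sym (set-other α′ β′ k′ e≢g f≢g)))))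
    rerouted : ∀ {β} → F e ≡ true → SumOf (EvenIn ends A) (set 0 β k′) →
               SumOf (EvenIn ends A) (set 0 (suc β) k)
    rerouted {β} Fe s = sum-more (exchange-even true F∈A) s (by-cases
      (trans (set-e 0 (suc β) k) (sym (cong₂ (λ b x → bit b ℕ.+ x)
        (trans (exchange-e true F) (cong (_xor true) Fe)) (set-e 0 β k′))))
      (trans (set-f 0 (suc β) k) (sym (cong₂ (λ b x → bit b ℕ.+ x)
        (trans (exchange-f true F) (cong (_xor true) Ff)) (set-f 0 β k′))))
      λ g e≢g f≢g → trans (set-other 0 (suc β) k e≢g f≢g) (trans (eq g) (sym (cong₂ (λ b x → bit b ℕ.+ x)
        (exchange-other true F e≢g f≢g) (set-other 0 β k′ e≢g f≢g)))))
    split : ∀ b → F e ≡ b → ∀ α β → α ℕ.+ β ≡ bit (F e) ℕ.+ k′ e → SumOf (EvenIn ends A) (set α β k)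
    split false Fe α β total = unchanged Fe refl refl
      (sum-unfold rest α β (trans total (cong (λ b → bit b ℕ.+ k′ e) Fe)))
    split true Fe (suc α) β total = unchanged Fe refl refl
      (sum-unfold rest α β (ℕ.suc-injective (trans total (cong (λ b → bit b ℕ.+ k′ e) Fe))))
    split true Fe zero (suc β) total = rerouted Fe
      (sum-unfold rest zero β (ℕ.suc-injective (trans total (cong (λ b → bit b ℕ.+ k′ e) Fe))))
    split true Fe zero zero total with trans total (cong (λ b → bit b ℕ.+ k′ e) Fe)
    ... | ()

  pair : EdgeSet m
  pair = exchange true (λ _ → false)

  pair-even : EvenIn ends A pair
  pair-even = exchange-even true ((λ S → Xor.sum-zero (λ g → false ∧ crosses (ends g) S) λ _ → refl) , λ ())

  -- In the doubled point, `τ` counts circuits formed by the pair, `α` the sets that run through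
  -- `e`, and `β` those rerouted through `f`. The three equations have the unique solution
  -- `x + y - s`, `x + s - y`, `y + s - x`: integral thanks to the doubling, nonnegative by the
  -- triangle inequalities.
  split-counts : ∀ {x y s : ℤ} → Triangle (fromℤ x) (fromℤ y) (fromℤ s) →
                 ∃[ τ ] ∃[ α ] ∃[ β ] (ℤ.+ (τ ℕ.+ α) ≡ x ℤ.+ x × ℤ.+ (τ ℕ.+ β) ≡ y ℤ.+ y × ℤ.+ (α ℕ.+ β) ≡ s ℤ.+ s)
  split-counts {x} {y} {s} (p , q , r) = from-ℕ
    (nonneg⇒ℕ (slack-ℤ s x y r)) (nonneg⇒ℕ (slack-ℤ y x s q)) (nonneg⇒ℕ (slack-ℤ x y s p))
    where
    slack-ℤ : ∀ a b d → fromℤ a ≤ fromℤ b + fromℤ d → 0ℚ ≤ fromℤ (b ℤ.+ d ℤ.- a)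
    slack-ℤ a b d h = subst (0ℚ ≤_) (sym (trans (fromℤ-sub (b ℤ.+ d) a) (cong (_- fromℤ a) (fromℤ-+ b d)))) (slack h)
    from-ℕ : ∃[ τ ] ℤ.+ τ ≡ x ℤ.+ y ℤ.- s → ∃[ α ] ℤ.+ α ≡ x ℤ.+ s ℤ.- y → ∃[ β ] ℤ.+ β ≡ y ℤ.+ s ℤ.- x →
             ∃[ τ ] ∃[ α ] ∃[ β ] (ℤ.+ (τ ℕ.+ α) ≡ x ℤ.+ x × ℤ.+ (τ ℕ.+ β) ≡ y ℤ.+ y × ℤ.+ (α ℕ.+ β) ≡ s ℤ.+ s)
    from-ℕ (τ , τ≡) (α , α≡) (β , β≡) = τ , α , β
      , trans (cong₂ ℤ._+_ τ≡ α≡) (lemma₁ x y s)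
      , trans (cong₂ ℤ._+_ τ≡ β≡) (lemma₂ x y s)
      , trans (cong₂ ℤ._+_ α≡ β≡) (lemma₃ x y s)
      where
      lemma₁ : ∀ x y s → (x ℤ.+ y ℤ.- s) ℤ.+ (x ℤ.+ s ℤ.- y) ≡ x ℤ.+ x
      lemma₁ = ℤ-Solver.solve-∀
      lemma₂ : ∀ x y s → (x ℤ.+ y ℤ.- s) ℤ.+ (y ℤ.+ s ℤ.- x) ≡ y ℤ.+ y
      lemma₂ = ℤ-Solver.solve-∀
      lemma₃ : ∀ x y s → (x ℤ.+ s ℤ.- y) ℤ.+ (y ℤ.+ s ℤ.- x) ≡ s ℤ.+ s
      lemma₃ = ℤ-Solver.solve-∀

  roundable-parallel : Roundable ends (drop f A) → Roundable ends A
  roundable-parallel rec c c∈ ω = from-fold (cone-fold c∈)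
    where
    from-fold : ∃[ s ] (Cone (EvenIn ends (drop f A)) (set s 0ℚ c) × Triangle (c e) (c f) s) → Rounded ends A c ω
    from-fold (s , c̃∈ , T) = from-triangle (round-triangle (ω e) (ω f) T)
      where
      from-triangle : Rounding (c e) (c f) s (ω e) (ω f) → Rounded ends A c ω
      from-triangle R = from-rounded (rec c̃ c̃∈ ω̃)
        where
        open Rounding R using (X; Y; X-monotone; Y-monotone; X⊑; Y⊑; triangle) renaming (cost to XY-cost)
        c̃ ω̃ : Fin m → ℚ
        c̃ = set s 0ℚ c
        -- The rate at which the joint cost of the affine functions `X` and `Y` changes with `s`;
        -- `e` stands for the folded pair in the smaller problem.
        σ = ω e * fromℤ (proj₂ X) + ω f * fromℤ (proj₂ Y)
        ω̃ = set σ 0ℚ ω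
        from-rounded : Rounded ends (drop f A) c̃ ω̃ → Rounded ends A c ω
        from-rounded S = from-counts (split-counts {x} {y} {t} T-at-t)
          where
          open Rounded S renaming (z to z̃)
          t x y : ℤ
          t = z̃ e
          x = evalℤ X t
          y = evalℤ Y t
          t⊑s : fromℤ t ⊑ s
          t⊑s = subst (fromℤ t ⊑_) (set-e s 0ℚ c) (within e)
          T-at-t : Triangle (fromℤ x) (fromℤ y) (fromℤ t)
          T-at-t = subst₂ (λ x y → Triangle x y (fromℤ t)) (sym (fromℤ-eval X t)) (sym (fromℤ-eval Y t))
            (triangle (fromℤ t) t⊑s)
          z : Fin m → ℤ
          z = set x y z̃
          within′ : ∀ g → fromℤ (z g) ⊑ c g
          within′ = by-cases
            (subst (_⊑ c e) (sym (trans (cong fromℤ (set-e x y z̃)) (fromℤ-eval X t)))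
              (⊑-trans (X-monotone t⊑s) X⊑))
            (subst (_⊑ c f) (sym (trans (cong fromℤ (set-f x y z̃)) (fromℤ-eval Y t)))
              (⊑-trans (Y-monotone t⊑s) Y⊑))
            λ g e≢g f≢g → subst₂ (λ y a → fromℤ y ⊑ a) (sym (set-other x y z̃ e≢g f≢g))
              (set-other s 0ℚ c e≢g f≢g) (within g)
          costs-other : ∀ g → e ≢ g → f ≢ g → ω g * (c g - fromℤ (z g)) ≡ ω̃ g * (c̃ g - fromℤ (z̃ g))
          costs-other g e≢g f≢g = cong₂ _*_ (sym (set-other σ 0ℚ ω e≢g f≢g))
            (cong₂ (λ a y → a - fromℤ y) (sym (set-other s 0ℚ c e≢g f≢g)) (set-other x y z̃ e≢g f≢g))
          costs-ef : ω̃ e * (c̃ e - fromℤ (z̃ e)) + ω̃ f * (c̃ f - fromℤ (z̃ f)) ≤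
                     ω e * (c e - fromℤ (z e)) + ω f * (c f - fromℤ (z f))
          costs-ef = subst₂ _≤_
            (sym (cong₂ _+_ (cong₂ (λ w a → w * (a - fromℤ t)) (set-e σ 0ℚ ω) (set-e s 0ℚ c))
                            (trans (cong (_* (c̃ f - fromℤ (z̃ f))) (set-f σ 0ℚ ω)) (ℚ.*-zeroˡ (c̃ f - fromℤ (z̃ f))))))
            (sym (cong₂ (λ u v → ω e * (c e - u) + ω f * (c f - v))
              (trans (cong fromℤ (set-e x y z̃)) (fromℤ-eval X t))
              (trans (cong fromℤ (set-f x y z̃)) (fromℤ-eval Y t))))
            (≤-from (slack XY-cost)
              (lemma (ω e) (ω f) (c e) (c f) (fromℤ (proj₁ X)) (fromℤ (proj₂ X))
                     (fromℤ (proj₁ Y)) (fromℤ (proj₂ Y)) s (fromℤ t)))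
            where
            lemma : ∀ w w′ x y k δ l η s t →
              (w * x + w′ * y) - (w * (k + δ * s) + w′ * (l + η * s)) ≡
              (w * (x - (k + δ * t)) + w′ * (y - (l + η * t))) - ((w * δ + w′ * η) * (s - t) + 0ℚ)
            lemma = solve-∀ ℚ-ring
          from-counts : ∃[ τ ] ∃[ α ] ∃[ β ] (ℤ.+ (τ ℕ.+ α) ≡ x ℤ.+ x × ℤ.+ (τ ℕ.+ β) ≡ y ℤ.+ y ×
                                              ℤ.+ (α ℕ.+ β) ≡ t ℤ.+ t) → Rounded ends A c ω
          from-counts (τ , α , β , 2x , 2y , 2t) = record
            { z = z ; within = within′ ; cost = cost-transfer₂ e≢f costs-other costs-ef cost
            ; sum = SumOf-+ (SumOf-copies pair-even τ)
                            (sum-unfold sum α β (ℤ.+-injective (trans 2t (half e))))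
            ; half = by-cases
                (trans (cong₂ ℤ._+_ (set-e x y z̃) (set-e x y z̃)) (trans (sym 2x)
                  (cong ℤ.+_ (sym (cong₂ ℕ._+_ (copies-once (exchange-e true (λ _ → false))) (set-e α β k))))))
                (trans (cong₂ ℤ._+_ (set-f x y z̃) (set-f x y z̃)) (trans (sym 2y)
                  (cong ℤ.+_ (sym (cong₂ ℕ._+_ (copies-once (exchange-f true (λ _ → false))) (set-f α β k))))))
                λ g e≢g f≢g → trans (cong₂ ℤ._+_ (set-other x y z̃ e≢g f≢g) (set-other x y z̃ e≢g f≢g))
                  (trans (half g) (cong ℤ.+_ (sym (cong₂ ℕ._+_
                    (trans (cong (λ b → τ ℕ.* bit b) (exchange-other true (λ _ → false) e≢g f≢g)) (ℕ.*-zeroʳ τ))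
                    (set-other α β k e≢g f≢g))))) }
            where
            copies-once : ∀ {b} → b ≡ true → τ ℕ.* bit b ≡ τ
            copies-once refl = ℕ.*-identityʳ τ

-- Branch sets of K₄ minors

open All using ([]; _∷_)
open AllPairs using ([]; _∷_)
open Linked using (Linked; []; [-]; _∷_)

Within : ∀ {n} → (Fin n → Fin n → Set) → (Fin n → Maybe (Fin 4)) → Fin 4 → Fin n → Fin n → Set
Within R β i u v = R u v × β u ≡ just i × β v ≡ just i

-- A K₄ minor of the graph with adjacency relation R, given by its branch sets.
record Model {n} (R : Fin n → Fin n → Set) : Set where
  field
    β         : Fin n → Maybe (Fin 4)
    connected : ∀ {i u v} → β u ≡ just i → β v ≡ just i → Star (Within R β i) u v
    linked    : ∀ {i j} → i ≢ j → ∃[ u ] ∃[ v ] (β u ≡ just i × β v ≡ just j × R u v)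

-- Branch sets are pulled back along a partial map onto the smaller graph. Deletions, contractions
-- and isomorphisms are all of this form, with fibres whose points are equal or adjacent, so that
-- preimages of branch sets stay connected.
lift-model : ∀ {n n′} {R : Fin n → Fin n → Set} {R′ : Fin n′ → Fin n′ → Set} (φ : Fin n → Maybe (Fin n′)) →
             (∀ {p q} → R′ p q → ∃[ a ] ∃[ b ] (φ a ≡ just p × φ b ≡ just q × R a b)) →
             (∀ {p a b} → φ a ≡ just p → φ b ≡ just p → a ≡ b ⊎ R a b) →
             Model R′ → Model R
lift-model {R = R} {R′} φ edge fibre M = record { β = β ; connected = connected ; linked = linked }
  where
  module M = Model M
  β : _ → Maybe (Fin 4)
  β a = φ a >>= M.β
  from-just : ∀ {a p} → φ a ≡ just p → β a ≡ M.β p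
  from-just eq = cong (_>>= M.β) eq
  inside : ∀ {i p a b} → M.β p ≡ just i → φ a ≡ just p → φ b ≡ just p → Star (Within R β i) a b
  inside p∈i φa φb with fibre φa φb
  ... | inj₁ refl = ε
  ... | inj₂ r    = (r , trans (from-just φa) p∈i , trans (from-just φb) p∈i) ◅ ε
  path : ∀ {i p q a b} → Star (Within R′ M.β i) p q → M.β p ≡ just i → φ a ≡ just p → φ b ≡ just q →
         Star (Within R β i) a b
  path ε p∈i φa φb = inside p∈i φa φb
  path ((r , p∈i , q∈i) ◅ rs) _ φa φb with edge r
  ... | s , t , φs , φt , r′ = inside p∈i φa φs
    ◅◅ (r′ , trans (from-just φs) p∈i , trans (from-just φt) q∈i) ◅ path rs q∈i φt φb
  connected : ∀ {i u v} → β u ≡ just i → β v ≡ just i → Star (Within R β i) u v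
  connected {u = u} {v} u∈i v∈i with φ u in φu | φ v in φv
  ... | just p | just q = path (M.connected u∈i v∈i) u∈i φu φv
  linked : ∀ {i j} → i ≢ j → ∃[ u ] ∃[ v ] (β u ≡ just i × β v ≡ just j × R u v)
  linked i≢j with M.linked i≢j
  ... | p , q , p∈i , q∈j , r with edge r
  ... | a , b , φa , φb , r′ = a , b , trans (from-just φa) p∈i , trans (from-just φb) q∈j , r′

-- Paths as lists

Linked-++ˡ : ∀ {A : Set} {R : A → A → Set} xs {ys} → Linked R (xs ++ ys) → Linked R xs
Linked-++ˡ []           _       = []
Linked-++ˡ (x ∷ [])     _       = [-]
Linked-++ˡ (x ∷ y ∷ xs) (r ∷ l) = r ∷ Linked-++ˡ (y ∷ xs) l

Linked-++ʳ : ∀ {A : Set} {R : A → A → Set} xs {ys} → Linked R (xs ++ ys) → Linked R ys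
Linked-++ʳ []           l             = l
Linked-++ʳ (x ∷ [])     {[]}    l       = []
Linked-++ʳ (x ∷ [])     {_ ∷ _} (_ ∷ l) = l
Linked-++ʳ (x ∷ y ∷ xs) (_ ∷ l)       = Linked-++ʳ (y ∷ xs) l

-- The rotation of a path: the segment from `x` through `xs` is reversed, and its old first vertex
-- `x` is attached to `ys` by a chord.
Linked-ʳ++ : ∀ {A : Set} {R : A → A → Set} → (∀ {a b} → R a b → R b a) →
             ∀ {x} xs {ys} → Linked R (x ∷ xs) → Linked R (x ∷ ys) → Linked R (xs ʳ++ (x ∷ ys))
Linked-ʳ++ R-sym []       _       l′ = l′
Linked-ʳ++ R-sym (y ∷ xs) (r ∷ l) l′ = Linked-ʳ++ R-sym xs l (R-sym r ∷ l′)

Unique-++-disjoint : ∀ {A : Set} (xs : List A) {ys v} → Unique (xs ++ ys) → v ∈ₗ xs → v ∈ₗ ys → ⊥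
Unique-++-disjoint (x ∷ xs) (x∉ ∷ _) (here refl) v∈ys = All.lookup x∉ (∈-++⁺ʳ xs v∈ys) refl
Unique-++-disjoint (x ∷ xs) (_ ∷ u)  (there v∈)  v∈ys = Unique-++-disjoint xs u v∈ v∈ys

Unique-++ʳ : ∀ {A : Set} (xs : List A) {ys} → Unique (xs ++ ys) → Unique ys
Unique-++ʳ []       u       = u
Unique-++ʳ (x ∷ xs) (_ ∷ u) = Unique-++ʳ xs u

Unique-length : ∀ {n} {xs : List (Fin n)} → Unique xs → length xs ℕ.≤ n
Unique-length {xs = xs} u = injective⇒≤ (lookup-inj xs u)
  where
  lookup-inj : ∀ xs → Unique xs → ∀ {i j} → List.lookup xs i ≡ List.lookup xs j → i ≡ j
  lookup-inj (x ∷ xs) _         {zero}  {zero}  _  = refl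
  lookup-inj (x ∷ xs) (x∉ ∷ _)  {zero}  {suc j} eq = contradiction eq (All.lookup x∉ (∈-lookup j))
  lookup-inj (x ∷ xs) (x∉ ∷ _)  {suc i} {zero}  eq = contradiction (sym eq) (All.lookup x∉ (∈-lookup i))
  lookup-inj (x ∷ xs) (_ ∷ u)   {suc i} {suc j} eq = cong suc (lookup-inj xs u eq)

predecessor : ∀ {A : Set} {x t : A} {xs} → t ∈ₗ xs → ∃[ ys ] ∃[ r ] ∃[ zs ] x ∷ xs ≡ ys ++ r ∷ t ∷ zs
predecessor {x = x} {xs = _ ∷ zs} (here refl) = [] , x , zs , refl
predecessor {x = x} (there t∈) with predecessor t∈
... | ys , r , zs , eq = x ∷ ys , r , zs , cong (x ∷_) eq

last-satisfying : ∀ {A : Set} {P : A → Set} (P? : ∀ x → Dec (P x)) xs →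
                  (∃[ x ] (x ∈ₗ xs × P x)) →
                  ∃[ ys ] ∃[ z ] ∃[ zs ] (xs ≡ ys ++ z ∷ zs × P z × (∀ {x} → x ∈ₗ zs → ¬ P x))
last-satisfying {A} {P} P? (x ∷ xs) (w , w∈ , Pw) = later (search xs)
  where
  search : ∀ ys → (∃[ y ] (y ∈ₗ ys × P y)) ⊎ (∀ {y} → y ∈ₗ ys → ¬ P y)
  search []       = inj₂ λ ()
  search (y ∷ ys) with P? y | search ys
  ... | yes Py | _                   = inj₁ (y , here refl , Py)
  ... | no _   | inj₁ (v , v∈ , Pv) = inj₁ (v , there v∈ , Pv)
  ... | no ¬Py | inj₂ none           = inj₂ λ where
    (here refl) → ¬Py
    (there y∈)  → none y∈
  head-satisfies : ∀ {v} → v ∈ₗ x ∷ xs → P v → (∀ {y} → y ∈ₗ xs → ¬ P y) → P x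
  head-satisfies (here refl) Pv none = Pv
  head-satisfies (there v∈)  Pv none = contradiction Pv (none v∈)
  later : (∃[ y ] (y ∈ₗ xs × P y)) ⊎ (∀ {y} → y ∈ₗ xs → ¬ P y) →
          ∃[ ys ] ∃[ z ] ∃[ zs ] (x ∷ xs ≡ ys ++ z ∷ zs × P z × (∀ {x} → x ∈ₗ zs → ¬ P x))
  later (inj₁ found) with last-satisfying P? xs found
  ... | ys , z , zs , eq , Pz , none = x ∷ ys , z , zs , cong (x ∷_) eq , Pz , none
  later (inj₂ none) = [] , x , xs , refl , head-satisfies w∈ Pw none , none

module _ {n} {R : Fin n → Fin n → Set} (R-sym : ∀ {u v} → R u v → R v u) where

  open DecMembership (_≟_ {n}) using (_∈?_)

  paths⇒model : (bag : Fin 4 → List (Fin n)) →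
                (∀ {i j v} → v ∈ₗ bag i → v ∈ₗ bag j → i ≡ j) →
                (∀ i → Linked R (bag i)) →
                (∀ {i j} → i ≢ j → ∃[ u ] ∃[ v ] (u ∈ₗ bag i × v ∈ₗ bag j × R u v)) →
                Model R
  paths⇒model bag disjoint linked-bag link = record
    { β = β
    ; connected = λ {i} u∈i v∈i → connect (bag i) (linked-bag i) (λ x∈ → x∈) (∈-bag u∈i) (∈-bag v∈i)
    ; linked = λ i≢j → let (u , v , u∈ , v∈ , r) = link i≢j in u , v , bag-∈ u∈ , bag-∈ v∈ , r }
    where
    owner : ∀ {v} → Dec (∃[ i ] v ∈ₗ bag i) → Maybe (Fin 4)
    owner (yes (i , _)) = just i
    owner (no _)        = nothing
    β : Fin n → Maybe (Fin 4)
    β v = owner (any? λ i → v ∈? bag i)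
    ∈-bag : ∀ {v i} → β v ≡ just i → v ∈ₗ bag i
    ∈-bag {v} eq with any? (λ i → v ∈? bag i)
    ∈-bag refl | yes (i , v∈) = v∈
    ∈-bag ()   | no _
    bag-∈ : ∀ {v i} → v ∈ₗ bag i → β v ≡ just i
    bag-∈ {v} {i} v∈ with any? (λ i → v ∈? bag i)
    ... | yes (j , v∈j) = cong just (disjoint v∈j v∈)
    ... | no none       = contradiction (i , v∈) none
    from-head : ∀ {i x xs} → Linked R (x ∷ xs) → (∀ {y} → y ∈ₗ x ∷ xs → y ∈ₗ bag i) →
                ∀ {v} → v ∈ₗ x ∷ xs → Star (Within R β i) x v × Star (Within R β i) v x
    from-head _ _ (here refl) = ε , ε
    from-head (r ∷ l) sub (there v∈) with from-head l (sub ∘ there) v∈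
    ... | out , back = (r , bag-∈ (sub (here refl)) , bag-∈ (sub (there (here refl)))) ◅ out
      , back ◅◅ (R-sym r , bag-∈ (sub (there (here refl))) , bag-∈ (sub (here refl))) ◅ ε
    connect : ∀ {i} xs → Linked R xs → (∀ {y} → y ∈ₗ xs → y ∈ₗ bag i) →
              ∀ {u v} → u ∈ₗ xs → v ∈ₗ xs → Star (Within R β i) u v
    connect (x ∷ xs) l sub u∈ v∈ = proj₂ (from-head l sub u∈) ◅◅ proj₁ (from-head l sub v∈)

  -- The cycle v rs r t ws (closed by an edge from v into ws) with the crossing
  -- chords v t and r m.
  crossing-chords : ∀ {v rs r t ws z m} → Linked R (v ∷ rs ++ r ∷ t ∷ ws) → Unique (v ∷ rs ++ r ∷ t ∷ ws) →
                    R v t → z ∈ₗ ws → R v z → m ∈ₗ ws → R r m → Model R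
  crossing-chords {v} {rs} {r} {t} {w ∷ ws} {z} {m} l u vt z∈ vz m∈ rm =
    paths⇒model bag disjoint linked-bag (λ {i} {j} → link i j)
    where
    side : List (Fin n)
    side = rs ++ r ∷ []
    -- Removing the ends `v` and `t` of one chord leaves `side` and `w ∷ ws`, which the other chord
    -- `r m` joins. Path edges and `v z` provide the remaining adjacencies.
    bag : Fin 4 → List (Fin n)
    bag 0F = v ∷ []
    bag 1F = side
    bag 2F = t ∷ []
    bag 3F = w ∷ ws
    l-assoc : Linked R ((v ∷ side) ++ t ∷ w ∷ ws)
    l-assoc = subst (λ xs → Linked R (v ∷ xs)) (sym (++-assoc rs (r ∷ []) (t ∷ w ∷ ws))) l
    u-assoc : Unique ((v ∷ side) ++ t ∷ w ∷ ws)
    u-assoc = subst (λ xs → Unique (v ∷ xs)) (sym (++-assoc rs (r ∷ []) (t ∷ w ∷ ws))) u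
    l-tail : Linked R (r ∷ t ∷ w ∷ ws)
    l-tail = Linked-++ʳ (v ∷ rs) l
    linked-bag : ∀ i → Linked R (bag i)
    linked-bag 0F = [-]
    linked-bag 1F = Linked-++ʳ (v ∷ []) (Linked-++ˡ (v ∷ side) l-assoc)
    linked-bag 2F = [-]
    linked-bag 3F = Linked-++ʳ (r ∷ t ∷ []) l-tail
    apart : ∀ {i j x} → i Data.Fin.Base.< j → x ∈ₗ bag i → x ∈ₗ bag j → ⊥
    apart {0F} {1F} _ p q = Unique-++-disjoint (v ∷ []) u-assoc p (∈-++⁺ˡ q)
    apart {0F} {2F} _ p (here refl) = Unique-++-disjoint (v ∷ []) u-assoc p (∈-++⁺ʳ side (here refl))
    apart {0F} {3F} _ p q = Unique-++-disjoint (v ∷ []) u-assoc p (∈-++⁺ʳ side (there q))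
    apart {1F} {2F} _ p (here refl) = Unique-++-disjoint (v ∷ side) u-assoc (there p) (here refl)
    apart {1F} {3F} _ p q = Unique-++-disjoint (v ∷ side) u-assoc (there p) (there q)
    apart {2F} {3F} _ p q = Unique-++-disjoint (t ∷ []) (Unique-++ʳ (v ∷ side) u-assoc) p q
    apart {1F} {1F} (ℕ.s≤s ())
    apart {2F} {1F} (ℕ.s≤s ())
    apart {2F} {2F} (ℕ.s≤s (ℕ.s≤s ()))
    apart {3F} {1F} (ℕ.s≤s ())
    apart {3F} {2F} (ℕ.s≤s (ℕ.s≤s ()))
    apart {3F} {3F} (ℕ.s≤s (ℕ.s≤s (ℕ.s≤s ())))
    disjoint : ∀ {i j x} → x ∈ₗ bag i → x ∈ₗ bag j → i ≡ j
    disjoint {i} {j} p q with Data.Fin.Properties.<-cmp i j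
    ... | tri< i<j _ _ = contradiction q (apart i<j p)
    ... | tri≈ _ i≡j _ = i≡j
    ... | tri> _ _ j<i = contradiction p (apart j<i q)
    r∈ : r ∈ₗ side
    r∈ = ∈-++⁺ʳ rs (here refl)
    Link : Fin 4 → Fin 4 → Set
    Link i j = ∃[ u ] ∃[ v ] (u ∈ₗ bag i × v ∈ₗ bag j × R u v)
    flip : ∀ i j → Link i j → Link j i
    flip _ _ (u , v , u∈ , v∈ , r) = v , u , v∈ , u∈ , R-sym r
    link₀₁ : Link 0F 1F
    link₀₁ = first rs l-assoc
      where
      first : ∀ rs → Linked R ((v ∷ rs ++ r ∷ []) ++ t ∷ w ∷ ws) →
              ∃[ u ] ∃[ y ] (u ∈ₗ v ∷ [] × y ∈ₗ rs ++ r ∷ [] × R u y)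
      first []      (vr ∷ _) = v , r , here refl , here refl , vr
      first (y ∷ _) (vy ∷ _) = v , y , here refl , here refl , vy
    link₁₂ : Link 1F 2F
    link₁₂ with l-tail
    ... | rt ∷ _ = r , t , r∈ , here refl , rt
    link₂₃ : Link 2F 3F
    link₂₃ with l-tail
    ... | _ ∷ tw ∷ _ = t , w , here refl , here refl , tw
    link : ∀ i j → i ≢ j → Link i j
    link 0F 0F i≢i = contradiction refl i≢i
    link 0F 1F _   = link₀₁
    link 0F 2F _   = v , t , here refl , here refl , vt
    link 0F 3F _   = v , z , here refl , z∈ , vz
    link 1F 0F _   = flip 0F 1F link₀₁
    link 1F 1F i≢i = contradiction refl i≢i
    link 1F 2F _   = link₁₂
    link 1F 3F _   = r , m , r∈ , m∈ , rm
    link 2F 0F _   = t , v , here refl , here refl , R-sym vt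
    link 2F 1F _   = flip 1F 2F link₁₂
    link 2F 2F i≢i = contradiction refl i≢i
    link 2F 3F _   = link₂₃
    link 3F 0F _   = z , v , z∈ , here refl , R-sym vz
    link 3F 1F _   = m , r , m∈ , r∈ , R-sym rm
    link 3F 2F _   = flip 2F 3F link₂₃
    link 3F 3F i≢i = contradiction refl i≢i

  -- Dirac's theorem.  Among the paths that cannot be extended at their first
  -- vertex v, keep shortening the initial segment that contains all neighbours
  -- of v: if z is the last neighbour, t another one that is not next to v, and
  -- r the predecessor of t, then either r has a neighbour after t, giving
  -- crossing chords, or reversing the segment from v to r gives a path from r
  -- on which the last neighbour of r is t.
  module Dirac (R? : ∀ u v → Dec (R u v)) (R-irrefl : ∀ {v} → ¬ R v v)
               (third : ∀ {v t} → R v t → ∀ p q → ∃[ t ] (R v t × t ≢ p × t ≢ q)) where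

    extendable? : ∀ v path → Dec (∃[ t ] (R v t × ¬ t ∈ₗ path))
    extendable? v path = any? λ t → R? v t ×-dec ¬? (t ∈? path)

    trapped : ∀ {v t rest} → ¬ (∃[ t ] (R v t × ¬ t ∈ₗ v ∷ rest)) → R v t → t ∈ₗ rest
    trapped {v} {t} {rest} stuck vt with t ∈? v ∷ rest
    ... | yes (here refl) = contradiction vt R-irrefl
    ... | yes (there t∈)  = t∈
    ... | no t∉           = contradiction (t , vt , t∉) stuck

    cons-unique : ∀ {t : Fin n} {xs} → ¬ t ∈ₗ xs → Unique xs → Unique (t ∷ xs)
    cons-unique t∉ u = All.tabulate (λ { x∈ refl → t∉ x∈ }) ∷ u

    -- Termination is lexicographic in `k`, which bounds the number of further extensions, and in
    -- `ℓ`, which bounds the initial segment that is being shortened. An extension at `k` zero is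
    -- impossible: `v ∷ rest` would already have more than `n` distinct vertices.
    search : ∀ k v rest {t} → Linked R (v ∷ rest) → Unique (v ∷ rest) → n ℕ.≤ length rest ℕ.+ k →
             R v t → Model R

    shorten : ∀ k ℓ v xs z zs → length xs ℕ.≤ ℓ → Linked R (v ∷ xs ++ z ∷ zs) → Unique (v ∷ xs ++ z ∷ zs) →
              n ℕ.≤ length (xs ++ z ∷ zs) ℕ.+ k →
              R v z → (∀ {t} → R v t → t ∈ₗ xs ⊎ t ≡ z) → Model R

    search k v rest l u bound vt with extendable? v (v ∷ rest)
    search zero v rest l u bound vt | yes (t , vt′ , t∉) =
      contradiction (ℕ.≤-trans (Unique-length u) (subst (n ℕ.≤_) (ℕ.+-identityʳ (length rest)) bound))
        (ℕ.n≮n (length rest))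
    search (suc k) v rest l u bound vt | yes (t , vt′ , t∉) =
      search k t (v ∷ rest) (R-sym vt′ ∷ l) (cons-unique t∉ u)
        (subst (n ℕ.≤_) (ℕ.+-suc (length rest) k) bound) (R-sym vt′)
    search k v rest l u bound vt | no stuck with last-satisfying (R? v) rest (_ , trapped stuck vt , vt)
    ... | xs , z , zs , refl , vz , none =
      shorten k (length xs) v xs z zs ℕ.≤-refl l u bound vz λ vt′ → place vt′ (∈-++⁻ xs (trapped stuck vt′))
      where
      place : ∀ {t} → R v t → t ∈ₗ xs ⊎ t ∈ₗ z ∷ zs → t ∈ₗ xs ⊎ t ≡ z
      place vt′ (inj₁ t∈)          = inj₁ t∈
      place vt′ (inj₂ (here refl)) = inj₂ refl
      place vt′ (inj₂ (there t∈))  = contradiction vt′ (none t∈)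

    shorten k ℓ v [] z zs short l u bound vz nbrs with third vz z z
    ... | t , vt , t≢z , _ with nbrs vt
    ... | inj₂ t≡z = contradiction t≡z t≢z
    shorten k (suc ℓ) v (x ∷ xs) z zs short l u bound vz nbrs with third vz x z
    ... | t , vt , t≢x , t≢z with nbrs vt
    ... | inj₂ t≡z = contradiction t≡z t≢z
    ... | inj₁ (here t≡x) = contradiction t≡x t≢x
    ... | inj₁ (there t∈) with predecessor {x = x} t∈
    ... | rs , r , us , eq = rotate (extendable? r (r ∷ xs′ ++ t ∷ ws)) (any? λ m → (m ∈? ws) ×-dec R? r m)
      where
      ws xs′ : List (Fin n)
      ws  = us ++ z ∷ zs
      xs′ = reverse (v ∷ rs)
      shape : (x ∷ xs) ++ z ∷ zs ≡ rs ++ r ∷ t ∷ ws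
      shape = trans (cong (_++ z ∷ zs) eq) (++-assoc rs (r ∷ t ∷ us) (z ∷ zs))
      l₁ : Linked R (v ∷ rs ++ r ∷ t ∷ ws)
      l₁ = subst (λ p → Linked R (v ∷ p)) shape l
      u₁ : Unique (v ∷ rs ++ r ∷ t ∷ ws)
      u₁ = subst (λ p → Unique (v ∷ p)) shape u
      ws-tail : Linked R (t ∷ ws)
      ws-tail = Linked-++ʳ (v ∷ rs ++ r ∷ []) (subst (λ p → Linked R (v ∷ p))
        (sym (++-assoc rs (r ∷ []) (t ∷ ws))) l₁)
      rotated≡ : (rs ++ r ∷ []) ʳ++ (v ∷ t ∷ ws) ≡ r ∷ xs′ ++ t ∷ ws
      rotated≡ = trans (++-ʳ++ rs) (cong (r ∷_) (ʳ++-defn (v ∷ rs)))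
      l′ : Linked R (r ∷ xs′ ++ t ∷ ws)
      l′ = subst (Linked R) rotated≡ (Linked-ʳ++ R-sym (rs ++ r ∷ [])
        (Linked-++ˡ (v ∷ rs ++ r ∷ []) (subst (λ p → Linked R (v ∷ p)) (sym (++-assoc rs (r ∷ []) (t ∷ ws))) l₁))
        (vt ∷ ws-tail))
      permuted : v ∷ rs ++ r ∷ t ∷ ws ↭ r ∷ xs′ ++ t ∷ ws
      permuted = ↭-trans (shift r (v ∷ rs) (t ∷ ws))
        (prep r (++⁺ʳ (t ∷ ws) (↭-sym (↭-reverse (v ∷ rs)))))
      u′ : Unique (r ∷ xs′ ++ t ∷ ws)
      u′ = Unique-resp-↭ (setoid (Fin n)) (↭⇒↭ₛ permuted) u₁
      rt : R r t
      rt with Linked-++ʳ (v ∷ rs) l₁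
      ... | r ∷ _ = r
      lengths : length (xs′ ++ t ∷ ws) ≡ length ((x ∷ xs) ++ z ∷ zs)
      lengths = ℕ.suc-injective (sym (trans (cong (suc ∘ length) shape) (↭-length permuted)))
      bound′ : n ℕ.≤ length (xs′ ++ t ∷ ws) ℕ.+ k
      bound′ = subst (λ j → n ℕ.≤ j ℕ.+ k) (sym lengths) bound
      xs-length : length (x ∷ xs) ≡ length rs ℕ.+ suc (suc (length us))
      xs-length = trans (cong length eq) (length-++ rs)
      shorter : length xs′ ℕ.≤ ℓ
      shorter = ℕ.≤-trans (ℕ.≤-reflexive (length-reverse (v ∷ rs)))
        (ℕ.s≤s⁻¹ (ℕ.≤-trans (ℕ.≤-trans
          (ℕ.≤-reflexive (sym (trans (ℕ.+-comm (length rs) 2) refl)))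
          (ℕ.+-monoʳ-≤ (length rs) (ℕ.s≤s (ℕ.s≤s ℕ.z≤n))))
          (ℕ.≤-trans (ℕ.≤-reflexive (sym xs-length)) short)))
      extend : ∀ k → n ℕ.≤ length (xs′ ++ t ∷ ws) ℕ.+ k →
               (∃[ w ] (R r w × ¬ w ∈ₗ r ∷ xs′ ++ t ∷ ws)) → Model R
      extend zero bound _ = contradiction
        (ℕ.≤-trans (Unique-length u′) (subst (n ℕ.≤_) (ℕ.+-identityʳ (length (xs′ ++ t ∷ ws))) bound))
        (ℕ.n≮n (length (xs′ ++ t ∷ ws)))
      extend (suc k) bound (w , rw , w∉) = search k w (r ∷ xs′ ++ t ∷ ws) (R-sym rw ∷ l′) (cons-unique w∉ u′)
        (subst (n ℕ.≤_) (ℕ.+-suc (length (xs′ ++ t ∷ ws)) k) bound) (R-sym rw)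
      rotate : Dec (∃[ w ] (R r w × ¬ w ∈ₗ r ∷ xs′ ++ t ∷ ws)) → Dec (∃[ m ] (m ∈ₗ ws × R r m)) → Model R
      rotate (yes found) _ = extend k bound′ found
      rotate (no _) (yes (m , m∈ , rm)) = crossing-chords l₁ u₁ vt (∈-++⁺ʳ us (here refl)) vz m∈ rm
      rotate (no stuck) (no none) = shorten k ℓ r xs′ t ws shorter l′ u′ bound′ rt λ rw →
        place rw (∈-++⁻ xs′ (trapped stuck rw))
        where
        place : ∀ {w} → R r w → w ∈ₗ xs′ ⊎ w ∈ₗ t ∷ ws → w ∈ₗ xs′ ⊎ w ≡ t
        place rw (inj₁ w∈)          = inj₁ w∈
        place rw (inj₂ (here refl)) = inj₂ refl
        place rw (inj₂ (there w∈))  = contradiction (_ , w∈ , rw) none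

    dirac : ∀ {u v} → R u v → Model R
    dirac {u} uv = search n u [] [-] ([] ∷ []) ℕ.≤-refl uv

-- Box-integrality of the cycle cone of a graph without K₄ minor

Adj-sym : ∀ {n m} {ends : Ends n m} {A u v} → Adj ends A u v → Adj ends A v u
Adj-sym (e , Ae , j) = e , Ae , Sum.swap j

joins? : ∀ {n} (p : Fin n × Fin n) u v → Dec (Joins p u v)
joins? p u v = ≡-dec _≟_ _≟_ p (u , v) ⊎-dec ≡-dec _≟_ _≟_ p (v , u)

adj? : ∀ {n m} (ends : Ends n m) A u v → Dec (Adj ends A u v)
adj? ends A u v = any? λ e → (A e Bool.≟ true) ×-dec joins? (ends e) u v

drop-⊂ : ∀ {m} {A : EdgeSet m} {e} → A e ≡ true → tabulate (drop e A) ⊂ tabulate A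
drop-⊂ {A = A} {e} Ae = ⊆ₑ⇒⊂ {F = drop e A} {A} {e} (λ {g} → drop-⊆ e A {g}) Ae (drop-same e A)

joins-unique : ∀ {n} {p q : Fin n × Fin n} {u v} → Joins p u v → Joins q u v → Joins q (proj₁ p) (proj₂ p)
joins-unique (inj₁ refl) j = j
joins-unique (inj₂ refl) j = Sum.swap j

incident⇒joins : ∀ {n m} {ends : Ends n m} {e v} → Incident (graph ends) e v → ∃[ t ] Joins (ends e) t v
incident⇒joins {ends = ends} {e} (inj₁ refl) = proj₂ (ends e) , inj₂ refl
incident⇒joins {ends = ends} {e} (inj₂ refl) = proj₁ (ends e) , inj₁ refl

not-loop : ∀ {n} {p : Fin n × Fin n} {u v} → proj₁ p ≢ proj₂ p → Joins p u v → u ≢ v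
not-loop p≢ (inj₁ refl) u≡v = p≢ u≡v
not-loop p≢ (inj₂ refl) u≡v = p≢ (sym u≡v)

model-drop : ∀ {n m} {ends : Ends n m} {A e} → Model (Adj ends (drop e A)) → Model (Adj ends A)
model-drop {A = A} {e} = lift-model just
  (λ { {p} {q} (g , Ag , j) → p , q , refl , refl , g , drop-⊆ e A Ag , j })
  λ { refl refl → inj₁ refl }

model-contract : ∀ {n m} {ends : Ends n m} {A f t v} → A f ≡ true → Joins (ends f) t v →
                 Model (Adj (mapEnds (merge t v) ∘ ends) (drop f A)) → Model (Adj ends A)
model-contract {ends = ends} {A} {f} {t} {v} Af ends-f = lift-model (just ∘ merge t v) edge fibre
  where
  edge : ∀ {p q} → Adj (mapEnds (merge t v) ∘ ends) (drop f A) p q →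
         ∃[ a ] ∃[ b ] (just (merge t v a) ≡ just p × just (merge t v b) ≡ just q × Adj ends A a b)
  edge (g , Ag , inj₁ eq) = _ , _ , cong just (cong proj₁ eq) , cong just (cong proj₂ eq)
    , g , drop-⊆ f A Ag , inj₁ refl
  edge (g , Ag , inj₂ eq) = _ , _ , cong just (cong proj₂ eq) , cong just (cong proj₁ eq)
    , g , drop-⊆ f A Ag , inj₂ refl
  fibre : ∀ {p a b} → just (merge t v a) ≡ just p → just (merge t v b) ≡ just p → a ≡ b ⊎ Adj ends A a b
  fibre {a = a} {b} φa φb with merge-kernel t v {a} {b} (just-injective (trans φa (sym φb)))
  ... | inj₁ eq                    = inj₁ eq
  ... | inj₂ (inj₁ (refl , refl)) = inj₂ (f , Af , ends-f)
  ... | inj₂ (inj₂ (refl , refl)) = inj₂ (f , Af , Sum.swap ends-f)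

-- The induction is on the active set alone. Every reduction deactivates one edge, and branch sets
-- found in the reduced graph pull back, so their absence is inherited.
roundable : ∀ {n m} (ends : Ends n m) A → Acc _⊂_ (tabulate A) → ¬ Model (Adj ends A) → Roundable ends A
roundable {n} {m} ends A (acc rec) ¬model = check-loop (any? λ e → (A e Bool.≟ true) ×-dec (proj₁ (ends e) ≟ proj₂ (ends e)))
  where
  remove : ∀ {e} → A e ≡ true → Roundable ends (drop e A)
  remove {e} Ae = roundable ends (drop e A) (rec (drop-⊂ Ae)) (¬model ∘ model-drop)

  ParallelPair : Set
  ParallelPair = ∃[ e ] ∃[ f ] (e ≢ f × A e ≡ true × A f ≡ true × Joins (ends f) (proj₁ (ends e)) (proj₂ (ends e)))

  parallel? : Dec ParallelPair
  parallel? = any? λ e → any? λ f → ¬? (e ≟ f) ×-dec (A e Bool.≟ true) ×-dec (A f Bool.≟ true) ×-dec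
    joins? (ends f) (proj₁ (ends e)) (proj₂ (ends e))

  module Simple (loopless : ∀ {e} → A e ≡ true → proj₁ (ends e) ≢ proj₂ (ends e)) (no-parallel : ¬ ParallelPair) where

    same-edge : ∀ {e g t v} → A e ≡ true → A g ≡ true → Joins (ends e) t v → Joins (ends g) t v → e ≡ g
    same-edge {e} {g} Ae Ag je jg with e ≟ g
    ... | yes e≡g = e≡g
    ... | no e≢g  = contradiction (e , g , e≢g , Ae , Ag , joins-unique je jg) no-parallel

    -- Degree is measured by neighbours: if `Third v p q` fails, all neighbours of `v` are among `p`
    -- and `q`, and without loops and parallel edges `v` then has at most two edges.
    Third : Fin n → Fin n → Fin n → Set
    Third v p q = ∃[ t ] (Adj ends A v t × t ≢ p × t ≢ q)

    third? : ∀ v p q → Dec (Third v p q)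
    third? v p q = any? λ t → adj? ends A v t ×-dec ¬? (t ≟ p) ×-dec ¬? (t ≟ q)

    module SmallDegree {v p q e t} (small : ¬ Third v p q) (Ae : A e ≡ true) (ends-e : Joins (ends e) t v) where

      neighbour : ∀ {g x} → A g ≡ true → Joins (ends g) x v → x ≡ p ⊎ x ≡ q
      neighbour {g} {x} Ag j with x ≟ p | x ≟ q
      ... | yes x≡p | _       = inj₁ x≡p
      ... | no _    | yes x≡q = inj₂ x≡q
      ... | no x≢p  | no x≢q  = contradiction (x , (g , Ag , Sum.swap j) , x≢p , x≢q) small

      two-values : ∀ {x y z} → x ≡ p ⊎ x ≡ q → y ≡ p ⊎ y ≡ q → z ≡ p ⊎ z ≡ q → x ≢ y → z ≡ x ⊎ z ≡ y
      two-values (inj₁ refl) (inj₁ refl) _ x≢y           = contradiction refl x≢y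
      two-values (inj₂ refl) (inj₂ refl) _ x≢y           = contradiction refl x≢y
      two-values (inj₁ refl) (inj₂ refl) (inj₁ refl) _   = inj₁ refl
      two-values (inj₁ refl) (inj₂ refl) (inj₂ refl) _   = inj₂ refl
      two-values (inj₂ refl) (inj₁ refl) (inj₁ refl) _   = inj₂ refl
      two-values (inj₂ refl) (inj₁ refl) (inj₂ refl) _   = inj₁ refl

      t≢v : t ≢ v
      t≢v = not-loop (loopless Ae) ends-e

      Second : Set
      Second = ∃[ f ] (e ≢ f × A f ≡ true × Incident (graph ends) f v)

      second? : Dec Second
      second? = any? λ f → ¬? (e ≟ f) ×-dec (A f Bool.≟ true) ×-dec
        ((proj₁ (ends f) ≟ v) ⊎-dec (proj₂ (ends f) ≟ v))

      reduce : Dec Second → Roundable ends A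
      reduce (no ¬second) = roundable-bridge ends-e t≢v unique (remove Ae)
        where
        unique : ∀ {g} → A g ≡ true → Incident (graph ends) g v → e ≡ g
        unique {g} Ag inc with e ≟ g
        ... | yes e≡g = e≡g
        ... | no e≢g  = contradiction (g , e≢g , Ag , inc) ¬second
      reduce (yes (f , e≢f , Af , inc)) with incident⇒joins {ends = ends} inc
      ... | s , ends-f = Series.roundable-series {ends = ends} {A} e≢f Af ends-e t≢v ends-f s≢v unique
        (roundable _ (drop f A) (rec (drop-⊂ Af)) (¬model ∘ model-contract Af ends-f))
        where
        s≢v : s ≢ v
        s≢v = not-loop (loopless Af) ends-f
        t≢s : t ≢ s
        t≢s refl = e≢f (same-edge Ae Af ends-e ends-f)
        unique : ∀ {g} → A g ≡ true → Incident (graph ends) g v → e ≡ g ⊎ f ≡ g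
        unique {g} Ag inc with incident⇒joins {ends = ends} inc
        ... | x , ends-g with two-values (neighbour Ae ends-e) (neighbour Af ends-f) (neighbour Ag ends-g) t≢s
        ... | inj₁ refl = inj₁ (same-edge Ae Ag ends-e ends-g)
        ... | inj₂ refl = inj₂ (same-edge Af Ag ends-f ends-g)

    small? : Dec (∃[ v ] ∃[ p ] ∃[ q ] (¬ Third v p q × ∃[ t ] Adj ends A v t))
    small? = any? λ v → any? λ p → any? λ q → ¬? (third? v p q) ×-dec any? λ t → adj? ends A v t

    solve-simple : Dec (∃[ v ] ∃[ p ] ∃[ q ] (¬ Third v p q × ∃[ t ] Adj ends A v t)) →
                   Dec (∃[ e ] A e ≡ true) → Roundable ends A
    solve-simple (yes (v , p , q , small , t , e , Ae , j)) _ = SmallDegree.reduce small Ae (Sum.swap j)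
      (SmallDegree.second? small Ae (Sum.swap j))
    solve-simple (no _) (no empty) = roundable-empty λ e → Bool.¬-not λ Ae → empty (e , Ae)
    solve-simple (no large) (yes (e , Ae)) =
      contradiction (Dirac.dirac (Adj-sym {ends = ends} {A}) (adj? ends A) irrefl third (e , Ae , inj₁ refl)) ¬model
      where
      irrefl : ∀ {v} → ¬ Adj ends A v v
      irrefl (e , Ae , j) = not-loop (loopless Ae) j refl
      third : ∀ {v t} → Adj ends A v t → ∀ p q → Third v p q
      third {v} {t} vt p q with third? v p q
      ... | yes found = found
      ... | no small  = contradiction (v , p , q , small , t , vt) large

  check-parallel : (∀ {e} → A e ≡ true → proj₁ (ends e) ≢ proj₂ (ends e)) → Dec ParallelPair → Roundable ends A
  check-parallel _ (yes (e , f , e≢f , Ae , Af , par)) =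
    Parallel.roundable-parallel {ends = ends} {A} e≢f Ae Af par (remove Af)
  check-parallel loopless (no no-parallel) =
    solve-simple small? (any? λ e → A e Bool.≟ true)
    where open Simple loopless no-parallel

  check-loop : Dec (∃[ e ] (A e ≡ true × proj₁ (ends e) ≡ proj₂ (ends e))) → Roundable ends A
  check-loop (yes (e , Ae , loop)) = roundable-loop Ae loop (remove Ae)
  check-loop (no no-loop) = check-parallel (λ Ae loop → no-loop (_ , Ae , loop)) parallel?

-- Integral dual solutions

-- The rows of a system assembled by _++_, map and allFin, indexed by Fin k.
record Rows {A : Set} (L : List A) (k : ℕ) (row : Fin k → A) : Set where
  field
    from      : Fin k → Fin (List.length L)
    to        : Fin (List.length L) → Fin k
    to∘from   : ∀ i → to (from i) ≡ i
    lookup-from : ∀ i → List.lookup L (from i) ≡ row i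
    sum-from  : ∀ f → Rational.sum f ≡ Rational.sum (f ∘ from)

rows-map : ∀ {A B : Set} (g : A → B) L → Rows (List.map g L) (List.length L) (g ∘ List.lookup L)
rows-map g [] = record { from = λ (); to = λ (); to∘from = λ (); lookup-from = λ (); sum-from = λ _ → refl }
rows-map g (a ∷ L) = record
  { from        = λ { zero → zero ; (suc i) → suc (from i) }
  ; to          = λ { zero → zero ; (suc i) → suc (to i) }
  ; to∘from     = λ { zero → refl ; (suc i) → cong suc (to∘from i) }
  ; lookup-from = λ { zero → refl ; (suc i) → lookup-from i }
  ; sum-from    = λ f → cong (f zero +_) (sum-from (f ∘ suc)) }
  where open Rows (rows-map g L)

rows-tabulate : ∀ {A B : Set} (g : A → B) {k} (f : Fin k → A) → Rows (List.map g (List.tabulate f)) k (g ∘ f)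
rows-tabulate g {zero}  f =
  record { from = λ (); to = λ (); to∘from = λ (); lookup-from = λ (); sum-from = λ _ → refl }
rows-tabulate g {suc k} f = record
  { from        = λ { zero → zero ; (suc i) → suc (from i) }
  ; to          = λ { zero → zero ; (suc i) → suc (to i) }
  ; to∘from     = λ { zero → refl ; (suc i) → cong suc (to∘from i) }
  ; lookup-from = λ { zero → refl ; (suc i) → lookup-from i }
  ; sum-from    = λ f → cong (f zero +_) (sum-from (f ∘ suc)) }
  where open Rows (rows-tabulate g (f ∘ suc))

module _ {A : Set} where

  inl : ∀ L₁ {L₂ : List A} → Fin (List.length L₁) → Fin (List.length (L₁ List.++ L₂))
  inl (_ ∷ L₁) zero    = zero
  inl (_ ∷ L₁) (suc i) = suc (inl L₁ i)

  inr : ∀ L₁ {L₂ : List A} → Fin (List.length L₂) → Fin (List.length (L₁ List.++ L₂))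
  inr []       i = i
  inr (_ ∷ L₁) i = suc (inr L₁ i)

  side : ∀ L₁ {L₂ : List A} → Fin (List.length (L₁ List.++ L₂)) → Fin (List.length L₁) ⊎ Fin (List.length L₂)
  side []       i       = inj₂ i
  side (_ ∷ L₁) zero    = inj₁ zero
  side (_ ∷ L₁) (suc i) = Sum.map₁ suc (side L₁ i)

  side-inl : ∀ L₁ {L₂ : List A} i → side L₁ {L₂} (inl L₁ i) ≡ inj₁ i
  side-inl (_ ∷ L₁) zero    = refl
  side-inl (_ ∷ L₁) (suc i) = cong (Sum.map₁ suc) (side-inl L₁ i)

  side-inr : ∀ L₁ {L₂ : List A} i → side L₁ {L₂} (inr L₁ i) ≡ inj₂ i
  side-inr []       i = refl
  side-inr (_ ∷ L₁) i = cong (Sum.map₁ suc) (side-inr L₁ i)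

  lookup-inl : ∀ L₁ {L₂ : List A} i → List.lookup (L₁ List.++ L₂) (inl L₁ i) ≡ List.lookup L₁ i
  lookup-inl (_ ∷ L₁) zero    = refl
  lookup-inl (_ ∷ L₁) (suc i) = lookup-inl L₁ i

  lookup-inr : ∀ L₁ {L₂ : List A} i → List.lookup (L₁ List.++ L₂) (inr L₁ i) ≡ List.lookup L₂ i
  lookup-inr []       i = refl
  lookup-inr (_ ∷ L₁) i = lookup-inr L₁ i

  sum-++ : ∀ L₁ {L₂ : List A} (f : Fin (List.length (L₁ List.++ L₂)) → ℚ) →
           Rational.sum f ≡ Rational.sum (f ∘ inl L₁) + Rational.sum (f ∘ inr L₁)
  sum-++ []       f = sym (ℚ.+-identityˡ (Rational.sum f))
  sum-++ (_ ∷ L₁) f = trans (cong (f zero +_) (sum-++ L₁ (f ∘ suc)))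
    (sym (ℚ.+-assoc (f zero) (Rational.sum (f ∘ suc ∘ inl L₁)) (Rational.sum (f ∘ suc ∘ inr L₁))))

∈-subsets : ∀ {m} (C : Subset m) → C ∈ₗ subsets m
∈-subsets Vec.[] = here refl
∈-subsets {suc m} (false Vec.∷ C) = ∈-++⁺ˡ (∈-map⁺ (false Vec.∷_) (∈-subsets C))
∈-subsets {suc m} (true  Vec.∷ C) =
  ∈-++⁺ʳ (List.map (false Vec.∷_) (subsets m)) (∈-map⁺ (true Vec.∷_) (∈-subsets C))

-- The dual of the system with box constraints

module BoxedSystem (G : Graph) (ℓ u : Fin (Graph.#E G) → ℚ) where

  open Graph G renaming (#E to m; #V to n)

  N : ℕ
  N = List.length (circuits G)

  circuitSet : Fin N → EdgeSet m
  circuitSet j = lookup (List.lookup (circuits G) j)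

  S : System m
  S = halfCircuitSystem G List.++ box ℓ u

  circuit-row : Fin N → Row m
  circuit-row j = (λ e → ½ * χ (List.lookup (circuits G) j) e) ≥ᵣ 0ℚ

  lower-row upper-row : Fin m → Row m
  lower-row e = unit e ≥ᵣ ℓ e
  upper-row e = unit e ≤ᵣ u e

  private
    module C = Rows (rows-map (λ C → (λ e → ½ * χ C e) ≥ᵣ 0ℚ) (circuits G))
    module L = Rows (rows-tabulate lower-row (λ e → e))
    module U = Rows (rows-tabulate upper-row (λ e → e))
    lowers uppers : System m
    lowers = List.map lower-row (List.allFin m)
    uppers = List.map upper-row (List.allFin m)

  iC : Fin N → Fin (List.length S)
  iC j = inl (halfCircuitSystem G) (C.from j)

  iL iU : Fin m → Fin (List.length S)
  iL e = inr (halfCircuitSystem G) (inl lowers (L.from e))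
  iU e = inr (halfCircuitSystem G) (inr lowers (U.from e))

  S-iC : ∀ j → List.lookup S (iC j) ≡ circuit-row j
  S-iC j = trans (lookup-inl (halfCircuitSystem G) (C.from j)) (C.lookup-from j)

  S-iL : ∀ e → List.lookup S (iL e) ≡ lower-row e
  S-iL e = trans (lookup-inr (halfCircuitSystem G) (inl lowers (L.from e)))
    (trans (lookup-inl lowers (L.from e)) (L.lookup-from e))

  S-iU : ∀ e → List.lookup S (iU e) ≡ upper-row e
  S-iU e = trans (lookup-inr (halfCircuitSystem G) (inr lowers (U.from e)))
    (trans (lookup-inr lowers (U.from e)) (U.lookup-from e))

  sum-S : ∀ f → Rational.sum {List.length S} f ≡
          Rational.sum (f ∘ iC) + (Rational.sum (f ∘ iL) + Rational.sum (f ∘ iU))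
  sum-S f = trans (sum-++ (halfCircuitSystem G) f) (cong₂ _+_
    (C.sum-from (f ∘ inl (halfCircuitSystem G)))
    (trans (sum-++ lowers (f ∘ inr (halfCircuitSystem G))) (cong₂ _+_
      (L.sum-from (f ∘ inr (halfCircuitSystem G) ∘ inl lowers))
      (U.sum-from (f ∘ inr (halfCircuitSystem G) ∘ inr lowers)))))

  module _ {K : Set} (a : Fin N → K) (q p : Fin m → K) where

    from-box : Fin (List.length lowers) ⊎ Fin (List.length uppers) → K
    from-box (inj₁ i) = q (L.to i)
    from-box (inj₂ i) = p (U.to i)

    from-side : Fin (List.length (halfCircuitSystem G)) ⊎ Fin (List.length (box ℓ u)) → K
    from-side (inj₁ i) = a (C.to i)
    from-side (inj₂ i) = from-box (side lowers i)

    assemble : Fin (List.length S) → K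
    assemble i = from-side (side (halfCircuitSystem G) i)

    assemble-C : ∀ j → assemble (iC j) ≡ a j
    assemble-C j = trans (cong from-side (side-inl (halfCircuitSystem G) (C.from j))) (cong a (C.to∘from j))

    assemble-L : ∀ e → assemble (iL e) ≡ q e
    assemble-L e = trans (cong from-side (side-inr (halfCircuitSystem G) (inl lowers (L.from e))))
      (trans (cong from-box (side-inl lowers (L.from e))) (cong q (L.to∘from e)))

    assemble-U : ∀ e → assemble (iU e) ≡ p e
    assemble-U e = trans (cong from-side (side-inr (halfCircuitSystem G) (inr lowers (U.from e))))
      (trans (cong from-box (side-inr lowers (U.from e))) (cong p (U.to∘from e)))

    assemble-all : (P : K → Set) → (∀ j → P (a j)) → (∀ e → P (q e)) → (∀ e → P (p e)) → ∀ i → P (assemble i)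
    assemble-all P Pa Pq Pp i = all-sides (side (halfCircuitSystem G) i)
      where
      all-box : ∀ s → P (from-box s)
      all-box (inj₁ i) = Pq (L.to i)
      all-box (inj₂ i) = Pp (U.to i)
      all-sides : ∀ s → P (from-side s)
      all-sides (inj₁ i) = Pa (C.to i)
      all-sides (inj₂ i) = all-box (side lowers i)

  -- The point `c` of the circuit cone that the multipliers of the circuit rows describe, with the
  -- coefficient 1/2 of these rows.
  flow : (Fin N → ℚ) → Fin m → ℚ
  flow a e = Rational.sum λ j → (½ * 𝟙 (circuitSet j e)) * a j

  sum-unit-column : ∀ (e : Fin m) (p : Fin m → ℚ) → Rational.sum (λ g → unit g e * p g) ≡ p e
  sum-unit-column e p = trans (Rational.sum-single e (λ g → unit g e * p g)
      λ g e≢g → trans (cong (λ b → 𝟙 b * p g) (does-≟-≢ (e≢g ∘ sym))) (ℚ.*-zeroˡ (p g)))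
    (trans (cong (λ b → 𝟙 b * p e) (does-≟-refl e)) (ℚ.*-identityˡ (p e)))

  sum-unit-row : ∀ (e : Fin m) (x : Fin m → ℚ) → unit e · x ≡ x e
  sum-unit-row e x = trans (Rational.sum-single e (λ g → unit e g * x g)
      λ g e≢g → trans (cong (λ b → 𝟙 b * x g) (does-≟-≢ e≢g)) (ℚ.*-zeroˡ (x g)))
    (trans (cong (λ b → 𝟙 b * x e) (does-≟-refl e)) (ℚ.*-identityˡ (x e)))

  sum-neg : ∀ {k} (f : Fin k → ℚ) → Rational.sum (λ i → - f i) ≡ - Rational.sum f
  sum-neg {zero}  f = refl
  sum-neg {suc k} f = trans (cong (- f zero +_) (sum-neg (f ∘ suc)))
    (sym (ℚ.neg-distrib-+ (f zero) (Rational.sum (f ∘ suc))))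

  neg-sum-* : ∀ {k} (f g : Fin k → ℚ) → Rational.sum (λ i → (- f i) * g i) ≡ - Rational.sum (λ i → f i * g i)
  neg-sum-* f g = trans (Rational.sum-cong-≗ λ i → sym (ℚ.neg-distribˡ-* (f i) (g i))) (sum-neg (λ i → f i * g i))

  -- With `c` the flow, and `p` and `q` the multipliers of the upper and lower bounds, the dual
  -- equations thus say `p - q = w + c`.
  column : ∀ e y → Rational.sum (λ i → matrix S i e * y i) ≡ - flow (y ∘ iC) e + (- y (iL e) + y (iU e))
  column e y = trans (sum-S (λ i → matrix S i e * y i)) (cong₂ _+_
    (trans (Rational.sum-cong-≗ λ j → cong (λ r → proj₁ r e * y (iC j)) (S-iC j))
      (neg-sum-* (λ j → ½ * 𝟙 (circuitSet j e)) (y ∘ iC)))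
    (cong₂ _+_
      (trans (Rational.sum-cong-≗ λ g → cong (λ r → proj₁ r e * y (iL g)) (S-iL g))
        (trans (neg-sum-* (λ g → unit g e) (y ∘ iL)) (cong -_ (sum-unit-column e (y ∘ iL)))))
      (trans (Rational.sum-cong-≗ λ g → cong (λ r → proj₁ r e * y (iU g)) (S-iU g))
        (sum-unit-column e (y ∘ iU)))))

  value : ∀ y → rhs S · y ≡ Rational.sum (λ e → u e * y (iU e) - ℓ e * y (iL e))
  value y = trans (sum-S (λ i → rhs S i * y i)) (trans (cong₂ _+_
    (trans (Rational.sum-cong-≗ λ j → cong (λ r → proj₂ r * y (iC j)) (S-iC j))
      (Rational.sum-zero (λ j → 0ℚ * y (iC j)) λ j → ℚ.*-zeroˡ (y (iC j))))
    (trans (cong₂ _+_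
      (Rational.sum-cong-≗ λ g → cong (λ r → proj₂ r * y (iL g)) (S-iL g))
      (Rational.sum-cong-≗ λ g → cong (λ r → proj₂ r * y (iU g)) (S-iU g)))
      (trans (sym (Rational.∑-distrib-+ (λ g → (- ℓ g) * y (iL g)) (λ g → u g * y (iU g))))
        (Rational.sum-cong-≗ λ g → lemma (ℓ g) (u g) (y (iL g)) (y (iU g))))))
    (ℚ.+-identityˡ _))
    where
    lemma : ∀ l u q p → (- l) * q + u * p ≡ u * p - l * q
    lemma = solve-∀ ℚ-ring

  circuitSet-circuit : ∀ j → IsCircuit ends (circuitSet j)
  circuitSet-circuit j = Circuit⇒circuit ends
    (proj₂ (∈-filter⁻ (circuit? G) {xs = subsets m} (∈-lookup {xs = circuits G} j)))

  circuit-index : ∀ {F} → IsCircuit ends F → ∃[ j ] (∀ e → circuitSet j e ≡ F e)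
  circuit-index {F} circ = Any.index C∈ , λ e →
    trans (cong (λ C → lookup C e) (sym (lookup-index C∈))) (lookup∘tabulate F e)
    where
    C∈ : tabulate F ∈ₗ circuits G
    C∈ = ∈-filter⁺ (circuit? G) (∈-subsets (tabulate F)) (circuit⇒Circuit ends circ)

  Cone-flow : ∀ a → (∀ j → 0ℚ ≤ a j) → Cone (Even ends) (flow a)
  Cone-flow a 0≤a = go circuitSet (λ j → circuit⇒even ends (circuitSet-circuit j)) a 0≤a
    where
    go : ∀ {k} (F : Fin k → EdgeSet m) → (∀ j → Even ends (F j)) → (a : Fin k → ℚ) → (∀ j → 0ℚ ≤ a j) →
         Cone (Even ends) (λ e → Rational.sum λ j → (½ * 𝟙 (F j e)) * a j)
    go {zero}  F even a 0≤a = apex λ _ → refl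
    go {suc k} F even a 0≤a = ray (ℚ.nonNegative⁻¹ ½ ⊗ 0≤a zero) (even zero)
      (go (F ∘ suc) (λ j → even (suc j)) (a ∘ suc) (0≤a ∘ suc))
      λ e → cong (_+ Rational.sum (λ j → (½ * 𝟙 (F (suc j) e)) * a (suc j))) (lemma ½ (𝟙 (F zero e)) (a zero))
      where
      lemma : ∀ h b a → (h * b) * a ≡ (h * a) * b
      lemma = solve-∀ ℚ-ring

  multiplicities : ∀ {k} → SumOf (IsCircuit ends) k →
                   ∃[ b ] (∀ e → Rational.sum (λ j → 𝟙 (circuitSet j e) * fromℤ (ℤ.+ b j)) ≡ fromℤ (ℤ.+ k e))
  multiplicities {k} (sum-none k≗0) = (λ _ → 0) , λ e → trans
    (Rational.sum-zero (λ j → 𝟙 (circuitSet j e) * 0ℚ) λ j → ℚ.*-zeroʳ (𝟙 (circuitSet j e)))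
    (cong (λ k → fromℤ (ℤ.+ k)) (sym (k≗0 e)))
  multiplicities {k} (sum-more {F} {k′} circ rest eq) = extend (circuit-index circ) (multiplicities rest)
    where
    extend : (∃[ j ] (∀ e → circuitSet j e ≡ F e)) →
             ∃[ b ] (∀ e → Rational.sum (λ j → 𝟙 (circuitSet j e) * fromℤ (ℤ.+ b j)) ≡ fromℤ (ℤ.+ k′ e)) →
             ∃[ b ] (∀ e → Rational.sum (λ j → 𝟙 (circuitSet j e) * fromℤ (ℤ.+ b j)) ≡ fromℤ (ℤ.+ k e))
    extend (i , C≗F) (b , b-sum) = b′ , λ e → trans (Rational.sum-cong-≗ λ j → distrib e j)
      (trans (Rational.∑-distrib-+ (λ j → 𝟙 (circuitSet j e) * fromℤ (ℤ.+ bit (single i j)))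
                                   (λ j → 𝟙 (circuitSet j e) * fromℤ (ℤ.+ b j)))
        (trans (cong₂ _+_ (new e) (b-sum e))
          (trans (sym (fromℤ-+ (ℤ.+ bit (F e)) (ℤ.+ k′ e))) (cong (λ k → fromℤ (ℤ.+ k)) (sym (eq e))))))
      where
      b′ : Fin N → ℕ
      b′ j = bit (single i j) ℕ.+ b j
      distrib : ∀ e j → 𝟙 (circuitSet j e) * fromℤ (ℤ.+ b′ j) ≡
                𝟙 (circuitSet j e) * fromℤ (ℤ.+ bit (single i j)) + 𝟙 (circuitSet j e) * fromℤ (ℤ.+ b j)
      distrib e j = trans (cong (𝟙 (circuitSet j e) *_) (fromℤ-+ (ℤ.+ bit (single i j)) (ℤ.+ b j)))
        (ℚ.*-distribˡ-+ (𝟙 (circuitSet j e)) (fromℤ (ℤ.+ bit (single i j))) (fromℤ (ℤ.+ b j)))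
      𝟙-bit : ∀ c → 𝟙 c * 1ℚ ≡ fromℤ (ℤ.+ bit c)
      𝟙-bit false = refl
      𝟙-bit true  = refl
      new : ∀ e → Rational.sum (λ j → 𝟙 (circuitSet j e) * fromℤ (ℤ.+ bit (single i j))) ≡ fromℤ (ℤ.+ bit (F e))
      new e = trans (Rational.sum-single i (λ j → 𝟙 (circuitSet j e) * fromℤ (ℤ.+ bit (single i j)))
          λ j i≢j → trans (cong (λ c → 𝟙 (circuitSet j e) * fromℤ (ℤ.+ bit c)) (does-≟-≢ i≢j)) (ℚ.*-zeroʳ (𝟙 (circuitSet j e))))
        (trans (cong₂ (λ c d → 𝟙 c * fromℤ (ℤ.+ bit d)) (C≗F e) (does-≟-refl i)) (𝟙-bit (F e)))

sum-mono : ∀ {k} {f g : Fin k → ℚ} → (∀ i → f i ≤ g i) → Rational.sum f ≤ Rational.sum g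
sum-mono {zero}  f≤g = ℚ.≤-refl
sum-mono {suc k} f≤g = ℚ.+-mono-≤ (f≤g zero) (sum-mono (λ i → f≤g (suc i)))

sum-scale : ∀ {k} r (f : Fin k → ℚ) → Rational.sum (λ i → r * f i) ≡ r * Rational.sum f
sum-scale {zero}  r f = sym (ℚ.*-zeroʳ r)
sum-scale {suc k} r f = trans (cong (r * f zero +_) (sum-scale r (f ∘ suc)))
  (sym (ℚ.*-distribˡ-+ r (f zero) (Rational.sum (f ∘ suc))))

full : ∀ {m} → EdgeSet m
full _ = true

module IntegralDual (G : Graph) (¬model : ¬ Model (Adj (Graph.ends G) full)) (ℓ u : Fin (Graph.#E G) → ℚ)
                    (w : Fin (Graph.#E G) → ℤ)
                    (x : Fin (Graph.#E G) → ℚ)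
                    (x-feasible : PrimalFeasible (BoxedSystem.S G ℓ u) x)
                    (y : Fin (List.length (BoxedSystem.S G ℓ u)) → ℚ)
                    (y-feasible : DualFeasible (BoxedSystem.S G ℓ u) (fromℤ ∘ w) y) where

  open Graph G renaming (#E to m; #V to n)
  open BoxedSystem G ℓ u

  x-row : ∀ i {r} → List.lookup S i ≡ r → proj₁ r · x ≤ proj₂ r
  x-row i refl = x-feasible i

  -- The feasible point lies between the bounds. This inequality is what makes the edge costs
  -- convex.
  ℓ≤u : ∀ e → ℓ e ≤ u e
  ℓ≤u e = ℚ.≤-trans
    (neg-cancel (subst (_≤ - ℓ e) (trans (neg-sum-* (unit e) x) (cong -_ (sum-unit-row e x))) (x-row (iL e) (S-iL e))))
    (subst (_≤ u e) (sum-unit-row e x) (x-row (iU e) (S-iU e)))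
    where
    neg-cancel : ∀ {a b} → - a ≤ - b → b ≤ a
    neg-cancel {a} {b} h = ≤-from (slack h) (lemma a b)
      where
      lemma : ∀ a b → (- b) - (- a) ≡ a - b
      lemma = solve-∀ ℚ-ring

  W c p q : Fin m → ℚ
  W e = fromℤ (w e)
  c = flow (y ∘ iC)
  p = y ∘ iU
  q = y ∘ iL

  p-q : ∀ e → p e - q e ≡ W e + c e
  p-q e = trans (lemma (p e) (q e) (c e)) (cong (_+ c e) (trans (sym (column e y)) (proj₁ y-feasible e)))
    where
    lemma : ∀ p q c → p - q ≡ (- c + (- q + p)) + c
    lemma = solve-∀ ℚ-ring

  Sign : Fin m → Set
  Sign e = 0ℚ ≤ W e + c e ⊎ W e + c e ≤ 0ℚ

  sign : ∀ e → Sign e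
  sign e = ℚ.≤-total 0ℚ (W e + c e)

  slope : ∀ {e} → Sign e → ℚ
  slope {e} (inj₁ _) = u e
  slope {e} (inj₂ _) = ℓ e

  -- The cost of edge e in the dual is the convex function
  -- c e ↦ u e (w e + c e)⁺ - ℓ e (w e + c e)⁻, which has slope ω e around c e.
  ω : Fin m → ℚ
  ω e = slope (sign e)

  -- Only `p - q` is prescribed, and raising both by 1 costs `u - ℓ`, which is nonnegative; so it is
  -- cheapest to have one of them zero.
  cost-bound : ∀ e (s : Sign e) → slope s * (W e + c e) ≤ u e * p e - ℓ e * q e
  cost-bound e (inj₁ _) = subst (λ d → u e * d ≤ u e * p e - ℓ e * q e) (p-q e)
    (≤-from (slack (ℓ≤u e) ⊗ proj₂ y-feasible (iL e)) (lemma (u e) (ℓ e) (p e) (q e)))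
    where
    lemma : ∀ u l p q → (u - l) * q ≡ u * p - l * q - u * (p - q)
    lemma = solve-∀ ℚ-ring
  cost-bound e (inj₂ _) = subst (λ d → ℓ e * d ≤ u e * p e - ℓ e * q e) (p-q e)
    (≤-from (slack (ℓ≤u e) ⊗ proj₂ y-feasible (iU e)) (lemma (u e) (ℓ e) (p e) (q e)))
    where
    lemma : ∀ u l p q → (u - l) * p ≡ u * p - l * q - l * (p - q)
    lemma = solve-∀ ℚ-ring

  rounded : Rounded ends full c ω
  rounded = roundable ends full (⊂-wellFounded _) ¬model c
    (Cone-map (λ F-even → F-even , λ _ → refl) (Cone-flow (y ∘ iC) (proj₂ y-feasible ∘ iC))) ω

  open Rounded rounded

  Z : Fin m → ℚ
  Z e = fromℤ (z e)

  -- The positive and negative parts of `w + z`, selected by the sign of `w + c` before rounding, so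
  -- that the new cost has the same slope `ω`.
  p′ q′ : ∀ {e} → Sign e → ℤ
  p′ {e} (inj₁ _) = w e ℤ.+ z e
  p′ {e} (inj₂ _) = ℤ.+ 0
  q′ {e} (inj₁ _) = ℤ.+ 0
  q′ {e} (inj₂ _) = ℤ.- (w e ℤ.+ z e)

  -- The breakpoint `- w e` is an integer, so rounding `c e` does not carry it to the other side.
  0≤p′ : ∀ e (s : Sign e) → 0ℚ ≤ fromℤ (p′ s)
  0≤p′ e (inj₁ 0≤W+c) = subst (0ℚ ≤_) (sym (fromℤ-+ (w e) (z e)))
    (≤-from (slack -W≤Z) (trans (cong (λ a → Z e - a) (fromℤ-neg (w e))) (lemma (W e) (Z e))))
    where
    lemma : ∀ w z → z - (- w) ≡ w + z - 0ℚ
    lemma = solve-∀ ℚ-ring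
    lemma′ : ∀ w c → w + c - 0ℚ ≡ c - (- w)
    lemma′ = solve-∀ ℚ-ring
    -W≤Z : fromℤ (ℤ.- w e) ≤ Z e
    -W≤Z = lower (within e) (ℤ.- w e) (subst (_≤ c e) (sym (fromℤ-neg (w e)))
      (≤-from (slack 0≤W+c) (lemma′ (W e) (c e))))
  0≤p′ e (inj₂ _) = ℚ.≤-refl

  0≤q′ : ∀ e (s : Sign e) → 0ℚ ≤ fromℤ (q′ s)
  0≤q′ e (inj₁ _) = ℚ.≤-refl
  0≤q′ e (inj₂ W+c≤0) = subst (0ℚ ≤_) (sym (trans (fromℤ-neg (w e ℤ.+ z e)) (cong -_ (fromℤ-+ (w e) (z e)))))
    (≤-from (slack Z≤-W) (trans (cong (_- Z e) (fromℤ-neg (w e))) (lemma (W e) (Z e))))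
    where
    lemma : ∀ w z → - w - z ≡ - (w + z) - 0ℚ
    lemma = solve-∀ ℚ-ring
    lemma′ : ∀ w c → 0ℚ - (w + c) ≡ - w - c
    lemma′ = solve-∀ ℚ-ring
    Z≤-W : Z e ≤ fromℤ (ℤ.- w e)
    Z≤-W = upper (within e) (ℤ.- w e) (subst (c e ≤_) (sym (fromℤ-neg (w e)))
      (≤-from (slack W+c≤0) (lemma′ (W e) (c e))))

  p′-q′ : ∀ e (s : Sign e) → fromℤ (p′ s) - fromℤ (q′ s) ≡ W e + Z e
  p′-q′ e (inj₁ _) = trans (lemma (fromℤ (w e ℤ.+ z e))) (fromℤ-+ (w e) (z e))
    where
    lemma : ∀ a → a - 0ℚ ≡ a
    lemma = solve-∀ ℚ-ring
  p′-q′ e (inj₂ _) = trans (cong (λ a → 0ℚ - a) (fromℤ-neg (w e ℤ.+ z e)))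
    (trans (lemma (fromℤ (w e ℤ.+ z e))) (fromℤ-+ (w e) (z e)))
    where
    lemma : ∀ a → 0ℚ - (- a) ≡ a
    lemma = solve-∀ ℚ-ring

  cost′ : ∀ e (s : Sign e) → u e * fromℤ (p′ s) - ℓ e * fromℤ (q′ s) ≡ slope s * (W e + Z e)
  cost′ e s@(inj₁ _) = trans (lemma (u e) (ℓ e) (fromℤ (p′ s))) (cong (u e *_) (p′-q′ e s))
    where
    lemma : ∀ u l a → u * a - l * 0ℚ ≡ u * (a - 0ℚ)
    lemma = solve-∀ ℚ-ring
  cost′ e s@(inj₂ _) = trans (lemma (u e) (ℓ e) (fromℤ (q′ s))) (cong (ℓ e *_) (p′-q′ e s))
    where
    lemma : ∀ u l a → u * 0ℚ - l * a ≡ l * (0ℚ - a)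
    lemma = solve-∀ ℚ-ring

  counts : ∃[ b ] (∀ e → Rational.sum (λ j → 𝟙 (circuitSet j e) * fromℤ (ℤ.+ b j)) ≡ fromℤ (ℤ.+ k e))
  counts = multiplicities (SumOf-bind (even⇒circuits ∘ proj₁) sum)

  b : Fin N → ℕ
  b = proj₁ counts

  y′ : Fin (List.length S) → ℤ
  y′ = assemble (λ j → ℤ.+ b j) (λ e → q′ (sign e)) (λ e → p′ (sign e))

  y′-C : ∀ j → fromℤ (y′ (iC j)) ≡ fromℤ (ℤ.+ b j)
  y′-C j = cong fromℤ (assemble-C (λ j → ℤ.+ b j) (λ e → q′ (sign e)) (λ e → p′ (sign e)) j)

  y′-L : ∀ e → fromℤ (y′ (iL e)) ≡ fromℤ (q′ (sign e))
  y′-L e = cong fromℤ (assemble-L (λ j → ℤ.+ b j) (λ e → q′ (sign e)) (λ e → p′ (sign e)) e)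

  y′-U : ∀ e → fromℤ (y′ (iU e)) ≡ fromℤ (p′ (sign e))
  y′-U e = cong fromℤ (assemble-U (λ j → ℤ.+ b j) (λ e → q′ (sign e)) (λ e → p′ (sign e)) e)

  flow′ : ∀ e → flow (fromℤ ∘ y′ ∘ iC) e ≡ Z e
  flow′ e = begin
    Rational.sum (λ j → (½ * 𝟙 (circuitSet j e)) * fromℤ (y′ (iC j)))
      ≡⟨ Rational.sum-cong-≗ (λ j → trans (cong ((½ * 𝟙 (circuitSet j e)) *_) (y′-C j))
                                           (ℚ.*-assoc ½ (𝟙 (circuitSet j e)) (fromℤ (ℤ.+ b j)))) ⟩
    Rational.sum (λ j → ½ * (𝟙 (circuitSet j e) * fromℤ (ℤ.+ b j)))
      ≡⟨ sum-scale ½ (λ j → 𝟙 (circuitSet j e) * fromℤ (ℤ.+ b j)) ⟩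
    ½ * Rational.sum (λ j → 𝟙 (circuitSet j e) * fromℤ (ℤ.+ b j))
      ≡⟨ cong (½ *_) (trans (proj₂ counts e) (trans (cong fromℤ (sym (half e))) (fromℤ-+ (z e) (z e)))) ⟩
    ½ * (Z e + Z e)
      ≡⟨ lemma (Z e) ⟩
    Z e ∎
    where
    open ≡-Reasoning
    lemma : ∀ z → ½ * (z + z) ≡ z
    lemma = solve-∀ ℚ-ring

  y′-feasible : DualFeasible S (fromℤ ∘ w) (fromℤ ∘ y′)
  y′-feasible =
      (λ e → trans (column e (fromℤ ∘ y′)) (trans
        (cong₂ (λ a d → - a + d) (flow′ e) (cong₂ (λ q p → - q + p) (y′-L e) (y′-U e)))
        (trans (lemma (Z e) (fromℤ (p′ (sign e))) (fromℤ (q′ (sign e))))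
          (trans (cong (_- Z e) (p′-q′ e (sign e))) (cancel (W e) (Z e))))))
    , assemble-all (λ j → ℤ.+ b j) (λ e → q′ (sign e)) (λ e → p′ (sign e)) (λ a → 0ℚ ≤ fromℤ a)
        (λ j → fromℤ-mono-≤ {ℤ.+ 0} {ℤ.+ b j} (ℤ.+≤+ ℕ.z≤n)) (λ e → 0≤q′ e (sign e)) (λ e → 0≤p′ e (sign e))
    where
    lemma : ∀ z p q → - z + (- q + p) ≡ p - q - z
    lemma = solve-∀ ℚ-ring
    cancel : ∀ w z → w + z - z ≡ w
    cancel = solve-∀ ℚ-ring

  y′-cheaper : rhs S · (fromℤ ∘ y′) ≤ rhs S · y
  y′-cheaper = begin
    rhs S · (fromℤ ∘ y′)
      ≡⟨ value (fromℤ ∘ y′) ⟩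
    Rational.sum (λ e → u e * fromℤ (y′ (iU e)) - ℓ e * fromℤ (y′ (iL e)))
      ≡⟨ Rational.sum-cong-≗ (λ e → trans
           (cong₂ (λ p q → u e * p - ℓ e * q) (y′-U e) (y′-L e)) (cost′ e (sign e))) ⟩
    Rational.sum (λ e → ω e * (W e + Z e))
      ≤⟨ ≤-from cost (sym (trans (cong (_- Rational.sum (λ e → ω e * (W e + Z e))) split)
           (cancel (Rational.sum λ e → ω e * (W e + Z e)) (Rational.sum λ e → ω e * (c e - Z e))))) ⟩
    Rational.sum (λ e → ω e * (W e + c e))
      ≤⟨ sum-mono (λ e → cost-bound e (sign e)) ⟩
    Rational.sum (λ e → u e * p e - ℓ e * q e)
      ≡⟨ value y ⟨
    rhs S · y ∎
    where
    open ℚ.≤-Reasoning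
    lemma : ∀ o w c z → o * (w + c) ≡ o * (w + z) + o * (c - z)
    lemma = solve-∀ ℚ-ring
    cancel : ∀ a b → a + b - a ≡ b
    cancel = solve-∀ ℚ-ring
    split : Rational.sum (λ e → ω e * (W e + c e)) ≡
            Rational.sum (λ e → ω e * (W e + Z e)) + Rational.sum (λ e → ω e * (c e - Z e))
    split = trans (Rational.sum-cong-≗ λ e → lemma (ω e) (W e) (c e) (Z e))
      (Rational.∑-distrib-+ (λ e → ω e * (W e + Z e)) (λ e → ω e * (c e - Z e)))

no-model⇒box-TDI : ∀ G → ¬ Model (Adj (Graph.ends G) full) → BoxTDI (halfCircuitSystem G)
no-model⇒box-TDI G ¬model ℓ u w v ((x , x-feasible , _) , _) ((y , y-feasible , y-value) , minimal) =
  y′ , y′-feasible , ℚ.≤-antisym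
    (ℚ.≤-trans y′-cheaper (ℚ.≤-reflexive y-value))
    (minimal _ (fromℤ ∘ y′ , y′-feasible , refl))
  where open IntegralDual G ¬model ℓ u w x x-feasible y y-feasible

-- Minors and branch sets

record Embedding (H G : Graph) : Set where
  private
    module H = Graph H
    module G = Graph G
  field
    ι      : Fin H.#V → Fin G.#V
    ι-inj  : ∀ {a b} → ι a ≡ ι b → a ≡ b
    η      : Fin H.#E → Fin G.#E
    η-inj  : ∀ {a b} → η a ≡ η b → a ≡ b
    compat : ∀ k → Joins (G.ends (η k)) (ι (proj₁ (H.ends k))) (ι (proj₂ (H.ends k)))

minor-step : ∀ {G G′ H} → G ⟶ G′ → HasMinor G′ H → HasMinor G H
minor-step s (G″ , rest , iso) = G″ , s ◅ rest , iso

module _ {H : Graph} where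

  private module H = Graph H

  bijective⇒≅ : ∀ {n m} {ends : Ends n m} (E : Embedding H (graph ends)) →
                (∀ v → ∃[ a ] Embedding.ι E a ≡ v) → (∀ e → ∃[ k ] Embedding.η E k ≡ e) → graph ends ≅ H
  bijective⇒≅ {ends = ends} E ι-surj η-surj = record
    { vertices = mk↔ₛ′ (proj₁ ∘ ι-surj) ι (λ a → ι-inj (proj₂ (ι-surj (ι a)))) (proj₂ ∘ ι-surj)
    ; edges    = mk↔ₛ′ (proj₁ ∘ η-surj) η (λ k → η-inj (proj₂ (η-surj (η k)))) (proj₂ ∘ η-surj)
    ; ends-≅   = λ e → pull-back (proj₁ (η-surj e)) (subst
        (λ e → Joins (ends e) _ _) (proj₂ (η-surj e)) (compat (proj₁ (η-surj e)))) }
    where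
    open Embedding E
    to-ι : ∀ {v a} → v ≡ ι a → a ≡ proj₁ (ι-surj v)
    to-ι {v} v≡ = ι-inj (sym (trans (proj₂ (ι-surj v)) v≡))
    pull-back : ∀ {s t} k → Joins (s , t) (ι (proj₁ (H.ends k))) (ι (proj₂ (H.ends k))) →
                Joins (H.ends k) (proj₁ (ι-surj s)) (proj₁ (ι-surj t))
    pull-back k (inj₁ eq) = inj₁ (cong₂ _,_ (to-ι (cong proj₁ eq)) (to-ι (cong proj₂ eq)))
    pull-back k (inj₂ eq) = inj₂ (cong₂ _,_ (to-ι (cong proj₂ eq)) (to-ι (cong proj₁ eq)))

  -- Every edge is in the image of `η`, so a vertex missed by `ι` is isolated and may be deleted.
  -- This is why surplus edges are removed before surplus vertices.
  spanning-edges⇒minor : ∀ {n m} {ends : Ends n m} (E : Embedding H (graph ends)) →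
                         (∀ e → ∃[ k ] Embedding.η E k ≡ e) → HasMinor (graph ends) H
  spanning-edges⇒minor {n} {ends = ends} E η-surj with any? (λ v → all? λ a → ¬? (Embedding.ι E a ≟ v))
  ... | no covered = _ , ε , bijective⇒≅ E ι-surj η-surj
    where
    ι-surj : ∀ v → ∃[ a ] Embedding.ι E a ≡ v
    ι-surj v with any? (λ a → Embedding.ι E a ≟ v)
    ... | yes found = found
    ... | no none   = contradiction (v , λ a eq → none (a , eq)) covered
  spanning-edges⇒minor {suc n} {m} {ends} E η-surj | yes (v , missed) =
    minor-step (delete-vertex v λ e → sym (cong₂ _,_ (punchIn-punchOut (v≢₁ e)) (punchIn-punchOut (v≢₂ e))))
      (spanning-edges⇒minor E′ η-surj)
    where
    open Embedding E
    v≢ι : ∀ a → v ≢ ι a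
    v≢ι a = missed a ∘ sym
    v≢ends : ∀ e → v ≢ proj₁ (ends e) × v ≢ proj₂ (ends e)
    v≢ends e with η-surj e
    ... | k , refl with compat k
    ...   | inj₁ eq = (λ v≡ → v≢ι _ (trans v≡ (cong proj₁ eq))) , (λ v≡ → v≢ι _ (trans v≡ (cong proj₂ eq)))
    ...   | inj₂ eq = (λ v≡ → v≢ι _ (trans v≡ (cong proj₁ eq))) , (λ v≡ → v≢ι _ (trans v≡ (cong proj₂ eq)))
    v≢₁ : ∀ e → v ≢ proj₁ (ends e)
    v≢₁ e = proj₁ (v≢ends e)
    v≢₂ : ∀ e → v ≢ proj₂ (ends e)
    v≢₂ e = proj₂ (v≢ends e)
    ends′ : Ends n m
    ends′ e = punchOut (v≢₁ e) , punchOut (v≢₂ e)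
    E′ : Embedding H (graph ends′)
    E′ = record
      { ι      = λ a → punchOut (v≢ι a)
      ; ι-inj  = λ {a} {b} eq → ι-inj (punchOut-injective (v≢ι a) (v≢ι b) eq)
      ; η      = η
      ; η-inj  = η-inj
      ; compat = λ k → joins′ k (compat k) }
      where
      joins′ : ∀ k → Joins (ends (η k)) (ι (proj₁ (H.ends k))) (ι (proj₂ (H.ends k))) →
               Joins (ends′ (η k)) (punchOut (v≢ι (proj₁ (H.ends k)))) (punchOut (v≢ι (proj₂ (H.ends k))))
      joins′ k (inj₁ eq) = inj₁ (cong₂ _,_ (punchOut-cong v (cong proj₁ eq)) (punchOut-cong v (cong proj₂ eq)))
      joins′ k (inj₂ eq) = inj₂ (cong₂ _,_ (punchOut-cong v (cong proj₁ eq)) (punchOut-cong v (cong proj₂ eq)))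

  embedding⇒minor : ∀ {n m} {ends : Ends n m} → Embedding H (graph ends) → HasMinor (graph ends) H
  embedding⇒minor {m = m} E with any? (λ e → all? λ k → ¬? (Embedding.η E k ≟ e))
  ... | no covered = spanning-edges⇒minor E η-surj
    where
    η-surj : ∀ e → ∃[ k ] Embedding.η E k ≡ e
    η-surj e with any? (λ k → Embedding.η E k ≟ e)
    ... | yes found = found
    ... | no none   = contradiction (e , λ k eq → none (k , eq)) covered
  embedding⇒minor {n} {suc m} {ends} E | yes (e , missed) =
    minor-step (delete-edge e) (embedding⇒minor E′)
    where
    open Embedding E
    e≢η : ∀ k → e ≢ η k
    e≢η k = missed k ∘ sym
    E′ : Embedding H (graph (ends ∘ punchIn e))
    E′ = record
      { ι      = ι
      ; ι-inj  = ι-inj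
      ; η      = λ k → punchOut (e≢η k)
      ; η-inj  = λ {a} {b} eq → η-inj (punchOut-injective (e≢η a) (e≢η b) eq)
      ; compat = λ k → subst (λ g → Joins (ends g) _ _) (sym (punchIn-punchOut (e≢η k))) (compat k) }

-- The counterpart of `lift-model`: branch sets pass to a quotient as soon as `β` is constant on its
-- fibres, which holds when the contracted edge lies inside a branch set.
push-model : ∀ {n n′} {R : Fin n → Fin n → Set} {R′ : Fin n′ → Fin n′ → Set} (φ : Fin n → Fin n′)
             (section : Fin n′ → Fin n) → (∀ p → φ (section p) ≡ p) →
             (M : Model R) → (∀ a → Model.β M (section (φ a)) ≡ Model.β M a) →
             (∀ {a b} → R a b → φ a ≡ φ b ⊎ R′ (φ a) (φ b)) → Model R′
push-model {R = R} {R′} φ section φ-section M β-φ edge = record { β = β′ ; connected = connected′ ; linked = linked′ }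
  where
  open Model M
  β′ : _ → Maybe (Fin 4)
  β′ p = β (section p)
  in-bag : ∀ {a i} → β a ≡ just i → β′ (φ a) ≡ just i
  in-bag {a} eq = trans (β-φ a) eq
  path : ∀ {i a b} → Star (Within R β i) a b → Star (Within R′ β′ i) (φ a) (φ b)
  path ε = ε
  path {i} {b = b} ((r , a∈ , c∈) ◅ rest) with edge r
  ... | inj₁ eq = subst (λ p → Star (Within R′ β′ i) p (φ b)) (sym eq) (path rest)
  ... | inj₂ r′ = (r′ , in-bag a∈ , in-bag c∈) ◅ path rest
  connected′ : ∀ {i p q} → β′ p ≡ just i → β′ q ≡ just i → Star (Within R′ β′ i) p q
  connected′ {i} {p} {q} p∈ q∈ = subst₂ (Star (Within R′ β′ i)) (φ-section p) (φ-section q) (path (connected p∈ q∈))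
  linked′ : ∀ {i j} → i ≢ j → ∃[ p ] ∃[ q ] (β′ p ≡ just i × β′ q ≡ just j × R′ p q)
  linked′ i≢j with linked i≢j
  ... | a , b , a∈ , b∈ , r with edge r
  ...   | inj₁ eq = contradiction (just-injective (trans (sym (in-bag a∈)) (trans (cong β′ eq) (in-bag b∈)))) i≢j
  ...   | inj₂ r′ = φ a , φ b , in-bag a∈ , in-bag b∈ , r′

-- The quotient map identifying u and v, which removes v.
module Quotient {n} {u v : Fin (suc n)} (v≢u : v ≢ u) where

  φ : Fin (suc n) → Fin n
  φ w with v ≟ w
  ... | yes _  = punchOut v≢u
  ... | no v≢w = punchOut v≢w

  φ-punchIn : ∀ p → φ (punchIn v p) ≡ p
  φ-punchIn p with v ≟ punchIn v p
  ... | yes v≡ = contradiction (sym v≡) (punchInᵢ≢i v p)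
  ... | no v≢  = trans (punchOut-cong v refl) (punchOut-punchIn v)

  punchIn-φ : ∀ w → punchIn v (φ w) ≡ w ⊎ (w ≡ v × punchIn v (φ w) ≡ u)
  punchIn-φ w with v ≟ w
  ... | yes v≡w = inj₂ (sym v≡w , punchIn-punchOut v≢u)
  ... | no v≢w  = inj₁ (punchIn-punchOut v≢w)

  φ-v : φ v ≡ punchOut v≢u
  φ-v with v ≟ v
  ... | yes _  = refl
  ... | no v≢v = contradiction refl v≢v

  φ-u : φ u ≡ punchOut v≢u
  φ-u with v ≟ u
  ... | yes _ = refl
  ... | no _  = punchOut-cong v refl

  kernel : ∀ a b → φ a ≡ φ b → a ≡ b ⊎ Joins (u , v) a b
  kernel a b eq with punchIn-φ a | punchIn-φ b
  ... | inj₁ p | inj₁ q = inj₁ (trans (sym p) (trans (cong (punchIn v) eq) q))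
  ... | inj₂ (refl , p) | inj₂ (refl , q) = inj₁ refl
  ... | inj₁ p | inj₂ (refl , q) = inj₂ (inj₁ (cong (_, v) (sym (trans (sym p) (trans (cong (punchIn v) eq) q)))))
  ... | inj₂ (refl , p) | inj₁ q = inj₂ (inj₂ (cong (_, v) (sym (trans (sym q) (trans (cong (punchIn v) (sym eq)) p)))))

K₄-ends : Ends 4 6
K₄-ends = Graph.ends K₄

K₄-simple : ∀ k → proj₁ (K₄-ends k) ≢ proj₂ (K₄-ends k)
K₄-simple = from-yes (all? λ k → ¬? (proj₁ (K₄-ends k) ≟ proj₂ (K₄-ends k)))

K₄-edge-unique : ∀ k l → Joins (K₄-ends l) (proj₁ (K₄-ends k)) (proj₂ (K₄-ends k)) → k ≡ l
K₄-edge-unique = from-yes (all? λ k → all? λ l →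
  joins? (K₄-ends l) (proj₁ (K₄-ends k)) (proj₂ (K₄-ends k)) →-dec (k ≟ l))

K₄-complete : ∀ i j → i ≢ j → Adj K₄-ends full i j
K₄-complete = from-yes (all? λ i → all? λ j → ¬? (i ≟ j) →-dec adj? K₄-ends full i j)

singletons⇒embedding : ∀ {n m} {ends : Ends n m} (M : Model (Adj ends full)) →
                       (∀ {i u v} → Model.β M u ≡ just i → Model.β M v ≡ just i → u ≡ v) →
                       Embedding K₄ (graph ends)
singletons⇒embedding {ends = ends} M singleton = record
  { ι = ι ; ι-inj = λ {a} {b} eq → just-injective (trans (sym (ι∈ a)) (trans (cong β eq) (ι∈ b)))
  ; η = η ; η-inj = η-inj ; compat = compat }
  where
  open Model M
  -- That a branch set is nonempty follows only from `linked`; a vertex of it is read off from its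
  -- link to some other branch set.
  other : Fin 4 → Fin 4
  other 0F      = 1F
  other (suc _) = 0F
  ≢other : ∀ i → i ≢ other i
  ≢other 0F      ()
  ≢other (suc _) ()
  ι : Fin 4 → _
  ι i = proj₁ (linked (≢other i))
  ι∈ : ∀ i → β (ι i) ≡ just i
  ι∈ i = proj₁ (proj₂ (proj₂ (linked (≢other i))))
  edge : ∀ k → Adj ends full (ι (proj₁ (K₄-ends k))) (ι (proj₂ (K₄-ends k)))
  edge k with linked (K₄-simple k)
  ... | a , b , a∈ , b∈ , r = subst₂ (Adj ends full) (singleton a∈ (ι∈ _)) (singleton b∈ (ι∈ _)) r
  η : Fin 6 → _
  η k = proj₁ (edge k)
  compat : ∀ k → Joins (ends (η k)) (ι (proj₁ (K₄-ends k))) (ι (proj₂ (K₄-ends k)))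
  compat k = proj₂ (proj₂ (edge k))
  ι-inj : ∀ {a b} → ι a ≡ ι b → a ≡ b
  ι-inj {a} {b} eq = just-injective (trans (sym (ι∈ a)) (trans (cong β eq) (ι∈ b)))
  reflect : ∀ {p a b c d} → Joins p (ι a) (ι b) → Joins p (ι c) (ι d) → Joins (c , d) a b
  reflect (inj₁ refl) (inj₁ eq) = inj₁ (cong₂ _,_ (ι-inj (sym (cong proj₁ eq))) (ι-inj (sym (cong proj₂ eq))))
  reflect (inj₁ refl) (inj₂ eq) = inj₂ (cong₂ _,_ (ι-inj (sym (cong proj₂ eq))) (ι-inj (sym (cong proj₁ eq))))
  reflect (inj₂ refl) (inj₁ eq) = inj₂ (cong₂ _,_ (ι-inj (sym (cong proj₁ eq))) (ι-inj (sym (cong proj₂ eq))))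
  reflect (inj₂ refl) (inj₂ eq) = inj₁ (cong₂ _,_ (ι-inj (sym (cong proj₂ eq))) (ι-inj (sym (cong proj₁ eq))))
  η-inj : ∀ {k l} → η k ≡ η l → k ≡ l
  η-inj {k} {l} eq = K₄-edge-unique k l
    (reflect (subst (λ e → Joins (ends e) (ι (proj₁ (K₄-ends k))) (ι (proj₂ (K₄-ends k)))) eq (compat k)) (compat l))

-- While some edge has both ends in one branch set it is contracted, or deleted if it is a loop.
-- When none is left, a path inside a branch set has no edges, so branch sets are single vertices
-- and the links form a copy of K₄.
model⇒K₄ : ∀ {n m} (ends : Ends n m) → Model (Adj ends full) → HasMinor (graph ends) K₄

contract-edge-in-bag : ∀ {n m} (ends : Ends n m) (M : Model (Adj ends full)) →
  (∃[ e ] ∃[ i ] (Model.β M (proj₁ (ends e)) ≡ just i × Model.β M (proj₂ (ends e)) ≡ just i)) →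
  HasMinor (graph ends) K₄

model⇒K₄ {n} {m} ends M = contract (any? λ e → any? λ i → in-bag? e i)
  where
  open Model M
  InBag : Fin m → Fin 4 → Set
  InBag e i = β (proj₁ (ends e)) ≡ just i × β (proj₂ (ends e)) ≡ just i
  in-bag? : ∀ e i → Dec (InBag e i)
  in-bag? e i = ≡-decᴹ _≟_ (β (proj₁ (ends e))) (just i) ×-dec ≡-decᴹ _≟_ (β (proj₂ (ends e))) (just i)
  contract : Dec (∃[ e ] ∃[ i ] InBag e i) → HasMinor (graph ends) K₄
  contract (no none) = embedding⇒minor (singletons⇒embedding M singleton)
    where
    singleton : ∀ {i u v} → β u ≡ just i → β v ≡ just i → u ≡ v
    singleton u∈ v∈ with connected u∈ v∈
    ... | ε = refl
    ... | ((e , _ , inj₁ refl) , a∈ , b∈) ◅ _ = contradiction (e , _ , a∈ , b∈) none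
    ... | ((e , _ , inj₂ refl) , a∈ , b∈) ◅ _ = contradiction (e , _ , b∈ , a∈) none
  contract (yes found) = contract-edge-in-bag ends M found

contract-edge-in-bag {zero} ends M (e , _) with proj₁ (ends e)
... | ()
contract-edge-in-bag {suc n} {suc m} ends M (e , i , u∈ , v∈) = contract (v ≟ u)
  where
  open Model M
  u v : Fin (suc n)
  u = proj₁ (ends e)
  v = proj₂ (ends e)
  contract : Dec (v ≡ u) → HasMinor (graph ends) K₄
  contract (yes v≡u) = minor-step (delete-edge e) (model⇒K₄ (ends ∘ punchIn e)
    (push-model (λ w → w) (λ w → w) (λ _ → refl) M (λ _ → refl) edge))
    where
    edge : ∀ {a b} → Adj ends full a b → a ≡ b ⊎ Adj (ends ∘ punchIn e) full a b
    edge (g , _ , j) with e ≟ g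
    edge (g , _ , inj₁ refl) | yes refl = inj₁ (sym v≡u)
    edge (g , _ , inj₂ refl) | yes refl = inj₁ v≡u
    ... | no e≢g = inj₂ (punchOut e≢g , refl , subst (λ g → Joins (ends g) _ _) (sym (punchIn-punchOut e≢g)) j)
  contract (no v≢u) = minor-step
    (contract-edge e φ (λ p → punchIn v p , λ { refl → φ-punchIn p }) λ a b → mk⇔ (kernel a b) (identified a b))
    (model⇒K₄ (mapEnds φ ∘ ends ∘ punchIn e) (push-model φ (punchIn v) φ-punchIn M β-φ edge))
    where
    open Quotient v≢u
    identified : ∀ a b → a ≡ b ⊎ Joins (u , v) a b → φ a ≡ φ b
    identified a b (inj₁ refl)        = refl
    identified a b (inj₂ (inj₁ refl)) = trans φ-u (sym φ-v)
    identified a b (inj₂ (inj₂ refl)) = trans φ-v (sym φ-u)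
    β-φ : ∀ a → β (punchIn v (φ a)) ≡ β a
    β-φ a with punchIn-φ a
    ... | inj₁ eq          = cong β eq
    ... | inj₂ (a≡v , eq) = trans (cong β eq) (trans u∈ (sym (trans (cong β a≡v) v∈)))
    edge : ∀ {a b} → Adj ends full a b → φ a ≡ φ b ⊎ Adj (mapEnds φ ∘ ends ∘ punchIn e) full (φ a) (φ b)
    edge (g , _ , j) with e ≟ g
    ... | yes refl = inj₁ (identified _ _ (inj₂ j))
    ... | no e≢g   = inj₂ (punchOut e≢g , refl , subst (λ g → Joins (mapEnds φ (ends g)) _ _)
      (sym (punchIn-punchOut e≢g)) (Sum.map (cong (mapEnds φ)) (cong (mapEnds φ)) j))

-- The vertex map of each step is total except at a deleted vertex, and its fibres are single
-- vertices or the ends of the contracted edge.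
pull-model : ∀ {G H} → G ⟶ H → Model (Adj (Graph.ends H) full) → Model (Adj (Graph.ends G) full)
pull-model (delete-edge e) = lift-model just
  (λ { {p} {q} (g , _ , j) → p , q , refl , refl , punchIn e g , refl , j })
  λ { refl refl → inj₁ refl }
pull-model (contract-edge {ends = ends} e φ surj kernel) = lift-model (just ∘ φ)
  (λ { (g , _ , inj₁ refl) → _ , _ , refl , refl , punchIn e g , refl , inj₁ refl
     ; (g , _ , inj₂ refl) → _ , _ , refl , refl , punchIn e g , refl , inj₂ refl })
  λ {_} {a} {b} φa φb → Sum.map₂ (λ j → e , refl , j)
    (Equivalence.to (kernel a b) (just-injective (trans φa (sym φb))))
pull-model (delete-vertex {n} {m} {ends} {ends′} v ends≡) = lift-model φ edge
  (λ φa φb → inj₁ (trans (sym (φ-just φa)) (φ-just φb)))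
  where
  φ : Fin (suc n) → Maybe (Fin n)
  φ w with v ≟ w
  ... | yes _  = nothing
  ... | no v≢w = just (punchOut v≢w)
  φ-punchIn : ∀ p → φ (punchIn v p) ≡ just p
  φ-punchIn p with v ≟ punchIn v p
  ... | yes v≡ = contradiction (sym v≡) (punchInᵢ≢i v p)
  ... | no v≢  = cong just (trans (punchOut-cong v refl) (punchOut-punchIn v))
  φ-just : ∀ {w p} → φ w ≡ just p → punchIn v p ≡ w
  φ-just {w} eq with v ≟ w
  φ-just refl | no v≢w = punchIn-punchOut v≢w
  edge : ∀ {p q} → Adj ends′ full p q → ∃[ a ] ∃[ b ] (φ a ≡ just p × φ b ≡ just q × Adj ends full a b)
  edge {p} {q} (g , _ , j) = punchIn v p , punchIn v q , φ-punchIn p , φ-punchIn q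
    , g , refl , Sum.map (λ eq → trans (ends≡ g) (cong (mapEnds (punchIn v)) eq))
                         (λ eq → trans (ends≡ g) (cong (mapEnds (punchIn v)) eq)) j

K₄-model : Model (Adj K₄-ends full)
K₄-model = record
  { β = just
  ; connected = λ { refl refl → ε }
  ; linked = λ {i} {j} i≢j → i , j , refl , refl , K₄-complete i j i≢j }

≅-model : ∀ {G H} → G ≅ H → Model (Adj (Graph.ends H) full) → Model (Adj (Graph.ends G) full)
≅-model {G} {H} iso = lift-model (just ∘ to) edge
  λ {_} {a} {b} φa φb → inj₁ (injective (just-injective (trans φa (sym φb))))
  where
  module G = Graph G
  module H = Graph H
  open _≅_ iso
  open Inverse vertices using (to; strictlyInverseʳ) renaming (from to from-v)
  injective : ∀ {a b} → to a ≡ to b → a ≡ b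
  injective {a} {b} eq = trans (sym (strictlyInverseʳ a)) (trans (cong from-v eq) (strictlyInverseʳ b))
  edge : ∀ {p q} → Adj H.ends full p q → ∃[ a ] ∃[ b ] (just (to a) ≡ just p × just (to b) ≡ just q × Adj G.ends full a b)
  edge {p} {q} (k , _ , j) = transfer (subst (λ k → Joins (H.ends k) (to s) (to t))
    (Inverse.strictlyInverseˡ edges k) (ends-≅ (Inverse.from edges k))) j
    where
    g = Inverse.from edges k
    s = proj₁ (G.ends g)
    t = proj₂ (G.ends g)
    transfer : ∀ {r} → Joins r (to s) (to t) → Joins r p q →
               ∃[ a ] ∃[ b ] (just (to a) ≡ just p × just (to b) ≡ just q × Adj G.ends full a b)
    transfer (inj₁ refl) (inj₁ refl) = s , t , refl , refl , g , refl , inj₁ refl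
    transfer (inj₁ refl) (inj₂ refl) = t , s , refl , refl , g , refl , inj₂ refl
    transfer (inj₂ refl) (inj₁ refl) = t , s , refl , refl , g , refl , inj₂ refl
    transfer (inj₂ refl) (inj₂ refl) = s , t , refl , refl , g , refl , inj₁ refl

K₄⇒model : ∀ {G} → HasMinor G K₄ → Model (Adj (Graph.ends G) full)
K₄⇒model (G′ , steps , iso) = along steps (≅-model iso K₄-model)
  where
  along : ∀ {G H} → Star _⟶_ G H → Model (Adj (Graph.ends H) full) → Model (Adj (Graph.ends G) full)
  along ε          M = M
  along (s ◅ rest) M = pull-model s (along rest M)

-- A non-integral optimum from a K₄ minor

weak-duality : ∀ {n} (S : System n) {w x y} → PrimalFeasible S x → DualFeasible S w y → w · x ≤ rhs S · y
weak-duality {n} S {w} {x} {y} x-feasible (columns , 0≤y) = begin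
  w · x
    ≡⟨ Rational.sum-cong-≗ (λ e → trans (cong (_* x e) (sym (columns e)))
         (trans (ℚ.*-comm ((λ i → matrix S i e) · y) (x e)) (sym (sum-scale (x e) (λ i → matrix S i e * y i))))) ⟩
  (Rational.sum λ e → Rational.sum λ i → x e * (matrix S i e * y i))
    ≡⟨ Rational.∑-comm (λ e i → x e * (matrix S i e * y i)) ⟩
  (Rational.sum λ i → Rational.sum λ e → x e * (matrix S i e * y i))
    ≡⟨ Rational.sum-cong-≗ (λ i → trans (Rational.sum-cong-≗ λ e → lemma (x e) (matrix S i e) (y i))
         (sum-scale (y i) (λ e → matrix S i e * x e))) ⟩
  (Rational.sum λ i → y i * (matrix S i · x))
    ≤⟨ sum-mono (λ i → subst (y i * (matrix S i · x) ≤_) (ℚ.*-comm (y i) (rhs S i))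
         (ℚ.*-monoˡ-≤-nonNeg (y i) {{ℚ.nonNegative (0≤y i)}} (x-feasible i))) ⟩
  rhs S · y ∎
  where
  open ℚ.≤-Reasoning
  lemma : ∀ x a y → x * (a * y) ≡ y * (a * x)
  lemma = solve-∀ ℚ-ring

-- Lets claims about the 64 edge sets of K₄ be settled by computation.
all-vectors? : ∀ k {P : Vec.Vec Bool k → Set} → (∀ b → Dec (P b)) → Dec (∀ b → P b)
all-vectors? zero P? with P? Vec.[]
... | yes p = yes λ { Vec.[] → p }
... | no ¬p = no λ all → ¬p (all Vec.[])
all-vectors? (suc k) P? with all-vectors? k (P? ∘ (false Vec.∷_)) | all-vectors? k (P? ∘ (true Vec.∷_))
... | yes p | yes q = yes λ { (false Vec.∷ b) → p b ; (true Vec.∷ b) → q b }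
... | no ¬p | _     = no λ all → ¬p λ b → all (false Vec.∷ b)
... | _     | no ¬q = no λ all → ¬q λ b → all (true Vec.∷ b)

-- The three edges at vertex 0 of K₄ come first, then the triangle 123.
x₆ p₆ : Fin 6 → ℚ
x₆ = lookup (ℚ.-½ Vec.∷ ℚ.-½ Vec.∷ ℚ.-½ Vec.∷ 1ℚ Vec.∷ 1ℚ Vec.∷ 1ℚ Vec.∷ Vec.[])
p₆ = lookup (0ℚ Vec.∷ 0ℚ Vec.∷ 0ℚ Vec.∷ ½ Vec.∷ ½ Vec.∷ ½ Vec.∷ Vec.[])

-- Half the sum of the three triangles through vertex 0 is 1 on the star of 0 and 1/2 on the
-- opposite triangle. Adding `w₆` leaves 0 and 1/2, which is `p₆`. The triangle is fixed at 1 by its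
-- bounds, while -1/2 lies strictly between the bounds -1 and 1 of the star, so the two solutions
-- are complementary.
w₆ ℓ₆ : Fin 6 → ℤ
w₆ = lookup (ℤ.-[1+ 0 ] Vec.∷ ℤ.-[1+ 0 ] Vec.∷ ℤ.-[1+ 0 ] Vec.∷ ℤ.+ 0 Vec.∷ ℤ.+ 0 Vec.∷ ℤ.+ 0 Vec.∷ Vec.[])
ℓ₆ = lookup (ℤ.-[1+ 0 ] Vec.∷ ℤ.-[1+ 0 ] Vec.∷ ℤ.-[1+ 0 ] Vec.∷ ℤ.+ 1 Vec.∷ ℤ.+ 1 Vec.∷ ℤ.+ 1 Vec.∷ Vec.[])

weight₆ : EdgeSet 6 → ℚ
weight₆ c = Rational.sum λ k → 𝟙 (c k) * x₆ k

-- The bound is the sum of the three negative entries; a single edge of value 2 outweighs it.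
weight₆-bound : ∀ c → ℚ.- (ℤ.+ 3 ℚ./ 2) ≤ weight₆ c
weight₆-bound c = subst (ℚ.- (ℤ.+ 3 ℚ./ 2) ≤_)
  (Rational.sum-cong-≗ λ k → cong (λ b → 𝟙 b * x₆ k) (lookup∘tabulate c k))
  (from-yes (all-vectors? 6 λ b → ℚ.- (ℤ.+ 3 ℚ./ 2) ℚ.≤? weight₆ (lookup b)) (tabulate c))

-- Nonempty even sets of K₄ are the triangles through vertex 0, of weight 0, the opposite triangle,
-- of weight 3, and the three 4-cycles, of weight 1.
weight₆-even : ∀ c → (∀ i → cut K₄-ends c (at i) ≡ false) → 0ℚ ≤ weight₆ c
weight₆-even c even = subst (0ℚ ≤_)
  (Rational.sum-cong-≗ λ k → cong (λ b → 𝟙 b * x₆ k) (lookup∘tabulate c k))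
  (from-yes (all-vectors? 6 λ b → all? (λ i → cut K₄-ends (lookup b) (at i) Bool.≟ false) →-dec
      (0ℚ ℚ.≤? weight₆ (lookup b))) (tabulate c)
    λ i → trans (cut-cong K₄-ends (lookup∘tabulate c) (at i)) (even i))

Integer-sum : ∀ {k} {f : Fin k → ℚ} → (∀ i → Integer (f i)) → Integer (Rational.sum f)
Integer-sum {zero}  f∈ℤ = ℤ.+ 0 , refl
Integer-sum {suc k} f∈ℤ with f∈ℤ zero | Integer-sum (f∈ℤ ∘ suc)
... | a , p | b , q = a ℤ.+ b , trans (cong₂ _+_ p q) (sym (fromℤ-+ a b))

three-halves∉ℤ : ¬ Integer (ℤ.+ 3 ℚ./ 2)
three-halves∉ℤ (z , eq) with cong ℚ.denominator-1 (trans eq (fromℤ≡integral z))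
... | ()

xor-ring : AlmostCommutativeRing _ _
xor-ring = fromCommutativeRing Bool.xor-∧-commutativeRing λ x → Maybe.map sym (dec⇒maybe (x Bool.≟ false))

module NonIntegralOptimum (G : Graph) (M : Model (Adj (Graph.ends G) full)) where

  open Graph G renaming (#E to m; #V to n)
  open Model M

  InBag : Fin m → Set
  InBag g = ∃[ i ] (β (proj₁ (ends g)) ≡ just i × β (proj₂ (ends g)) ≡ just i)

  in-bag? : ∀ g → Dec (InBag g)
  in-bag? g = any? λ i → ≡-decᴹ _≟_ (β (proj₁ (ends g))) (just i) ×-dec ≡-decᴹ _≟_ (β (proj₂ (ends g))) (just i)

  private
    link : ∀ k → _
    link k = linked (K₄-simple k)

  tail head : Fin 6 → Fin n
  tail k = proj₁ (link k)
  head k = proj₁ (proj₂ (link k))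

  tail∈ : ∀ k → β (tail k) ≡ just (proj₁ (K₄-ends k))
  tail∈ k = proj₁ (proj₂ (proj₂ (link k)))

  head∈ : ∀ k → β (head k) ≡ just (proj₂ (K₄-ends k))
  head∈ k = proj₁ (proj₂ (proj₂ (proj₂ (link k))))

  D : Fin 6 → Fin m
  D k = proj₁ (proj₂ (proj₂ (proj₂ (proj₂ (link k)))))

  D-joins : ∀ k → Joins (ends (D k)) (tail k) (head k)
  D-joins k = proj₂ (proj₂ (proj₂ (proj₂ (proj₂ (proj₂ (link k))))))

  β-unique : ∀ {v i j} → β v ≡ just i → β v ≡ just j → i ≡ j
  β-unique p q = just-injective (trans (sym p) q)

  D-injective : ∀ {k l} → D k ≡ D l → k ≡ l
  D-injective {k} {l} eq = K₄-edge-unique k l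
    (bags (subst (λ e → Joins (ends e) (tail k) (head k)) eq (D-joins k)) (D-joins l))
    where
    same : ∀ {u v i j} → u ≡ v → β u ≡ just i → β v ≡ just j → j ≡ i
    same refl p q = β-unique q p
    bags : ∀ {p} → Joins p (tail k) (head k) → Joins p (tail l) (head l) →
           Joins (K₄-ends l) (proj₁ (K₄-ends k)) (proj₂ (K₄-ends k))
    bags (inj₁ refl) (inj₁ eq) = inj₁ (cong₂ _,_ (same (cong proj₁ eq) (tail∈ k) (tail∈ l)) (same (cong proj₂ eq) (head∈ k) (head∈ l)))
    bags (inj₁ refl) (inj₂ eq) = inj₂ (cong₂ _,_ (same (cong proj₂ eq) (head∈ k) (tail∈ l)) (same (cong proj₁ eq) (tail∈ k) (head∈ l)))
    bags (inj₂ refl) (inj₁ eq) = inj₂ (cong₂ _,_ (same (cong proj₁ eq) (head∈ k) (tail∈ l)) (same (cong proj₂ eq) (tail∈ k) (head∈ l)))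
    bags (inj₂ refl) (inj₂ eq) = inj₁ (cong₂ _,_ (same (cong proj₂ eq) (tail∈ k) (tail∈ l)) (same (cong proj₁ eq) (head∈ k) (head∈ l)))

  D-not-in-bag : ∀ k → ¬ InBag (D k)
  D-not-in-bag k (i , p , q) = K₄-simple k (ends-equal (D-joins k))
    where
    at-end : ∀ {u v j} → u ≡ v → β u ≡ just i → β v ≡ just j → j ≡ i
    at-end refl p q = β-unique q p
    ends-equal : Joins (ends (D k)) (tail k) (head k) → proj₁ (K₄-ends k) ≡ proj₂ (K₄-ends k)
    ends-equal (inj₁ eq) = trans (at-end (cong proj₁ eq) p (tail∈ k)) (sym (at-end (cong proj₂ eq) q (head∈ k)))
    ends-equal (inj₂ eq) = trans (at-end (cong proj₂ eq) q (tail∈ k)) (sym (at-end (cong proj₁ eq) p (head∈ k)))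

  -- One edge for each pair of branch sets is chosen as a link. Further edges between the same two
  -- branch sets count as `outer`, like those with an end outside all branch sets.
  data Kind (g : Fin m) : Set where
    link-edge : ∀ k → D k ≡ g → Kind g
    inner     : (∀ k → D k ≢ g) → InBag g → Kind g
    outer     : (∀ k → D k ≢ g) → ¬ InBag g → Kind g

  kind : ∀ g → Kind g
  kind g with any? (λ k → D k ≟ g) | in-bag? g
  ... | yes (k , eq) | _    = link-edge k eq
  ... | no ¬D | yes in-bag  = inner (λ k eq → ¬D (k , eq)) in-bag
  ... | no ¬D | no ¬in-bag  = outer (λ k eq → ¬D (k , eq)) ¬in-bag

  module _ {A : Set} (onLink : Fin 6 → A) (onInner : Fin m → A) (onOuter : A) where

    by-kind : ∀ {g} → Kind g → A
    by-kind     (link-edge k _) = onLink k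
    by-kind {g} (inner _ _)     = onInner g
    by-kind     (outer _ _)     = onOuter

    by-kind-D : ∀ k (K : Kind (D k)) → by-kind K ≡ onLink k
    by-kind-D k (link-edge l eq) = cong onLink (D-injective eq)
    by-kind-D k (inner ¬D _)     = contradiction refl (¬D k)
    by-kind-D k (outer ¬D _)     = contradiction refl (¬D k)

  -- Edges inside the bags get value 0 (contraction), the remaining non-minor
  -- edges a value so large that no circuit through them is tight (deletion).
  x : Fin m → ℚ
  x g = by-kind x₆ (λ _ → 0ℚ) (ℤ.+ 2 ℚ./ 1) (kind g)

  w-of-kind u-of-kind : ∀ {g} → Kind g → ℤ
  w-of-kind = by-kind w₆ (λ _ → ℤ.+ 0) (ℤ.+ 0)
  u-of-kind = by-kind (λ _ → ℤ.+ 1) (λ _ → ℤ.+ 0) (ℤ.+ 2)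

  w ℓ u : Fin m → ℤ
  w g = w-of-kind (kind g)
  ℓ g = by-kind ℓ₆ (λ _ → ℤ.+ 0) (ℤ.+ 2) (kind g)
  u g = u-of-kind (kind g)

  ℓ≤x : ∀ g → fromℤ (ℓ g) ≤ x g
  ℓ≤x g with kind g
  ... | link-edge k _ = from-yes (all? λ k → fromℤ (ℓ₆ k) ℚ.≤? x₆ k) k
  ... | inner _ _     = ℚ.≤-refl
  ... | outer _ _     = ℚ.≤-refl

  x≤u : ∀ g → x g ≤ fromℤ (u g)
  x≤u g with kind g
  ... | link-edge k _ = from-yes (all? λ k → x₆ k ℚ.≤? 1ℚ) k
  ... | inner _ _     = ℚ.≤-refl
  ... | outer _ _     = ℚ.≤-refl

  bag : Fin 4 → Fin n → Bool
  bag i v = maybe (at i) false (β v)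

  -- Inner edges never cross the boundary of a branch set, so only links contribute, and a link
  -- crosses as its edge of K₄ does. Consequently an even set without outer edges leaves an even set
  -- on K₄.
  cut-bag : ∀ {C} → (∀ {g} → C g ≡ true → (∀ k → D k ≢ g) → InBag g) → ∀ i →
            cut ends C (bag i) ≡ cut K₄-ends (C ∘ D) (at i)
  cut-bag {C} no-outer i = trans (Xor.sum-support D D-injective (λ g → C g ∧ crosses (ends g) (bag i)) off)
    (Xor.sum-cong-≗ λ k → cong (C (D k) ∧_) (on-link {k} (D-joins k)))
    where
    off : ∀ g → (∀ k → D k ≢ g) → C g ∧ crosses (ends g) (bag i) ≡ false
    off g ¬D with C g in Cg
    ... | false = refl
    ... | true with no-outer Cg ¬D
    ...   | j , p , q = trans (cong₂ _xor_ (cong (maybe (at i) false) p) (cong (maybe (at i) false) q)) (Bool.xor-same (at i j))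
    on-link : ∀ {k} → Joins (ends (D k)) (tail k) (head k) → crosses (ends (D k)) (bag i) ≡ crosses (K₄-ends k) (at i)
    on-link {k} (inj₁ eq) = trans (cong (λ p → crosses p (bag i)) eq)
      (cong₂ _xor_ (cong (maybe (at i) false) (tail∈ k)) (cong (maybe (at i) false) (head∈ k)))
    on-link {k} (inj₂ eq) = trans (cong (λ p → crosses p (bag i)) eq)
      (trans (Bool.xor-comm (bag i (head k)) (bag i (tail k)))
      (cong₂ _xor_ (cong (maybe (at i) false) (tail∈ k)) (cong (maybe (at i) false) (head∈ k))))

  -- Either `C` has an outer edge, whose value 2 exceeds anything that the links can lose, or the
  -- links of `C` form an even set of K₄.
  even-nonneg : ∀ {C} → Even ends C → 0ℚ ≤ Rational.sum λ g → 𝟙 (C g) * x g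
  even-nonneg {C} C-even = subst (0ℚ ≤_) (sym split) (total (any? outer?))
    where
    on-links off-links : Fin m → ℚ
    on-links g  = by-kind (λ k → 𝟙 (C (D k)) * x₆ k) (λ _ → 0ℚ) 0ℚ (kind g)
    off-links g = by-kind (λ _ → 0ℚ) (λ _ → 0ℚ) (𝟙 (C g) * (ℤ.+ 2 ℚ./ 1)) (kind g)
    pointwise : ∀ g → 𝟙 (C g) * x g ≡ on-links g + off-links g
    pointwise g with kind g
    ... | link-edge k refl = sym (ℚ.+-identityʳ (𝟙 (C g) * x₆ k))
    ... | inner _ _        = ℚ.*-zeroʳ (𝟙 (C g))
    ... | outer _ _        = sym (ℚ.+-identityˡ (𝟙 (C g) * (ℤ.+ 2 ℚ./ 1)))
    on-links-sum : Rational.sum on-links ≡ weight₆ (C ∘ D)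
    on-links-sum = trans (Rational.sum-support D D-injective on-links off)
      (Rational.sum-cong-≗ λ k → by-kind-D (λ k → 𝟙 (C (D k)) * x₆ k) (λ _ → 0ℚ) 0ℚ k (kind (D k)))
      where
      off : ∀ g → (∀ k → D k ≢ g) → on-links g ≡ 0ℚ
      off g ¬D with kind g
      ... | link-edge k eq = contradiction eq (¬D k)
      ... | inner _ _      = refl
      ... | outer _ _      = refl
    split : Rational.sum (λ g → 𝟙 (C g) * x g) ≡ weight₆ (C ∘ D) + Rational.sum off-links
    split = trans (Rational.sum-cong-≗ pointwise)
      (trans (Rational.∑-distrib-+ on-links off-links) (cong (_+ Rational.sum off-links) on-links-sum))
    0≤𝟙*2 : ∀ b → 0ℚ ≤ 𝟙 b * (ℤ.+ 2 ℚ./ 1)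
    0≤𝟙*2 false = from-yes (0ℚ ℚ.≤? 0ℚ * (ℤ.+ 2 ℚ./ 1))
    0≤𝟙*2 true  = from-yes (0ℚ ℚ.≤? 1ℚ * (ℤ.+ 2 ℚ./ 1))
    0≤off-links : ∀ g → 0ℚ ≤ off-links g
    0≤off-links g with kind g
    ... | link-edge _ _ = ℚ.≤-refl
    ... | inner _ _     = ℚ.≤-refl
    ... | outer _ _     = 0≤𝟙*2 (C g)
    Outer : Fin m → Set
    Outer g = C g ≡ true × (∀ k → D k ≢ g) × ¬ InBag g
    outer? : ∀ g → Dec (Outer g)
    outer? g = (C g Bool.≟ true) ×-dec all? (λ k → ¬? (D k ≟ g)) ×-dec ¬? (in-bag? g)
    term≤sum : ∀ {k} (f : Fin k → ℚ) → (∀ i → 0ℚ ≤ f i) → ∀ i → f i ≤ Rational.sum f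
    term≤sum f 0≤f zero    = subst (_≤ f zero + Rational.sum (f ∘ suc)) (ℚ.+-identityʳ (f zero))
      (ℚ.+-monoʳ-≤ (f zero) (sum-nonneg (f ∘ suc) (0≤f ∘ suc)))
      where
      sum-nonneg : ∀ {k} (f : Fin k → ℚ) → (∀ i → 0ℚ ≤ f i) → 0ℚ ≤ Rational.sum f
      sum-nonneg {zero}  f 0≤f = ℚ.≤-refl
      sum-nonneg {suc k} f 0≤f = 0≤f zero ⊕ sum-nonneg (f ∘ suc) (0≤f ∘ suc)
    term≤sum f 0≤f (suc i) = subst (_≤ f zero + Rational.sum (f ∘ suc)) (ℚ.+-identityˡ (f (suc i)))
      (ℚ.+-mono-≤ (0≤f zero) (term≤sum (f ∘ suc) (0≤f ∘ suc) i))
    off-links-outer : ∀ {g} → Outer g → off-links g ≡ 1ℚ * (ℤ.+ 2 ℚ./ 1)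
    off-links-outer {g} (Cg , ¬D , ¬in) with kind g
    ... | link-edge k eq = contradiction eq (¬D k)
    ... | inner _ in-bag = contradiction in-bag ¬in
    ... | outer _ _      = cong (λ b → 𝟙 b * (ℤ.+ 2 ℚ./ 1)) Cg
    total : Dec (∃[ g ] Outer g) → 0ℚ ≤ weight₆ (C ∘ D) + Rational.sum off-links
    total (yes (g , g-outer)) = ℚ.≤-trans (from-yes (0ℚ ℚ.≤? ℚ.- (ℤ.+ 3 ℚ./ 2) + 1ℚ * (ℤ.+ 2 ℚ./ 1)))
      (ℚ.+-mono-≤ (weight₆-bound (C ∘ D))
        (subst (_≤ Rational.sum off-links) (off-links-outer g-outer) (term≤sum off-links 0≤off-links g)))
    total (no no-outer) = weight₆-even (C ∘ D) (λ i → trans (sym (cut-bag covered i)) (C-even (bag i))) ⊕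
      subst (_≤ Rational.sum off-links) (Rational.sum-zero {m} (λ _ → 0ℚ) λ _ → refl) (sum-mono {m} {λ _ → 0ℚ} {off-links} 0≤off-links)
      where
      covered : ∀ {g} → C g ≡ true → (∀ k → D k ≢ g) → InBag g
      covered {g} Cg ¬D with in-bag? g
      ... | yes in-bag = in-bag
      ... | no ¬in     = contradiction (g , Cg , ¬D , ¬in) no-outer

  open BoxedSystem G (fromℤ ∘ ℓ) (fromℤ ∘ u)

  x-feasible : PrimalFeasible S x
  x-feasible i = All.lookup satisfied (∈-lookup {xs = S} i)
    where
    Satisfied : Row m → Set
    Satisfied r = proj₁ r · x ≤ proj₂ r
    circuit-satisfied : ∀ {C} → Circuit G C → Satisfied ((λ e → ½ * χ C e) ≥ᵣ 0ℚ)
    circuit-satisfied {C} circ = subst (_≤ ℚ.- 0ℚ)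
      (sym (trans (neg-sum-* (λ e → ½ * χ C e) x) (cong (λ a → - a) (trans
        (Rational.sum-cong-≗ λ e → ℚ.*-assoc ½ (χ C e) (x e)) (sum-scale ½ (λ e → χ C e * x e))))))
      (ℚ.neg-antimono-≤ (ℚ.nonNegative⁻¹ ½ ⊗ even-nonneg (circuit⇒even ends (Circuit⇒circuit ends circ))))
    satisfied : All.All Satisfied S
    satisfied = Allₚ.++⁺
      (Allₚ.map⁺ (All.tabulate λ {C} C∈ → circuit-satisfied {C} (proj₂ (∈-filter⁻ (circuit? G) {xs = subsets m} C∈))))
      (Allₚ.++⁺
        (Allₚ.map⁺ (Allₚ.tabulate⁺ λ e → subst (_≤ - fromℤ (ℓ e))
          (sym (trans (neg-sum-* (unit e) x) (cong (λ a → - a) (sum-unit-row e x)))) (ℚ.neg-antimono-≤ (ℓ≤x e))))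
        (Allₚ.map⁺ (Allₚ.tabulate⁺ λ e → subst (_≤ fromℤ (u e)) (sym (sum-unit-row e x)) (x≤u e))))

  -- The edges of a walk counted modulo 2; its boundary is the two end vertices even if edges
  -- repeat, so no simple path has to be extracted.
  path-edges : ∀ {i a b} → Star (Within (Adj ends full) β i) a b →
               ∃[ F ] ((∀ S → cut ends F S ≡ S a xor S b) × (∀ {g} → F g ≡ true → InBag g))
  path-edges {a = a} ε = (λ _ → false)
    , (λ S → trans (Xor.sum-zero (λ g → false ∧ crosses (ends g) S) λ _ → refl) (sym (Bool.xor-same (S a))))
    , λ ()
  path-edges {i} {a} {b} (_◅_ {j = c} ((e , _ , e-joins) , a∈ , c∈) rest) with path-edges rest
  ... | F , F-cut , F-inner = single e △ F
    , (λ S → trans (cut-△ ends (single e) F S) (trans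
        (cong₂ _xor_ (trans (cut-single ends e S) (crosses-e S e-joins)) (F-cut S)) (lemma (S a) (S c) (S b))))
    , inner-edge
    where
    lemma : ∀ a c b → (a xor c) xor (c xor b) ≡ a xor b
    lemma = solve-∀ xor-ring
    crosses-e : ∀ S → Joins (ends e) a c → crosses (ends e) S ≡ S a xor S c
    crosses-e S (inj₁ eq) = cong (λ p → crosses p S) eq
    crosses-e S (inj₂ eq) = trans (cong (λ p → crosses p S) eq) (Bool.xor-comm (S c) (S a))
    e-inner : Joins (ends e) a c → InBag e
    e-inner (inj₁ eq) = i , trans (cong (β ∘ proj₁) eq) a∈ , trans (cong (β ∘ proj₂) eq) c∈
    e-inner (inj₂ eq) = i , trans (cong (β ∘ proj₁) eq) c∈ , trans (cong (β ∘ proj₂) eq) a∈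
    inner-edge : ∀ {g} → (single e △ F) g ≡ true → InBag g
    inner-edge {g} h with e ≟ g
    ... | yes refl = e-inner e-joins
    ... | no _     = F-inner h

  -- An even set whose link edges are those of the triangle k l r of K₄.
  module LiftedTriangle (k l r : Fin 6) (kl : proj₁ (K₄-ends k) ≡ proj₁ (K₄-ends l))
                        (kr : proj₂ (K₄-ends k) ≡ proj₁ (K₄-ends r)) (lr : proj₂ (K₄-ends l) ≡ proj₂ (K₄-ends r)) where

    -- At each of the three corners, two links may end at different vertices of the same branch set;
    -- a walk inside it closes the gap.
    P₁ = path-edges (connected (tail∈ k) (trans (tail∈ l) (cong just (sym kl))))
    P₂ = path-edges (connected (head∈ k) (trans (tail∈ r) (cong just (sym kr))))
    P₃ = path-edges (connected (head∈ l) (trans (head∈ r) (cong just (sym lr))))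

    links paths triangle : EdgeSet m
    links    = single (D k) △ single (D l) △ single (D r)
    paths    = proj₁ P₁ △ proj₁ P₂ △ proj₁ P₃
    triangle = links △ paths

    cut-D : ∀ k S → cut ends (single (D k)) S ≡ S (tail k) xor S (head k)
    cut-D k S = trans (cut-single ends (D k) S) (cases (D-joins k))
      where
      cases : Joins (ends (D k)) (tail k) (head k) → crosses (ends (D k)) S ≡ S (tail k) xor S (head k)
      cases (inj₁ eq) = cong (λ p → crosses p S) eq
      cases (inj₂ eq) = trans (cong (λ p → crosses p S) eq) (Bool.xor-comm (S (head k)) (S (tail k)))

    triangle-even : Even ends triangle
    triangle-even S = trans (cut-△ ends links paths S) (trans (cong₂ _xor_
      (trans (cut-△ ends (single (D k) △ single (D l)) (single (D r)) S)
        (cong₂ _xor_ (trans (cut-△ ends (single (D k)) (single (D l)) S) (cong₂ _xor_ (cut-D k S) (cut-D l S))) (cut-D r S)))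
      (trans (cut-△ ends (proj₁ P₁ △ proj₁ P₂) (proj₁ P₃) S)
        (cong₂ _xor_ (trans (cut-△ ends (proj₁ P₁) (proj₁ P₂) S)
          (cong₂ _xor_ (proj₁ (proj₂ P₁) S) (proj₁ (proj₂ P₂) S))) (proj₁ (proj₂ P₃) S))))
      (lemma (S (tail k)) (S (head k)) (S (tail l)) (S (head l)) (S (tail r)) (S (head r))))
      where
      lemma : ∀ a b c d e f → (((a xor b) xor (c xor d)) xor (e xor f)) xor
                              (((a xor c) xor (b xor e)) xor (d xor f)) ≡ false
      lemma = solve-∀ xor-ring

    paths-inner : ∀ {g} → ¬ InBag g → paths g ≡ false
    paths-inner {g} ¬in = cong₂ _xor_ (cong₂ _xor_
      (off (proj₂ (proj₂ P₁))) (off (proj₂ (proj₂ P₂)))) (off (proj₂ (proj₂ P₃)))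
      where
      off : ∀ {F : EdgeSet m} → (∀ {g} → F g ≡ true → InBag g) → F g ≡ false
      off F-inner = Bool.¬-not (¬in ∘ F-inner)

    triangle-D : ∀ s → triangle (D s) ≡ (single k △ single l △ single r) s
    triangle-D s = trans (cong (links (D s) xor_) (paths-inner (D-not-in-bag s)))
      (trans (Bool.xor-identityʳ (links (D s))) (cong₂ _xor_ (cong₂ _xor_ (single-D k) (single-D l)) (single-D r)))
      where
      single-D : ∀ k → single (D k) (D s) ≡ single k s
      single-D k with k ≟ s
      ... | yes refl = does-≟-refl (D k)
      ... | no k≢s   = does-≟-≢ (k≢s ∘ D-injective)

    triangle-outer : ∀ {g} → (∀ k → D k ≢ g) → ¬ InBag g → triangle g ≡ false
    triangle-outer {g} ¬D ¬in = cong₂ _xor_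
      (cong₂ _xor_ (cong₂ _xor_ (does-≟-≢ (¬D k)) (does-≟-≢ (¬D l))) (does-≟-≢ (¬D r))) (paths-inner ¬in)

  -- Lifts of the three triangles through vertex 0 of K₄, on which `x` is tight.
  module T₁ = LiftedTriangle 0F 1F 3F refl refl refl
  module T₂ = LiftedTriangle 0F 2F 4F refl refl refl
  module T₃ = LiftedTriangle 1F 2F 5F refl refl refl

  coverage : Fin m → ℕ
  coverage g = bit (T₁.triangle g) ℕ.+ (bit (T₂.triangle g) ℕ.+ bit (T₃.triangle g))

  coverage₆ : Fin 6 → ℕ
  coverage₆ s = bit ((single 0F △ single 1F △ single 3F) s) ℕ.+
    (bit ((single 0F △ single 2F △ single 4F) s) ℕ.+ bit ((single 1F △ single 2F △ single 5F) s))

  coverage-D : ∀ s → coverage (D s) ≡ coverage₆ s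
  coverage-D s = cong₂ (λ a b → bit a ℕ.+ b) (T₁.triangle-D s)
    (cong₂ (λ a b → bit a ℕ.+ bit b) (T₂.triangle-D s) (T₃.triangle-D s))

  coverage-outer : ∀ {g} → (∀ k → D k ≢ g) → ¬ InBag g → coverage g ≡ 0
  coverage-outer ¬D ¬in = cong₂ (λ a b → bit a ℕ.+ b) (T₁.triangle-outer ¬D ¬in)
    (cong₂ (λ a b → bit a ℕ.+ bit b) (T₂.triangle-outer ¬D ¬in) (T₃.triangle-outer ¬D ¬in))

  circuit-counts : ∃[ b ] (∀ e → Rational.sum (λ j → 𝟙 (circuitSet j e) * fromℤ (ℤ.+ b j)) ≡ fromℤ (ℤ.+ coverage e))
  circuit-counts = multiplicities (SumOf-+ (even⇒circuits {F = T₁.triangle} T₁.triangle-even)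
    (SumOf-+ (even⇒circuits {F = T₂.triangle} T₂.triangle-even) (even⇒circuits {F = T₃.triangle} T₃.triangle-even)))

  -- The lifted triangles also use inner edges. Both bounds of such an edge are 0, so its upper
  -- bound absorbs this flow at no cost.
  p-of-kind : ∀ {g} → Kind g → ℚ
  p-of-kind = by-kind p₆ (λ g → ½ * fromℤ (ℤ.+ coverage g)) 0ℚ

  p : Fin m → ℚ
  p g = p-of-kind (kind g)

  b : Fin N → ℚ
  b j = fromℤ (ℤ.+ proj₁ circuit-counts j)

  y : Fin (List.length S) → ℚ
  y = assemble b (λ _ → 0ℚ) p

  flow-y : ∀ g → flow (y ∘ iC) g ≡ ½ * fromℤ (ℤ.+ coverage g)
  flow-y g = trans (Rational.sum-cong-≗ λ j → trans
      (cong ((½ * 𝟙 (circuitSet j g)) *_) (assemble-C b (λ _ → 0ℚ) p j)) (ℚ.*-assoc ½ (𝟙 (circuitSet j g)) (b j)))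
    (trans (sum-scale ½ (λ j → 𝟙 (circuitSet j g) * b j)) (cong (½ *_) (proj₂ circuit-counts g)))

  balance : ∀ g (K : Kind g) → - (½ * fromℤ (ℤ.+ coverage g)) + (- 0ℚ + p-of-kind K) ≡ fromℤ (w-of-kind K)
  balance g (link-edge k refl) = trans (cong (λ c → - (½ * fromℤ (ℤ.+ c)) + (- 0ℚ + p₆ k)) (coverage-D k))
    (from-yes (all? λ k → (- (½ * fromℤ (ℤ.+ coverage₆ k)) + (- 0ℚ + p₆ k)) ℚ.≟ fromℤ (w₆ k)) k)
  balance g (inner _ _) = lemma (½ * fromℤ (ℤ.+ coverage g))
    where
    lemma : ∀ a → - a + (- 0ℚ + a) ≡ 0ℚ
    lemma = solve-∀ ℚ-ring
  balance g (outer ¬D ¬in) = cong (λ c → - (½ * fromℤ (ℤ.+ c)) + (- 0ℚ + 0ℚ)) (coverage-outer ¬D ¬in)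

  0≤p : ∀ {g} (K : Kind g) → 0ℚ ≤ p-of-kind K
  0≤p (link-edge k _)  = from-yes (all? λ k → 0ℚ ℚ.≤? p₆ k) k
  0≤p {g} (inner _ _)  = ℚ.nonNegative⁻¹ ½ ⊗ fromℤ-mono-≤ {ℤ.+ 0} {ℤ.+ coverage g} (ℤ.+≤+ ℕ.z≤n)
  0≤p (outer _ _)      = ℚ.≤-refl

  y-feasible : DualFeasible S (fromℤ ∘ w) y
  y-feasible =
      (λ g → trans (column g y) (trans (cong₂ (λ a d → - a + d) (flow-y g)
        (cong₂ (λ q p → - q + p) (assemble-L b (λ _ → 0ℚ) p g) (assemble-U b (λ _ → 0ℚ) p g))) (balance g (kind g))))
    , assemble-all b (λ _ → 0ℚ) p (0ℚ ≤_)
        (λ j → fromℤ-mono-≤ {ℤ.+ 0} {ℤ.+ proj₁ circuit-counts j} (ℤ.+≤+ ℕ.z≤n)) (λ _ → ℚ.≤-refl) (λ g → 0≤p (kind g))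

  primal-value : (fromℤ ∘ w) · x ≡ ℤ.+ 3 ℚ./ 2
  primal-value = trans (Rational.sum-support D D-injective (λ g → fromℤ (w g) * x g) off)
    (Rational.sum-cong-≗ λ k → cong₂ (λ a b → fromℤ a * b)
      (by-kind-D w₆ (λ _ → ℤ.+ 0) (ℤ.+ 0) k (kind (D k))) (by-kind-D x₆ (λ _ → 0ℚ) (ℤ.+ 2 ℚ./ 1) k (kind (D k))))
    where
    off : ∀ g → (∀ k → D k ≢ g) → fromℤ (w g) * x g ≡ 0ℚ
    off g ¬D with kind g
    ... | link-edge k eq = contradiction eq (¬D k)
    ... | inner _ _      = refl
    ... | outer _ _      = refl

  dual-value : rhs S · y ≡ ℤ.+ 3 ℚ./ 2
  dual-value = trans (value y) (trans (Rational.sum-cong-≗ term)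
    (trans (Rational.sum-support D D-injective (λ g → fromℤ (u g) * p g) λ g ¬D → off ¬D (kind g))
      (Rational.sum-cong-≗ λ k → cong₂ (λ a b → fromℤ a * b)
        (by-kind-D (λ _ → ℤ.+ 1) (λ _ → ℤ.+ 0) (ℤ.+ 2) k (kind (D k)))
        (by-kind-D p₆ (λ g → ½ * fromℤ (ℤ.+ coverage g)) 0ℚ k (kind (D k))))))
    where
    lemma : ∀ a l → a - l * 0ℚ ≡ a
    lemma = solve-∀ ℚ-ring
    term : ∀ g → fromℤ (u g) * y (iU g) - fromℤ (ℓ g) * y (iL g) ≡ fromℤ (u g) * p g
    term g = trans (cong₂ (λ a b → fromℤ (u g) * a - fromℤ (ℓ g) * b)
      (assemble-U b (λ _ → 0ℚ) p g) (assemble-L b (λ _ → 0ℚ) p g)) (lemma (fromℤ (u g) * p g) (fromℤ (ℓ g)))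
    off : ∀ {g} → (∀ k → D k ≢ g) → (K : Kind g) → fromℤ (u-of-kind K) * p-of-kind K ≡ 0ℚ
    off     ¬D (link-edge k eq) = contradiction eq (¬D k)
    off {g} ¬D (inner _ _)      = ℚ.*-zeroˡ (½ * fromℤ (ℤ.+ coverage g))
    off     ¬D (outer _ _)      = refl

  -- The halves in the circuit rows do not reach the objective, since these rows have right-hand
  -- side 0; only the integral bounds do.
  integral-value : ∀ (y : Fin (List.length S) → ℤ) → Integer (rhs S · (fromℤ ∘ y))
  integral-value y = subst Integer (sym (value (fromℤ ∘ y))) (Integer-sum λ e →
    u e ℤ.* y (iU e) ℤ.- ℓ e ℤ.* y (iL e) , sym (trans (fromℤ-sub (u e ℤ.* y (iU e)) (ℓ e ℤ.* y (iL e)))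
      (cong₂ _-_ (fromℤ-* (u e) (y (iU e))) (fromℤ-* (ℓ e) (y (iL e))))))

  maximum : IsMaximum (PrimalValue S (fromℤ ∘ w)) (ℤ.+ 3 ℚ./ 2)
  maximum = (x , x-feasible , primal-value) , λ v (x′ , x′-feasible , x′-value) →
    subst (_≤ ℤ.+ 3 ℚ./ 2) x′-value (subst (((fromℤ ∘ w) · x′) ≤_) dual-value (weak-duality S x′-feasible y-feasible))

  minimum : IsMinimum (DualValue S (fromℤ ∘ w)) (ℤ.+ 3 ℚ./ 2)
  minimum = (y , y-feasible , dual-value) , λ v (y′ , y′-feasible , y′-value) →
    subst (ℤ.+ 3 ℚ./ 2 ≤_) y′-value (subst (_≤ rhs S · y′) primal-value (weak-duality S x-feasible y′-feasible))

  not-box-TDI : ¬ BoxTDI (halfCircuitSystem G)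
  not-box-TDI box-TDI = refute (box-TDI (fromℤ ∘ ℓ) (fromℤ ∘ u) w (ℤ.+ 3 ℚ./ 2) maximum minimum)
    where
    refute : (∃[ y ] (DualFeasible S (fromℤ ∘ w) (fromℤ ∘ y) × rhs S · (fromℤ ∘ y) ≡ ℤ.+ 3 ℚ./ 2)) → ⊥
    refute (y , _ , y-value) = three-halves∉ℤ (subst Integer y-value (integral-value y))

proposition6p9 : (G : Graph) → BoxTDI (halfCircuitSystem G) ⇔ SeriesParallel G
proposition6p9 G = mk⇔
  (λ box-TDI minor → NonIntegralOptimum.not-box-TDI G (K₄⇒model minor) box-TDI)
  (λ no-minor → no-model⇒box-TDI G λ M → no-minor (model⇒K₄ (Graph.ends G) M))
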